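{- Let $W$ be a deterministic Wheeler graph with $m$ edges over an alphabet of size $\sigma$, let $|W|$ denote its total number of vertices and edges, let $k$ be a positive integer, and for $1\le\ell\le k$ let $n_\ell$ be the number of distinct $\ell$-mers contained in $W$. There exists a data structure for simulating navigation of the node-centric de Bruijn graph of the $k$-mers of $W$ which uses $$O\Big(n_k+|W|\,k\log\big(\max_{1\le\ell\le k} n_\ell\big)+\sigma\log m\Big)$$ bits of space, and which implements: retrieving the handle of a $k$-mer in $O(k\log\sigma)$ time; listing of outgoing labels (given the handle of a node) in $O(\log\sigma)$ time per label; and forward traversal (given the handle of a node and an outgoing label, returning the handle of the node reached) in $O(\log\sigma)$ time.
   Context: A labeled graph has a finite vertex set $V$ and an edge set $E\subseteq V\times V\times\Sigma$, where $\Sigma$ is a finite alphabet totally ordered by $\prec$; an edge $(u,v,a)$ goes from $u$ to $v$ and has label $a$. An $\ell$-mer is a string $\alpha\in\Sigma^\ell$. The graph contains $\alpha$, and $\alpha$ reaches the vertex $v_\ell$, if there is a walk $v_0,\dots,v_\ell$ with $(v_{i-1},v_i,\alpha[i])\in E$ for all $1\le i\le \ell$. Strings are compared co-lexicographically (right-to-left lexicographic order, "colex"). The graph is deterministic if no two distinct outgoing edges of the same vertex have the same label. It is a Wheeler graph if there is a total ordering $<$ of the nodes (a Wheeler order) such that nodes with no incoming edges precede those with positive indegree, and for every pair of edges $(u,v,a),(u',v',a')$: (W1) $a\prec a'\Rightarrow v<v'$; (W2) $(a=a'\wedge u<u')\Rightarrow v\le v'$. A Wheeler order is fixed. The node-centric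 de Bruijn graph of the $k$-mers of $W$ has one node for each distinct $k$-mer contained in $W$, and an edge labeled $c\in\Sigma$ from $b\alpha$ to $\alpha c$ (where $b\in\Sigma$, $|\alpha|=k-1$) whenever both are $k$-mers contained in $W$. The outgoing labels of a node are the labels of its outgoing edges. The handle of a $k$-mer $\alpha$ is the triple $(u,v,j)$, where $[u,v]$ is the maximal interval (in the Wheeler order) of vertices of $W$ that $\alpha$ reaches, and $j$ is the rank of $\alpha$ in the colex order of the distinct $k$-mers reaching the left endpoint $u$. Model of computation: Word RAM whose word size is large enough to hold the numbers handled, which are proportional to the maximum number of distinct $\ell$-mers in $W$ over $1\le\ell\le k$. -}

module Defs where

open import Data.Bool using (Bool; true; false; _∧_; _∨_; _xor_; if_then_else_)
open import Data.Fin as Fin using (Fin; toℕ)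
import Data.Fin.Properties as Fin
open import Data.List
  using (List; []; _∷_; length; filter; map; allFin; cartesianProductWith; take; drop; _++_; upTo)
open import Data.List.Extrema.Nat using (max)
open import Data.List.Membership.Propositional using (_∈_)
import Data.List.Membership.DecPropositional as DecMembership
open import Data.List.Relation.Unary.Unique.Propositional using (Unique)
open import Data.Maybe using (Maybe; just; nothing)
open import Data.Nat
open import Data.Nat.DivMod using (_/_; _%_)
open import Data.Nat.Logarithm using (⌈log₂_⌉)
open import Data.Nat.Properties using (m^n≢0)
open import Data.Product using (_×_; _,_; ∃-syntax)
open import Data.Product.Properties using (≡-dec)
open import Data.Sum using (_⊎_)
open import Data.Vec as Vec using (Vec; []; _∷_; _∷ʳ_; reverse)
import Data.Vec.Relation.Binary.Lex.Strict as Lex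
open import Level using (0ℓ)
open import Relation.Binary
  using (Rel; Decidable; IsStrictTotalOrder)
open import Relation.Binary.PropositionalEquality using (_≡_; refl)
open import Relation.Nullary using (¬_; Dec; does)
open import Relation.Nullary.Decidable using (_×-dec_; map′)
open import Function using (_∘_)

------------------------------------------------------------------------
-- Labeled graphs

-- The alphabet is Fin σ with its usual order.  Edges form a set: the list
-- has no repetitions and its order plays no role.
record LabeledGraph (σ : ℕ) : Set where
  field
    order  : ℕ
    edges  : List (Fin order × Fin order × Fin σ)
    unique : Unique edges

  Vertex : Set
  Vertex = Fin order

  Edge : Vertex → Vertex → Fin σ → Set
  Edge u v a = (u , v , a) ∈ edges

  edgeCount : ℕ
  edgeCount = length edges

  size : ℕ
  size = order + edgeCount

  HasIncoming : Vertex → Set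
  HasIncoming v = ∃[ u ] ∃[ a ] Edge u v a

  edge? : ∀ u v a → Dec (Edge u v a)
  edge? u v a = (u , v , a) ∈? edges
    where open DecMembership (≡-dec Fin._≟_ (≡-dec Fin._≟_ Fin._≟_)) using (_∈?_)

Deterministic : ∀ {σ} → LabeledGraph σ → Set
Deterministic G = ∀ {u v v′ a} → Edge u v a → Edge u v′ a → v ≡ v′
  where open LabeledGraph G

record WheelerOrder {σ} (G : LabeledGraph σ) : Set₁ where
  open LabeledGraph G
  infix 4 _≺_ _≼_
  field
    _≺_                : Rel Vertex 0ℓ
    isStrictTotalOrder : IsStrictTotalOrder _≡_ _≺_

  open IsStrictTotalOrder isStrictTotalOrder public using () renaming (_<?_ to _≺?_)

  _≼_ : Rel Vertex 0ℓ
  u ≼ v = u ≺ v ⊎ u ≡ v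

  field
    sources-first : ∀ {u v} → ¬ HasIncoming u → HasIncoming v → u ≺ v
    W1 : ∀ {u v a u′ v′ a′} → Edge u v a → Edge u′ v′ a′ → a Fin.< a′ → v ≺ v′
    W2 : ∀ {u v u′ v′ a} → Edge u v a → Edge u′ v′ a → u ≺ u′ → v ≼ v′

  position : Vertex → ℕ
  position v = length (filter (_≺? v) (allFin order))

------------------------------------------------------------------------
-- ℓ-mers

allMers : ∀ σ ℓ → List (Vec (Fin σ) ℓ)
allMers σ zero    = [] ∷ []
allMers σ (suc ℓ) = cartesianProductWith _∷_ (allFin σ) (allMers σ ℓ)

infix 4 _<colex_ _<colex?_

_<colex_ : ∀ {σ ℓ} → Rel (Vec (Fin σ) ℓ) 0ℓ
α <colex β = Lex.Lex-< _≡_ Fin._<_ (reverse α) (reverse β)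

_<colex?_ : ∀ {σ ℓ} → Decidable (_<colex_ {σ} {ℓ})
α <colex? β = Lex.<-decidable Fin._≟_ Fin._<?_ (reverse α) (reverse β)

module _ {σ} (G : LabeledGraph σ) where
  open LabeledGraph G

  infixr 5 _∷_
  data Walk : ∀ {ℓ} → Vertex → Vec (Fin σ) ℓ → Vertex → Set where
    []  : ∀ {u} → Walk u [] u
    _∷_ : ∀ {u x v a ℓ} {α : Vec (Fin σ) ℓ} →
          Edge u x a → Walk x α v → Walk u (a ∷ α) v

  Reaches : ∀ {ℓ} → Vec (Fin σ) ℓ → Vertex → Set
  Reaches α v = ∃[ u ] Walk u α v

  Contains : ∀ {ℓ} → Vec (Fin σ) ℓ → Set
  Contains α = ∃[ v ] Reaches α v

  walk? : ∀ {ℓ} u (α : Vec (Fin σ) ℓ) v → Dec (Walk u α v)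
  walk? u [] v = map′ (λ { refl → [] }) (λ { [] → refl }) (u Fin.≟ v)
  walk? u (a ∷ α) v =
    map′ (λ { (_ , e , p) → e ∷ p }) (λ { (e ∷ p) → _ , e , p })
         (Fin.any? λ x → edge? u x a ×-dec walk? x α v)

  reaches? : ∀ {ℓ} (α : Vec (Fin σ) ℓ) v → Dec (Reaches α v)
  reaches? α v = Fin.any? λ u → walk? u α v

  contains? : ∀ {ℓ} (α : Vec (Fin σ) ℓ) → Dec (Contains α)
  contains? α = Fin.any? λ v → reaches? α v

  merCount : ℕ → ℕ
  merCount ℓ = length (filter contains? (allMers σ ℓ))

  -- The maximum of merCount ℓ over 1 ≤ ℓ ≤ k.
  maxMerCount : ℕ → ℕ
  maxMerCount k = max 0 (map (merCount ∘ suc) (upTo k))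

  colexRank : ∀ {ℓ} → Vec (Fin σ) ℓ → Vertex → ℕ
  colexRank {ℓ} α v =
    suc (length (filter (λ β → reaches? β v ×-dec β <colex? α) (allMers σ ℓ)))

  -- Edges of the node-centric de Bruijn graph on the contained k-mers.
  data DBEdge : ∀ {k} → Vec (Fin σ) k → Fin σ → Vec (Fin σ) k → Set where
    edge : ∀ {k b c} {α : Vec (Fin σ) k} →
           Contains (b ∷ α) → Contains (α ∷ʳ c) → DBEdge (b ∷ α) c (α ∷ʳ c)

  OutgoingLabel : ∀ {k} → Vec (Fin σ) k → Fin σ → Set
  OutgoingLabel α c = ∃[ β ] DBEdge α c β

------------------------------------------------------------------------
-- Handles

record Handle {σ} (G : LabeledGraph σ) : Set where
  constructor ⟨_,_,_⟩
  field
    left right : LabeledGraph.Vertex G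
    index      : ℕ

module _ {σ} {G : LabeledGraph σ} (O : WheelerOrder G) where
  open LabeledGraph G
  open WheelerOrder O

  ReachesInterval : ∀ {ℓ} → Vec (Fin σ) ℓ → Vertex → Vertex → Set
  ReachesInterval α u v = u ≼ v × (∀ x → u ≼ x → x ≼ v → Reaches G α x)

  record IsHandle {ℓ} (α : Vec (Fin σ) ℓ) (h : Handle G) : Set where
    open Handle h
    field
      reached  : ReachesInterval α left right
      maximal  : ∀ u v → ReachesInterval α u v → left ≼ u × v ≼ right
      isRank   : index ≡ colexRank G α left

  -- A vertex is represented by its 0-based position in the Wheeler order.
  encodeHandle : Handle G → List ℕ
  encodeHandle ⟨ u , v , j ⟩ = position u ∷ position v ∷ j ∷ []

encodeLabels : ∀ {σ} → List (Fin σ) → List ℕ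
encodeLabels = map toℕ

encodeMer : ∀ {σ ℓ} → Vec (Fin σ) ℓ → List ℕ
encodeMer α = encodeLabels (Vec.toList α)

------------------------------------------------------------------------
-- Word RAM
--
-- Words are naturals below 2 ^ w.  There are registers, a read-only data
-- segment holding the (static) data structure, a read/write working memory
-- that initially holds the query, and an output stream of words.  Every
-- instruction takes one unit of time.

data Op : Set where
  add sub mul div mod and or xor shl shr eq lt : Op

data Instr : Set where
  const : (r n : ℕ) → Instr            -- r := n
  arith : Op → (r a b : ℕ) → Instr     -- r := a op b
  fetch : (r a : ℕ) → Instr            -- r := data[a]
  load  : (r a : ℕ) → Instr            -- r := memory[a]
  store : (a b : ℕ) → Instr            -- memory[a] := b
  emit  : (a : ℕ) → Instr              -- output a
  jump  : (target : ℕ) → Instr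
  jumpz : (a target : ℕ) → Instr       -- jump if a is zero
  halt  : Instr

Program : Set
Program = List Instr

record State : Set where
  field
    pc        : ℕ
    registers : ℕ → ℕ
    memory    : ℕ → ℕ
    output    : List ℕ

nth : List ℕ → ℕ → ℕ
nth []       _       = 0
nth (x ∷ _)  zero    = x
nth (_ ∷ xs) (suc i) = nth xs i

-- Running off the end of the program halts.
instrAt : Program → ℕ → Instr
instrAt []      _       = halt
instrAt (i ∷ _) zero    = i
instrAt (_ ∷ p) (suc n) = instrAt p n

update : (ℕ → ℕ) → ℕ → ℕ → ℕ → ℕ
update f i x j = if does (j ≟ i) then x else f j

bit : Bool → ℕ
bit true  = 1
bit false = 0

fromBits : List Bool → ℕ
fromBits []       = 0
fromBits (b ∷ bs) = bit b + 2 * fromBits bs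

-- The bits of the data structure are packed w to a word.
dataWord : ℕ → List Bool → ℕ → ℕ
dataWord w bits a = fromBits (take w (drop (a * w) bits))

bitwise : (Bool → Bool → Bool) → ℕ → ℕ → ℕ → ℕ
bitwise f zero    x y = 0
bitwise f (suc w) x y =
  bit (f (does (x % 2 ≟ 1)) (does (y % 2 ≟ 1))) + 2 * bitwise f w (x / 2) (y / 2)

wrap : ℕ → ℕ → ℕ
wrap w x = _%_ x (2 ^ w) {{m^n≢0 2 w}}

-- Division and remainder by zero give 0.
quotient remainder : ℕ → ℕ → ℕ
quotient  x zero    = 0
quotient  x (suc y) = x / suc y
remainder x zero    = 0
remainder x (suc y) = x % suc y

evalOp : ℕ → Op → ℕ → ℕ → ℕ
evalOp w add x y = wrap w (x + y)
evalOp w sub x y = wrap w ((x + 2 ^ w) ∸ y)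
evalOp w mul x y = wrap w (x * y)
evalOp w div x y = wrap w (quotient x y)
evalOp w mod x y = wrap w (remainder x y)
evalOp w and x y = bitwise _∧_ w x y
evalOp w or  x y = bitwise _∨_ w x y
evalOp w xor x y = bitwise _xor_ w x y
evalOp w shl x y = wrap w (x * 2 ^ y)
evalOp w shr x y = wrap w (_/_ x (2 ^ y) {{m^n≢0 2 y}})
evalOp w eq  x y = wrap w (bit (does (x ≟ y)))
evalOp w lt  x y = wrap w (bit (does (x <? y)))

module Machine (w : ℕ) (bits : List Bool) (p : Program) where

  -- nothing: the machine has halted.
  execute : Instr → State → Maybe State
  execute i s = go i
    where
    open State s
    set : ℕ → ℕ → Maybe State
    set r x = just record s { pc = suc pc ; registers = update registers r x }
    go : Instr → Maybe State
    go (const r n)      = set r (wrap w n)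
    go (arith op r a b) = set r (evalOp w op (registers a) (registers b))
    go (fetch r a)      = set r (dataWord w bits (registers a))
    go (load r a)       = set r (memory (registers a))
    go (store a b)      = just record s
      { pc = suc pc ; memory = update memory (registers a) (registers b) }
    go (emit a)         = just record s
      { pc = suc pc ; output = output ++ registers a ∷ [] }
    go (jump t)         = just record s { pc = t }
    go (jumpz a t)      = just record s
      { pc = if does (registers a ≟ 0) then t else suc pc }
    go halt             = nothing

  step : State → Maybe State
  step s = execute (instrAt p (State.pc s)) s

  -- s halts after at most t steps with the given output.
  data HaltsFrom : (t : ℕ) → State → List ℕ → Set where
    done : ∀ {t s} → step s ≡ nothing → HaltsFrom t s (State.output s)
    next : ∀ {t s s′ out} → step s ≡ just s′ → HaltsFrom t s′ out → HaltsFrom (suc t) s out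

  -- Register 0 initially holds the word size, so that programs can unpack
  -- the data segment; the query occupies the first cells of the memory.
  initial : List ℕ → State
  initial query = record
    { pc        = 0
    ; registers = update (λ _ → 0) 0 w
    ; memory    = nth query
    ; output    = []
    }

-- On the data structure bits, p answers query with out in time at most t.
Answers : (w : ℕ) (bits : List Bool) (p : Program) (query out : List ℕ) (t : ℕ) → Set
Answers w bits p query out t = HaltsFrom t (initial query) out
  where open Machine w bits p

------------------------------------------------------------------------
-- Resource bounds

-- Logarithms under O(·) are bounded below by 1.
lg : ℕ → ℕ
lg n = 1 ⊔ ⌈log₂ n ⌉

spaceBound : ∀ {σ} → LabeledGraph σ → ℕ → ℕ
spaceBound {σ} G k =
  merCount G k + size * k * lg (maxMerCount G k) + σ * lg edgeCount
  where open LabeledGraph G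

-- Words hold c times the largest ℓ-mer count and position in the structure.
WordSizeSuffices : ∀ {σ} → ℕ → LabeledGraph σ → ℕ → ℕ → Set
WordSizeSuffices c G k w = c * (maxMerCount G k + spaceBound G k) ≤ 2 ^ w

module _ {σ} {G : LabeledGraph σ} (O : WheelerOrder G) (k : ℕ)
         (w : ℕ) (bits : List Bool) where

  RetrievesHandles : Program → ℕ → Set
  RetrievesHandles p C =
    ∀ (α : Vec (Fin σ) k) → Contains G α →
    ∃[ h ] IsHandle O α h ×
           Answers w bits p (encodeMer α) (encodeHandle O h) (C * (k * lg σ))

  -- The additional label in the time bound pays for an empty listing.
  ListsOutgoingLabels : Program → ℕ → Set
  ListsOutgoingLabels p C =
    ∀ (α : Vec (Fin σ) k) h → IsHandle O α h →
    ∃[ cs ] Unique cs ×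
            (∀ c → (c ∈ cs → OutgoingLabel G α c) × (OutgoingLabel G α c → c ∈ cs)) ×
            Answers w bits p (encodeHandle O h) (encodeLabels cs)
                    (C * (suc (length cs) * lg σ))

  TraversesForward : Program → ℕ → Set
  TraversesForward p C =
    ∀ (α : Vec (Fin σ) k) h c β → IsHandle O α h → DBEdge G α c β →
    ∃[ h′ ] IsHandle O β h′ ×
            Answers w bits p (encodeHandle O h ++ toℕ c ∷ []) (encodeHandle O h′)
                    (C * lg σ)

{-# OPTIONS --safe #-}
module Submission where

-- Read strings from right to left: colex order becomes lexicographic order.  In a
-- Wheeler graph the vertices reached by a string form an interval, and strings
-- reaching a smaller vertex are not larger.  So the strings reaching the same
-- vertices (a class) are consecutive, and a class is determined by the left end of
-- its interval and by whether that is a single vertex: there are at most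
-- min (2 |V|, n_ℓ) classes of ℓ-mers.  A string is held as its class and its offset
-- in the class.  Appending a letter sends classes to classes and shifts offsets by
-- a constant, so that a table of at most 4 |E| arcs (class, letter) per length
-- describes it, and the arc is found by binary search in O(log σ) time.  Handles of
-- k-mers and (class, offset) pairs translate into each other by tables over classes.
-- The remaining step of a traversal, removing the first letter, is monotone in the
-- rank of the k-mer.  The class of the suffix and its rank among the (k-1)-mers
-- that extend to the right are therefore monotone sequences of length n_k, stored
-- in unary in O(n_k + |V|) bits with a small table for decoding blocks.  Finally,
-- r ≤ min (2 x, s) numbers below x take r log x = O(x log s) bits, which pays
-- for the vertex positions and for the alphabet.

-- The bound leaves O(1) bits for each k-mer, so whatever takes log n_ℓ bits has to be charged to a
-- vertex or an edge at one of the k lengths. This is possible because two distinct strings that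
-- reach a common vertex cannot both reach vertices on the same side of it. Hence a class of several
-- strings reaches a single vertex, and a class is recognized at any of its vertices by two bits.
-- The suffix ranks count only (k-1)-mers that extend to the right, because the number of all
-- (k-1)-mers is not bounded in terms of n_k; extensibility depends on the class alone, so offsets
-- agree in both countings. Arcs name a letter by its index among the labels that occur, since log σ
-- bits for every arc at every length would not fit. The three programs are fixed for all graphs;
-- besides the query and the data they receive only the word size, which is bounded from below but
-- not from above. So every parameter and every field width has to be read from the data.

open import Data.Bool using (Bool; true; false; if_then_else_)
import Data.Bool as Bool
import Data.Bool.Properties as Bool
open import Data.Empty using (⊥-elim)
open import Data.Fin as Fin using (Fin; zero; suc; toℕ)
import Data.Fin.Properties as Fin
open import Data.List as List
  using (List; []; _∷_; length; filter; map; allFin; cartesianProduct; cartesianProductWith;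
         concatMap; take; drop; _++_; upTo; replicate)
open import Data.List.Extrema.Nat using (max; xs≤max)
open import Data.List.Membership.Propositional using (_∈_)
open import Data.List.Membership.Propositional.Properties
  using (∈-filter⁺; ∈-filter⁻; ∈-map⁺; ∈-map⁻; ∈-allFin; ∈-upTo⁺; ∈-++⁺ˡ; ∈-++⁺ʳ; ∈-++⁻;
         ∈-∃++; ∈-cartesianProductWith⁺; ∈-cartesianProduct⁺; ∈-length; ∈-concatMap⁻)
import Data.List.Properties as List
open import Data.List.Relation.Unary.All as All using (All; []; _∷_)
import Data.List.Relation.Unary.All.Properties as All
open import Data.List.Relation.Unary.AllPairs as AllPairs using (AllPairs; []; _∷_)
import Data.List.Relation.Unary.AllPairs.Properties as AllPairs
open import Data.List.Relation.Unary.Any as Any using (Any; here; there)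
open import Data.List.Relation.Unary.Unique.Propositional using (Unique)
import Data.List.Relation.Unary.Unique.Propositional.Properties as Unique
open import Data.Maybe using (just; nothing)
open import Data.Nat
open import Data.Nat.DivMod hiding (result; _div_; _mod_)
open import Data.Nat.Divisibility using (divides; n∣m*n)
open import Data.Nat.Logarithm using (⌈log₂_⌉; ⌈log₂⌈n/2⌉⌉≡⌈log₂n⌉∸1; ⌈log₂⌉-mono-≤; ⌈log₂2^n⌉≡n)
open import Data.Nat.Properties
import Data.Nat.Solver
open import Data.Product using (_×_; _,_; ∃-syntax; proj₁; proj₂)
open import Data.Product.Properties using (≡-dec)
open import Data.Sum using (_⊎_; inj₁; inj₂; [_,_]′)
open import Data.Unit using (⊤; tt)
open import Data.Vec as Vec using (Vec; []; _∷_; _∷ʳ_; lookup; _[_]≔_; reverse)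
import Data.Vec.Properties as Vec
import Data.Vec.Relation.Unary.All as VecAll
import Data.Vec.Relation.Unary.All.Properties as VecAll
import Data.Vec.Relation.Binary.Lex.Strict as Lex
import Data.Vec.Relation.Binary.Pointwise.Inductive as Pointwise
import Relation.Binary.Construct.Flip.EqAndOrd as Flip
open import Function using (_∘_; id; _$_; case_of_)
open import Relation.Binary using (IsStrictTotalOrder; tri<; tri≈; tri>)
open import Relation.Binary.PropositionalEquality
  using (_≡_; _≢_; refl; sym; trans; cong; cong₂; subst; subst₂; isEquivalence; module ≡-Reasoning)
open import Relation.Nullary using (¬_; Dec; yes; no; does; contradiction)
open import Relation.Nullary.Decidable using (_×-dec_; _→-dec_; ¬?; dec-true; dec-false)
open import Defs
open Data.Nat.Solver.+-*-Solver using (solve; _:+_; _:*_; _:=_; con)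

-- Compilation to the word RAM

-- Expressions are compiled to static single assignment form, so that they
-- clobber no register below the first free one; call evaluates a closed body
-- on its arguments.
data Expr (n : ℕ) : Set where
  var      : Fin n → Expr n
  lit      : ℕ → Expr n
  wordSize : Expr n
  op       : Op → Expr n → Expr n → Expr n
  fetchE   : Expr n → Expr n
  loadE    : Expr n → Expr n
  call     : ∀ {m} → Expr m → Vec (Expr n) m → Expr n

data Simple : Set where
  const : (r n : ℕ) → Simple
  arith : Op → (r a b : ℕ) → Simple
  fetch : (r a : ℕ) → Simple
  load  : (r a : ℕ) → Simple

embed : Simple → Instr
embed (const r n)     = const r n
embed (arith o r a b) = arith o r a b
embed (fetch r a)     = fetch r a
embed (load r a)      = load r a

record Compiled (A : Set) : Set where
  constructor compiled
  field
    instrs   : List Simple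
    result : A
    free   : ℕ
open Compiled

compileExpr : ∀ {n} → Vec ℕ n → ℕ → Expr n → Compiled ℕ
compileArgs : ∀ {n m} → Vec ℕ n → ℕ → Vec (Expr n) m → Compiled (Vec ℕ m)
compileExpr rs t (var i)    = compiled [] (lookup rs i) t
compileExpr rs t (lit n)    = compiled (const t n ∷ []) t (suc t)
compileExpr rs t wordSize   = compiled [] 0 t
compileExpr rs t (op o a b) =
  let A = compileExpr rs t a
      B = compileExpr rs (free A) b
  in compiled (instrs A ++ instrs B ++ arith o (free B) (result A) (result B) ∷ [])
              (free B) (suc (free B))
compileExpr rs t (fetchE a) =
  let A = compileExpr rs t a
  in compiled (instrs A ++ fetch (free A) (result A) ∷ []) (free A) (suc (free A))
compileExpr rs t (loadE a) =
  let A = compileExpr rs t a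
  in compiled (instrs A ++ load (free A) (result A) ∷ []) (free A) (suc (free A))
compileExpr rs t (call f as) =
  let A = compileArgs rs t as
      F = compileExpr (result A) (free A) f
  in compiled (instrs A ++ instrs F) (result F) (free F)
compileArgs rs t []       = compiled [] [] t
compileArgs rs t (a ∷ as) =
  let A  = compileExpr rs t a
      As = compileArgs rs (free A) as
  in compiled (instrs A ++ instrs As) (result A ∷ result As) (free As)

cost  : ∀ {n} → Expr n → ℕ
costs : ∀ {n m} → Vec (Expr n) m → ℕ
cost (var i)     = 0
cost (lit n)     = 1
cost wordSize    = 0
cost (op o a b)  = cost a + (cost b + 1)
cost (fetchE a)  = cost a + 1
cost (loadE a)   = cost a + 1
cost (call f as) = costs as + cost f
costs []         = 0
costs (a ∷ as)   = cost a + costs as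

cost-code : ∀ {n} (rs : Vec ℕ n) t e → length (instrs (compileExpr rs t e)) ≡ cost e
costs-code : ∀ {n m} (rs : Vec ℕ n) t (es : Vec (Expr n) m) →
             length (instrs (compileArgs rs t es)) ≡ costs es
cost-code rs t (var i)    = refl
cost-code rs t (lit n)    = refl
cost-code rs t wordSize   = refl
cost-code rs t (op o a b) =
  trans (List.length-++ (instrs (compileExpr rs t a)))
    (cong₂ _+_ (cost-code rs t a)
      (trans (List.length-++ (instrs (compileExpr rs _ b))) (cong (_+ 1) (cost-code rs _ b))))
cost-code rs t (fetchE a) =
  trans (List.length-++ (instrs (compileExpr rs t a))) (cong (_+ 1) (cost-code rs t a))
cost-code rs t (loadE a) =
  trans (List.length-++ (instrs (compileExpr rs t a))) (cong (_+ 1) (cost-code rs t a))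
cost-code rs t (call f as) =
  trans (List.length-++ (instrs (compileArgs rs t as)))
    (cong₂ _+_ (costs-code rs t as) (cost-code _ _ f))
costs-code rs t []       = refl
costs-code rs t (a ∷ as) =
  trans (List.length-++ (instrs (compileExpr rs t a)))
    (cong₂ _+_ (cost-code rs t a) (costs-code rs _ as))

update-same : ∀ f i x → update f i x i ≡ x
update-same f i x rewrite dec-true (i ≟ i) refl = refl

update-other : ∀ f i x {j} → j ≢ i → update f i x j ≡ f j
update-other f i x {j} j≢i rewrite dec-false (j ≟ i) j≢i = refl

data Stmt (v : ℕ) : Set where
  _≔_    : Fin v → Expr v → Stmt v
  output : Expr v → Stmt v
  _⨾_    : Stmt v → Stmt v → Stmt v
  while  : Expr v → Stmt v → Stmt v

infix  6 _≔_
infixr 5 _⨾_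

-- Register 0 keeps the word size and register 1 + i the variable i.
registersOf : ∀ v → Vec ℕ v
registersOf v = Vec.tabulate (suc ∘ toℕ)

-- Temporaries start at register `suc v`, above the variables. A move is an addition of zero, as the
-- machine has no copy instruction; this is why an assigned value has to be a proper word. Jump
-- targets are absolute, hence the parameter for the address of the code.
compileStmt : ∀ {v} → ℕ → Stmt v → List Instr
compileStmt {v} pc (i ≔ e) =
  let E = compileExpr (registersOf v) (suc v) e
  in map embed (instrs E) ++ const (free E) 0 ∷ arith add (suc (toℕ i)) (result E) (free E) ∷ []
compileStmt {v} pc (output e) =
  let E = compileExpr (registersOf v) (suc v) e
  in map embed (instrs E) ++ emit (result E) ∷ []
compileStmt pc (a ⨾ b) =
  let A = compileStmt pc a
  in A ++ compileStmt (pc + length A) b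
compileStmt {v} pc (while e b) =
  let E = compileExpr (registersOf v) (suc v) e
      B = compileStmt (pc + (length (map embed (instrs E)) + 1)) b
      end = pc + (length (map embed (instrs E)) + (1 + (length B + 1)))
  in map embed (instrs E) ++ jumpz (result E) end ∷ B ++ jump pc ∷ []

-- Big-step semantics, and correctness of compiled expressions

module Semantics (w : ℕ) (datum mem : ℕ → ℕ) where

  ⟦_⟧  : ∀ {n} → Expr n → Vec ℕ n → ℕ
  ⟦_⟧* : ∀ {n m} → Vec (Expr n) m → Vec ℕ n → Vec ℕ m
  ⟦ var i ⟧     ρ = lookup ρ i
  ⟦ lit n ⟧     ρ = wrap w n
  ⟦ wordSize ⟧  ρ = w
  ⟦ op o a b ⟧  ρ = evalOp w o (⟦ a ⟧ ρ) (⟦ b ⟧ ρ)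
  ⟦ fetchE a ⟧  ρ = datum (⟦ a ⟧ ρ)
  ⟦ loadE a ⟧   ρ = mem (⟦ a ⟧ ρ)
  ⟦ call f as ⟧ ρ = ⟦ f ⟧ (⟦ as ⟧* ρ)
  ⟦ [] ⟧*     ρ = []
  ⟦ a ∷ as ⟧* ρ = ⟦ a ⟧ ρ ∷ ⟦ as ⟧* ρ

  infix 4 _⊢_⇓_/_in-time_
  -- Time counts machine steps exactly: two for the copy in an assignment, one for each test of a
  -- loop condition, one for each jump back. `mem` is fixed because no statement stores, so the
  -- query stays readable throughout.
  data _⊢_⇓_/_in-time_ {v : ℕ} : Vec ℕ v → Stmt v → Vec ℕ v → List ℕ → ℕ → Set where
    assign : ∀ {s i e x} → ⟦ e ⟧ s ≡ x → x < 2 ^ w →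
             s ⊢ i ≔ e ⇓ s [ i ]≔ x / [] in-time (cost e + 2)
    emits  : ∀ {s e x} → ⟦ e ⟧ s ≡ x → s ⊢ output e ⇓ s / x ∷ [] in-time (cost e + 1)
    seq    : ∀ {s s₁ s₂ o₁ o₂ t₁ t₂ a b} →
             s ⊢ a ⇓ s₁ / o₁ in-time t₁ → s₁ ⊢ b ⇓ s₂ / o₂ in-time t₂ →
             s ⊢ a ⨾ b ⇓ s₂ / (o₁ ++ o₂) in-time (t₁ + t₂)
    stop   : ∀ {s e b} → ⟦ e ⟧ s ≡ 0 → s ⊢ while e b ⇓ s / [] in-time (cost e + 1)
    loop   : ∀ {s s₁ s₂ o₁ o₂ t₁ t₂ e b} → ⟦ e ⟧ s ≢ 0 →
             s ⊢ b ⇓ s₁ / o₁ in-time t₁ → s₁ ⊢ while e b ⇓ s₂ / o₂ in-time t₂ →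
             s ⊢ while e b ⇓ s₂ / (o₁ ++ o₂) in-time (cost e + 1 + (t₁ + (1 + t₂)))

  run1 : Simple → (ℕ → ℕ) → ℕ → ℕ
  run1 (const r n)     f = update f r (wrap w n)
  run1 (arith o r a b) f = update f r (evalOp w o (f a) (f b))
  run1 (fetch r a)     f = update f r (datum (f a))
  run1 (load r a)      f = update f r (mem (f a))

  runs : List Simple → (ℕ → ℕ) → ℕ → ℕ
  runs []       f = f
  runs (i ∷ is) f = runs is (run1 i f)

  runs-++ : ∀ is js f → runs (is ++ js) f ≡ runs js (runs is f)
  runs-++ []       js f = refl
  runs-++ (i ∷ is) js f = runs-++ is js (run1 i f)

  record Represents {n} (rs : Vec ℕ n) (t : ℕ) (f : ℕ → ℕ) (ρ : Vec ℕ n) : Set where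
    field
      below   : ∀ i → lookup rs i < t
      values  : ∀ i → f (lookup rs i) ≡ lookup ρ i
      nonzero : 0 < t
      zeroth  : f 0 ≡ w
  open Represents

  record Computes (t : ℕ) (C : Compiled ℕ) (x : ℕ) (f : ℕ → ℕ) : Set where
    field
      grows     : t ≤ free C
      bounded   : result C < free C
      computes  : runs (instrs C) f (result C) ≡ x
      preserves : ∀ j → j < t → runs (instrs C) f j ≡ f j
  open Computes

  record ComputesAll {m} (t : ℕ) (C : Compiled (Vec ℕ m)) (xs : Vec ℕ m) (f : ℕ → ℕ) : Set where
    field
      grows*     : t ≤ free C
      bounded*   : ∀ i → lookup (result C) i < free C
      computes*  : ∀ i → runs (instrs C) f (lookup (result C) i) ≡ lookup xs i
      preserves* : ∀ j → j < t → runs (instrs C) f j ≡ f j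
  open ComputesAll

  step-represents : ∀ {n} {rs : Vec ℕ n} {t f ρ t′ is} → Represents rs t f ρ → t ≤ t′ →
                    (∀ j → j < t → runs is f j ≡ f j) → Represents rs t′ (runs is f) ρ
  step-represents R t≤t′ pres = record
    { below   = λ i → <-≤-trans (below R i) t≤t′
    ; values  = λ i → trans (pres _ (below R i)) (values R i)
    ; nonzero = <-≤-trans (nonzero R) t≤t′
    ; zeroth  = trans (pres 0 (nonzero R)) (zeroth R)
    }

  -- The invariant of the induction is that only registers from `t` on are written: the result of an
  -- operand lies below the register at which the code of the next one starts, and so survives it. A
  -- called body finds its arguments in place, without copying.
  compileExpr-correct : ∀ {n} {rs : Vec ℕ n} {t f ρ} (e : Expr n) → Represents rs t f ρ →
                        Computes t (compileExpr rs t e) (⟦ e ⟧ ρ) f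
  compileArgs-correct : ∀ {n m} {rs : Vec ℕ n} {t f ρ} (es : Vec (Expr n) m) →
                        Represents rs t f ρ →
                        ComputesAll t (compileArgs rs t es) (⟦ es ⟧* ρ) f
  compileExpr-correct (var i) R = record
    { grows = ≤-refl ; bounded = below R i ; computes = values R i ; preserves = λ _ _ → refl }
  compileExpr-correct {t = t} {f} (lit n) R = record
    { grows = n≤1+n t ; bounded = ≤-refl ; computes = update-same f t (wrap w n)
    ; preserves = λ j j<t → update-other f t _ (<⇒≢ j<t) }
  compileExpr-correct wordSize R = record
    { grows = ≤-refl ; bounded = nonzero R ; computes = zeroth R ; preserves = λ _ _ → refl }
  compileExpr-correct {rs = rs} {t} {f} {ρ} (op o a b) R = record
    { grows = ≤-trans (≤-trans (grows CA) (grows CB)) (n≤1+n _)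
    ; bounded = ≤-refl
    ; computes = begin
        runs (instrs A ++ instrs B ++ last) f (free B)       ≡⟨ cong (_$ free B) split ⟩
        runs last g (free B)                             ≡⟨ update-same g (free B) _ ⟩
        evalOp w o (g (result A)) (g (result B))
          ≡⟨ cong₂ (evalOp w o) (trans (preserves CB _ (bounded CA)) (computes CA)) (computes CB) ⟩
        evalOp w o (⟦ a ⟧ ρ) (⟦ b ⟧ ρ) ∎
    ; preserves = λ j j<t → begin
        runs (instrs A ++ instrs B ++ last) f j ≡⟨ cong (_$ j) split ⟩
        runs last g j
          ≡⟨ update-other g (free B) _ (<⇒≢ (<-≤-trans j<t (≤-trans (grows CA) (grows CB)))) ⟩
        g j                                 ≡⟨ preserves CB j (<-≤-trans j<t (grows CA)) ⟩
        runs (instrs A) f j                   ≡⟨ preserves CA j j<t ⟩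
        f j ∎
    }
    where
    open ≡-Reasoning
    A = compileExpr rs t a
    CA = compileExpr-correct a R
    B = compileExpr rs (free A) b
    CB = compileExpr-correct b (step-represents {is = instrs A} R (grows CA) (preserves CA))
    last = arith o (free B) (result A) (result B) ∷ []
    g = runs (instrs B) (runs (instrs A) f)
    split : runs (instrs A ++ instrs B ++ last) f ≡ runs last g
    split = trans (runs-++ (instrs A) _ f) (runs-++ (instrs B) last _)
  compileExpr-correct {rs = rs} {t} {f} {ρ} (fetchE a) R = record
    { grows = ≤-trans (grows CA) (n≤1+n _)
    ; bounded = ≤-refl
    ; computes = trans (cong (_$ free A) split)
        (trans (update-same g (free A) _) (cong datum (computes CA)))
    ; preserves = λ j j<t → trans (cong (_$ j) split)
        (trans (update-other g (free A) _ (<⇒≢ (<-≤-trans j<t (grows CA)))) (preserves CA j j<t))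
    }
    where
    A = compileExpr rs t a
    CA = compileExpr-correct a R
    g = runs (instrs A) f
    split = runs-++ (instrs A) (fetch (free A) (result A) ∷ []) f
  compileExpr-correct {rs = rs} {t} {f} {ρ} (loadE a) R = record
    { grows = ≤-trans (grows CA) (n≤1+n _)
    ; bounded = ≤-refl
    ; computes = trans (cong (_$ free A) split)
        (trans (update-same g (free A) _) (cong mem (computes CA)))
    ; preserves = λ j j<t → trans (cong (_$ j) split)
        (trans (update-other g (free A) _ (<⇒≢ (<-≤-trans j<t (grows CA)))) (preserves CA j j<t))
    }
    where
    A = compileExpr rs t a
    CA = compileExpr-correct a R
    g = runs (instrs A) f
    split = runs-++ (instrs A) (load (free A) (result A) ∷ []) f
  compileExpr-correct {rs = rs} {t} {f} {ρ} (call e as) R = record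
    { grows = ≤-trans (grows* CA) (grows CF)
    ; bounded = bounded CF
    ; computes = trans (cong (_$ result F) split) (computes CF)
    ; preserves = λ j j<t → trans (cong (_$ j) split)
        (trans (preserves CF j (<-≤-trans j<t (grows* CA))) (preserves* CA j j<t))
    }
    where
    A = compileArgs rs t as
    CA = compileArgs-correct as R
    F = compileExpr (result A) (free A) e
    CF : Computes (free A) F (⟦ e ⟧ (⟦ as ⟧* ρ)) (runs (instrs A) f)
    CF = compileExpr-correct e record
      { below = bounded* CA ; values = computes* CA
      ; nonzero = <-≤-trans (nonzero R) (grows* CA)
      ; zeroth = trans (preserves* CA 0 (nonzero R)) (zeroth R) }
    split = runs-++ (instrs A) (instrs F) f
  compileArgs-correct [] R = record
    { grows* = ≤-refl ; bounded* = λ () ; computes* = λ () ; preserves* = λ _ _ → refl }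
  compileArgs-correct {rs = rs} {t} {f} (a ∷ as) R = record
    { grows* = ≤-trans (grows CA) (grows* CB)
    ; bounded* = λ where
        zero    → <-≤-trans (bounded CA) (grows* CB)
        (suc i) → bounded* CB i
    ; computes* = λ where
        zero    → trans (cong (_$ result A) split)
                    (trans (preserves* CB _ (bounded CA)) (computes CA))
        (suc i) → trans (cong (_$ lookup (result B) i) split) (computes* CB i)
    ; preserves* = λ j j<t → trans (cong (_$ j) split)
        (trans (preserves* CB j (<-≤-trans j<t (grows CA))) (preserves CA j j<t))
    }
    where
    A = compileExpr rs t a
    CA = compileExpr-correct a R
    B = compileArgs rs (free A) as
    CB = compileArgs-correct as (step-represents {is = instrs A} R (grows CA) (preserves CA))
    split = runs-++ (instrs A) (instrs B) f

instrAt-++ : ∀ (pre : Program) {i post} → instrAt (pre ++ i ∷ post) (length pre) ≡ i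
instrAt-++ []        = refl
instrAt-++ (_ ∷ pre) = instrAt-++ pre

instrAt-end : ∀ (p : Program) → instrAt p (length p) ≡ halt
instrAt-end []      = refl
instrAt-end (_ ∷ p) = instrAt-end p

-- Simulation of statements by the machine

module Execution (w : ℕ) (bits : List Bool) (mem : ℕ → ℕ) (p : Program) where
  open Machine w bits p
  open Semantics w (dataWord w bits) mem

  infix 4 _⟶[_]_
  data _⟶[_]_ : State → ℕ → State → Set where
    idle : ∀ {s} → s ⟶[ 0 ] s
    _then_ : ∀ {s s₁ s₂ t} → step s ≡ just s₁ → s₁ ⟶[ t ] s₂ → s ⟶[ suc t ] s₂

  ⟶-trans : ∀ {s s₁ s₂ t₁ t₂} → s ⟶[ t₁ ] s₁ → s₁ ⟶[ t₂ ] s₂ → s ⟶[ t₁ + t₂ ] s₂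
  ⟶-trans idle       q = q
  ⟶-trans (x then r) q = x then ⟶-trans r q

  ⟶-halts : ∀ {s s₁ t t′} → s ⟶[ t ] s₁ → step s₁ ≡ nothing → t ≤ t′ →
             HaltsFrom t′ s (State.output s₁)
  ⟶-halts idle       h t≤t′       = done h
  ⟶-halts (x then r) h (s≤s t≤t′) = next x (⟶-halts r h t≤t′)

  -- Registers are compared pointwise: chains of `update` with the same values are not provably
  -- equal as functions. The memory is never updated, so equality is available there.
  record _at_/_/_ (s : State) (pc : ℕ) (f : ℕ → ℕ) (out : List ℕ) : Set where
    field
      pc≡     : State.pc s ≡ pc
      regs≡   : ∀ i → State.registers s i ≡ f i
      mem≡    : State.memory s ≡ mem
      output≡ : State.output s ≡ out
  open _at_/_/_

  update-cong : ∀ {f g : ℕ → ℕ} → (∀ i → f i ≡ g i) → ∀ r {x y} → x ≡ y →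
                ∀ i → update f r x i ≡ update g r y i
  update-cong f≡g r refl i with does (i ≟ r)
  ... | true  = refl
  ... | false = f≡g i

  step-simple : ∀ {pre post s f out} i → p ≡ pre ++ embed i ∷ post → s at length pre / f / out →
                ∃[ s′ ] step s ≡ just s′ × s′ at suc (length pre) / run1 i f / out
  step-simple {pre} {post} {record { pc = pc ; registers = g ; memory = m ; output = o }} i refl
    record { pc≡ = refl ; regs≡ = g≡f ; mem≡ = refl ; output≡ = refl }
    rewrite instrAt-++ pre {embed i} {post} with i
  ... | const r n = _ , refl , record
    { pc≡ = refl ; regs≡ = update-cong g≡f r refl ; mem≡ = refl ; output≡ = refl }
  ... | arith o r a b = _ , refl , record
    { pc≡ = refl ; regs≡ = update-cong g≡f r (cong₂ (evalOp w o) (g≡f a) (g≡f b))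
    ; mem≡ = refl ; output≡ = refl }
  ... | fetch r a = _ , refl , record
    { pc≡ = refl ; regs≡ = update-cong g≡f r (cong (dataWord w bits) (g≡f a))
    ; mem≡ = refl ; output≡ = refl }
  ... | load r a = _ , refl , record
    { pc≡ = refl ; regs≡ = update-cong g≡f r (cong mem (g≡f a)) ; mem≡ = refl ; output≡ = refl }

  length-snoc : ∀ (pre : Program) i → length (pre ++ i ∷ []) ≡ suc (length pre)
  length-snoc pre i = trans (List.length-++ pre) (+-comm (length pre) 1)

  simulates-simple : ∀ is {pre post s f out} → p ≡ pre ++ map embed is ++ post →
    s at length pre / f / out →
    ∃[ s′ ] s ⟶[ length is ] s′ × s′ at length (pre ++ map embed is) / runs is f / out
  simulates-simple [] {pre} p≡ at-s =
    _ , idle , record { pc≡ = trans (pc≡ at-s) (cong length (sym (List.++-identityʳ pre)))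
                      ; regs≡ = regs≡ at-s ; mem≡ = mem≡ at-s ; output≡ = output≡ at-s }
  simulates-simple (i ∷ is) {pre} {post} p≡ at-s
    with step-simple {pre} i p≡ at-s
  ... | s₁ , st , at-s₁
    with simulates-simple is {pre ++ embed i ∷ []} {post}
           (trans p≡ (sym (List.++-assoc pre (embed i ∷ []) _)))
           (record { pc≡ = trans (pc≡ at-s₁) (sym (length-snoc pre (embed i)))
                   ; regs≡ = regs≡ at-s₁ ; mem≡ = mem≡ at-s₁ ; output≡ = output≡ at-s₁ })
  ... | s₂ , run , at-s₂ = s₂ , st then run , record
    { pc≡ = trans (pc≡ at-s₂) (cong length (List.++-assoc pre (embed i ∷ []) (map embed is)))
    ; regs≡ = regs≡ at-s₂ ; mem≡ = mem≡ at-s₂ ; output≡ = output≡ at-s₂ }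

  record Holds {v} (s : State) (pc : ℕ) (ρ : Vec ℕ v) (out : List ℕ) : Set where
    field
      atPc   : State.pc s ≡ pc
      vars   : ∀ i → State.registers s (suc (toℕ i)) ≡ lookup ρ i
      word   : State.registers s 0 ≡ w
      memory : State.memory s ≡ mem
      out≡   : State.output s ≡ out
  open Holds

  evaluate : ∀ {v} (e : Expr v) {pre rest post s ρ out} →
    let E = compileExpr (registersOf v) (suc v) e in
    p ≡ pre ++ (map embed (instrs E) ++ rest) ++ post → Holds s (length pre) ρ out →
    ∃[ s′ ] s ⟶[ cost e ] s′ × Holds s′ (length (pre ++ map embed (instrs E))) ρ out ×
            State.registers s′ (result E) ≡ ⟦ e ⟧ ρ × result E < free E × suc v ≤ free E
  evaluate {v} e {pre} {rest} {post} {s} {ρ} p≡ H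
    with simulates-simple (instrs (compileExpr (registersOf v) (suc v) e)) {pre} {rest ++ post}
           (trans p≡ (cong (pre ++_) (List.++-assoc
             (map embed (instrs (compileExpr (registersOf v) (suc v) e))) rest post)))
           (record { pc≡ = atPc H ; regs≡ = λ _ → refl ; mem≡ = memory H ; output≡ = out≡ H })
  ... | s′ , run , at-s′ =
    s′ , subst (λ t → s ⟶[ t ] s′) (cost-code (registersOf v) (suc v) e) run
       , record
         { atPc = pc≡ at-s′
         ; vars = λ i → trans (regs≡ at-s′ _)
             (trans (preserves C _ (s≤s (Fin.toℕ<n i))) (vars H i))
         ; word = trans (regs≡ at-s′ 0) (trans (preserves C 0 (s≤s z≤n)) (word H))
         ; memory = mem≡ at-s′ ; out≡ = output≡ at-s′ }
       , trans (regs≡ at-s′ _) (computes C) , bounded C , grows C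
    where
    open Computes
    C = compileExpr-correct {rs = registersOf v} {f = State.registers s} e record
      { below = λ i → subst (_< suc v) (sym (Vec.lookup∘tabulate _ i)) (s≤s (Fin.toℕ<n i))
      ; values = λ i → trans (cong (State.registers s) (Vec.lookup∘tabulate (suc ∘ toℕ) i)) (vars H i)
      ; nonzero = s≤s z≤n
      ; zeroth = word H }

  step-at : ∀ {pre post s i} → p ≡ pre ++ i ∷ post → State.pc s ≡ length pre →
            step s ≡ execute i s
  step-at {pre} {post} {s} {i} refl refl = cong (λ i → execute i s) (instrAt-++ pre {i} {post})

  reassoc : ∀ (xs ys zs us : Program) → xs ++ (ys ++ zs) ++ us ≡ (xs ++ ys) ++ zs ++ us
  reassoc xs ys zs us = trans (cong (xs ++_) (List.++-assoc ys zs us)) (sym (List.++-assoc xs ys _))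

  module Loop {v} (pre : Program) (e : Expr v) (b : Stmt v) where
    E     = compileExpr (registersOf v) (suc v) e
    head  = map embed (instrs E)
    inner = compileStmt (length pre + (length head + 1)) b
    end   = length pre + (length head + (1 + (length inner + 1)))
    start = (pre ++ head) ++ jumpz (result E) end ∷ []

    enter : State → State
    enter s = record s { pc = if does (State.registers s (result E) ≟ 0) then end else suc (State.pc s) }

    end≡ : length (pre ++ compileStmt (length pre) (while e b)) ≡ end
    end≡ = trans (List.length-++ pre) (cong (length pre +_)
      (trans (List.length-++ head) (cong (λ x → length head + suc x) (List.length-++ inner))))

    -- The induction hypothesis for the body speaks of code placed after `start`, whereas the
    -- compiler obtained the same address as a sum.
    body≡ : compileStmt (length start) b ≡ inner
    body≡ = cong (λ l → compileStmt l b) (trans (List.length-++ (pre ++ head))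
      (trans (cong (_+ 1) (List.length-++ pre)) (+-assoc (length pre) _ 1)))

    split : ∀ post → pre ++ compileStmt (length pre) (while e b) ++ post ≡
                     start ++ compileStmt (length start) b ++ jump (length pre) ∷ post
    split post = begin
      pre ++ (head ++ test∷ (inner ++ back)) ++ post         ≡⟨ reassoc pre head _ post ⟩
      (pre ++ head) ++ test∷ ((inner ++ back) ++ post)
        ≡⟨ cong (λ z → (pre ++ head) ++ test∷ z) (List.++-assoc inner back post) ⟩
      (pre ++ head) ++ test∷ (inner ++ jump (length pre) ∷ post) ≡⟨ List.++-assoc (pre ++ head) _ _ ⟨
      start ++ inner ++ jump (length pre) ∷ post
        ≡⟨ cong (λ z → start ++ z ++ jump (length pre) ∷ post) body≡ ⟨
      start ++ compileStmt (length start) b ++ jump (length pre) ∷ post ∎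
      where
      open ≡-Reasoning
      back = jump (length pre) ∷ []
      test∷ : Program → Program
      test∷ = jumpz (result E) end ∷_

    module _ (post : Program) (p≡ : p ≡ pre ++ compileStmt (length pre) (while e b) ++ post) (s : State) where

      test : State.pc s ≡ length (pre ++ head) → step s ≡ just (enter s)
      test = step-at {pre = pre ++ head} {s = s} (trans p≡ (reassoc pre head _ post))

      repeat : State.pc s ≡ length (start ++ compileStmt (length start) b) →
               step s ≡ just (record s { pc = length pre })
      repeat = step-at {pre = start ++ compileStmt (length start) b} {s = s}
        (trans p≡ (trans (split post) (sym (List.++-assoc start _ _))))

  wrap-small : ∀ {x} → x < 2 ^ w → wrap w x ≡ x
  wrap-small = m<n⇒m%n≡m {{m^n≢0 2 w}}

  -- Induction on the derivation, for code at any place of the whole program: `pre` determines the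
  -- absolute jump targets, and `post` is arbitrary, so that no fragment relies on what follows it.
  simulates : ∀ {v} {st : Stmt v} {ρ ρ′ o t pre post s out} →
    ρ ⊢ st ⇓ ρ′ / o in-time t →
    p ≡ pre ++ compileStmt (length pre) st ++ post → Holds s (length pre) ρ out →
    ∃[ s′ ] s ⟶[ t ] s′ × Holds s′ (length (pre ++ compileStmt (length pre) st)) ρ′ (out ++ o)
  simulates {v} {pre = pre} {post} {s} {out} (assign {ρ} {i} {e} {x} ⟦e⟧≡x x<) p≡ H
    with evaluate e {pre} p≡ H
  ... | s₁ , run₁ , H₁ , val , r<f , v<f = s₃ ,
    ⟶-trans run₁ (st₂ then (st₃ then idle)) , record
      { atPc = trans (cong suc (trans (cong suc (atPc H₁)) (sym (length-snoc pre′ (const F 0)))))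
                 (trans (sym (length-snoc (pre′ ++ const F 0 ∷ []) last))
                   (cong length (trans (List.++-assoc pre′ _ _) (List.++-assoc pre _ _))))
      ; vars = vars₃
      ; word = trans (update-other (State.registers s₂) (suc (toℕ i)) sum′ λ ())
                 (trans (update-other (State.registers s₁) F (wrap w 0)
                   (<⇒≢ (<-≤-trans (s≤s z≤n) v<f))) (word H₁))
      ; memory = memory H₁
      ; out≡ = trans (out≡ H₁) (sym (List.++-identityʳ out)) }
    where
    E = compileExpr (registersOf v) (suc v) e
    F = free E
    pre′ = pre ++ map embed (instrs E)
    last = arith add (suc (toℕ i)) (result E) F
    s₂ = record s₁ { pc = suc (State.pc s₁) ; registers = update (State.registers s₁) F (wrap w 0) }
    sum′ = wrap w (State.registers s₂ (result E) + State.registers s₂ F)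
    s₃ = record s₂ { pc = suc (State.pc s₂)
                   ; registers = update (State.registers s₂) (suc (toℕ i)) sum′ }
    p≡′ : p ≡ pre′ ++ const F 0 ∷ last ∷ post
    p≡′ = trans p≡ (reassoc pre (map embed (instrs E)) _ post)
    st₂ : step s₁ ≡ just s₂
    st₂ = step-at {pre = pre′} {s = s₁} p≡′ (atPc H₁)
    st₃ : step s₂ ≡ just s₃
    st₃ = step-at {pre = pre′ ++ const F 0 ∷ []} {s = s₂} (trans p≡′ (sym (List.++-assoc pre′ _ _)))
            (trans (cong suc (atPc H₁)) (sym (length-snoc pre′ _)))
    new : wrap w (State.registers s₂ (result E) + State.registers s₂ F) ≡ x
    new = begin
      wrap w (State.registers s₂ (result E) + State.registers s₂ F)
        ≡⟨ cong₂ (λ a b → wrap w (a + b))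
             (trans (update-other (State.registers s₁) F (wrap w 0) (<⇒≢ r<f)) (trans val ⟦e⟧≡x))
             (update-same (State.registers s₁) F (wrap w 0)) ⟩
      wrap w (x + wrap w 0)
        ≡⟨ cong (λ z → wrap w (x + z)) (wrap-small (m^n>0 2 w)) ⟩
      wrap w (x + 0) ≡⟨ cong (wrap w) (+-identityʳ x) ⟩
      wrap w x       ≡⟨ wrap-small x< ⟩
      x ∎
      where open ≡-Reasoning
    vars₃ : ∀ j → State.registers s₃ (suc (toℕ j)) ≡ lookup (ρ [ i ]≔ x) j
    vars₃ j with j Fin.≟ i
    ... | yes refl = trans (update-same (State.registers s₂) (suc (toℕ i)) sum′)
      (trans new (sym (Vec.lookup∘update i ρ x)))
    ... | no j≢i = begin
      State.registers s₃ (suc (toℕ j))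
        ≡⟨ update-other (State.registers s₂) (suc (toℕ i)) sum′ (j≢i ∘ Fin.toℕ-injective ∘ suc-injective) ⟩
      State.registers s₂ (suc (toℕ j))
        ≡⟨ update-other (State.registers s₁) F (wrap w 0) (<⇒≢ (<-≤-trans (s≤s (Fin.toℕ<n j)) v<f)) ⟩
      State.registers s₁ (suc (toℕ j)) ≡⟨ vars H₁ j ⟩
      lookup ρ j                       ≡⟨ Vec.lookup∘update′ j≢i ρ x ⟨
      lookup (ρ [ i ]≔ x) j            ∎
      where open ≡-Reasoning
  simulates {v} {pre = pre} {post} {out = out} (emits {ρ} {e} {x} ⟦e⟧≡x) p≡ H
    with evaluate e {pre} p≡ H
  ... | s₁ , run₁ , H₁ , val , _ , _ = s₂ , ⟶-trans run₁ (st₂ then idle) , record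
      { atPc = trans (cong suc (atPc H₁)) (trans (sym (length-snoc pre′ _))
                 (cong length (List.++-assoc pre _ _)))
      ; vars = vars H₁ ; word = word H₁ ; memory = memory H₁
      ; out≡ = cong₂ (λ a b → a ++ b ∷ []) (out≡ H₁) (trans val ⟦e⟧≡x) }
    where
    E = compileExpr (registersOf v) (suc v) e
    pre′ = pre ++ map embed (instrs E)
    s₂ = record s₁ { pc = suc (State.pc s₁)
                   ; output = State.output s₁ ++ State.registers s₁ (result E) ∷ [] }
    st₂ : step s₁ ≡ just s₂
    st₂ = step-at {pre = pre′} {s = s₁} (trans p≡ (reassoc pre (map embed (instrs E)) _ post)) (atPc H₁)
  simulates {pre = pre} {post} {s} {out} (seq {s₂ = ρ₂} {o₁ = o₁} {o₂} {a = a} {b} A B) p≡ H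
    with simulates {pre = pre} A (trans p≡
      (cong (pre ++_) (List.++-assoc (compileStmt (length pre) a) _ post))) H
  ... | s₁ , run₁ , H₁
    with simulates {pre = pre ++ ca} {post} {s₁} B
           (trans p≡ (trans (cong (pre ++_) (List.++-assoc ca _ post))
             (trans (sym (List.++-assoc pre ca _))
               (cong (λ l → (pre ++ ca) ++ compileStmt l b ++ post) (sym (List.length-++ pre))))))
           H₁
    where ca = compileStmt (length pre) a
  ... | s₂ , run₂ , H₂ = s₂ , ⟶-trans run₁ run₂ ,
    subst₂ (λ c o → Holds s₂ c ρ₂ o)
      (cong length (trans (List.++-assoc pre ca _)
        (cong (λ l → pre ++ ca ++ compileStmt l b) (List.length-++ pre))))
      (List.++-assoc out o₁ o₂) H₂
    where ca = compileStmt (length pre) a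
  simulates {pre = pre} {post} {s} {out} (stop {ρ} {e} {b} ⟦e⟧≡0) p≡ H with evaluate e {pre} p≡ H
  ... | s₁ , run₁ , H₁ , val , _ , _ = enter s₁ , ⟶-trans run₁ (test post p≡ s₁ (atPc H₁) then idle) ,
    record
      { atPc = trans exit (sym end≡)
      ; vars = vars H₁ ; word = word H₁ ; memory = memory H₁
      ; out≡ = trans (out≡ H₁) (sym (List.++-identityʳ out)) }
    where
    open Loop pre e b
    exit : State.pc (enter s₁) ≡ end
    exit rewrite dec-true (State.registers s₁ (result E) ≟ 0) (trans val ⟦e⟧≡0) = refl
  simulates {pre = pre} {post} {s} {out}
    (loop {ρ} {ρ₁} {ρ₂} {o₁} {o₂} {t₁} {t₂} {e} {b} ⟦e⟧≢0 body rest) p≡ H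
    with evaluate e {pre} p≡ H
  ... | s₁ , run₁ , H₁ , val , _ , _
    with simulates {pre = Loop.start pre e b} {jump (length pre) ∷ post} {Loop.enter pre e b s₁} body
           (trans p≡ (Loop.split pre e b post))
           (record { atPc = trans continue (trans (cong suc (atPc H₁)) (sym (length-snoc (pre ++ head) _)))
                   ; vars = vars H₁ ; word = word H₁ ; memory = memory H₁ ; out≡ = out≡ H₁ })
    where
    open Loop pre e b
    continue : State.pc (enter s₁) ≡ suc (State.pc s₁)
    continue rewrite dec-false (State.registers s₁ (result E) ≟ 0) (λ z → ⟦e⟧≢0 (trans (sym val) z)) = refl
  ... | s₂ , run₂ , H₂
    with simulates {pre = pre} {post} {record s₂ { pc = length pre }} rest p≡
           (record { atPc = refl ; vars = vars H₂ ; word = word H₂ ; memory = memory H₂ ; out≡ = out≡ H₂ })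
  ... | s₃ , run₃ , H₃ =
    s₃ , subst (λ t → s ⟶[ t ] s₃) (sym (+-assoc (cost e) 1 _))
           (⟶-trans run₁ (Loop.test pre e b post p≡ s₁ (atPc H₁) then
             ⟶-trans run₂ (Loop.repeat pre e b post p≡ s₂ (atPc H₂) then run₃)))
       , subst (Holds s₃ _ ρ₂) (List.++-assoc out o₁ o₂) H₃

compile : ∀ {v} → Stmt v → Program
compile = compileStmt 0

module _ (w : ℕ) (bits : List Bool) (query : List ℕ) where
  open Semantics w (dataWord w bits) (nth query)

  -- All registers but register 0 start at zero, which represents the state with all variables zero.
  -- The code has no final `halt`; running off its end stops the machine.
  compile-answers : ∀ {v} {st : Stmt v} {ρ′ out t t′} → Vec.replicate v 0 ⊢ st ⇓ ρ′ / out in-time t →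
                    t ≤ t′ → Answers w bits (compile st) query out t′
  compile-answers {v} {st} {t′ = t′} ex t≤t′
    with Execution.simulates w bits (nth query) (compile st) {pre = []} {[]} {out = []} ex
           (sym (List.++-identityʳ _))
           (record { atPc = refl ; vars = λ i → sym (Vec.lookup-replicate i 0) ; word = refl
                   ; memory = refl ; out≡ = refl })
  ... | s′ , run , H = subst (HaltsFrom t′ (initial query)) (Execution.Holds.out≡ H)
        (Execution.⟶-halts w bits (nth query) (compile st) run
          (trans (cong (λ c → execute (instrAt (compile st) c) s′) (Execution.Holds.atPc H))
            (cong (λ i → execute i s′) (instrAt-end (compile st)))) t≤t′)
    where open Machine w bits (compile st)

-- Reading bit fields

n<2^n : ∀ n → n < 2 ^ n
n<2^n zero    = s≤s z≤n
n<2^n (suc n) = begin-strict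
  1 + n         <⟨ s≤s (n<2^n n) ⟩
  1 + 2 ^ n     ≤⟨ +-monoˡ-≤ (2 ^ n) (m^n>0 2 n) ⟩
  2 ^ n + 2 ^ n ≡⟨ cong (2 ^ n +_) (+-identityʳ (2 ^ n)) ⟨
  2 ^ suc n     ∎
  where open ≤-Reasoning

[m*n+o]/n : ∀ m {n o} .{{_ : NonZero n}} → o < n → (m * n + o) / n ≡ m
[m*n+o]/n m {n} {o} o<n = begin
  (m * n + o) / n     ≡⟨ +-distrib-/-∣ˡ o (n∣m*n m) ⟩
  m * n / n + o / n   ≡⟨ cong₂ _+_ (m*n/n≡m m n) (m<n⇒m/n≡0 o<n) ⟩
  m + 0               ≡⟨ +-identityʳ m ⟩
  m                   ∎
  where open ≡-Reasoning

[m*n+o]%n : ∀ m {n o} .{{_ : NonZero n}} → o < n → (m * n + o) % n ≡ o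
[m*n+o]%n m {n} {o} o<n =
  trans (cong (_% n) (+-comm (m * n) o)) (trans ([m+kn]%n≡m%n o m n) (m<n⇒m%n≡m o<n))

length-take-≤ : ∀ {A : Set} n (xs : List A) → length (take n xs) ≤ n
length-take-≤ n xs = subst (_≤ n) (sym (List.length-take n xs)) (m⊓n≤m n (length xs))

length≡0⇒[] : ∀ {A : Set} {xs : List A} → length xs ≡ 0 → xs ≡ []
length≡0⇒[] {xs = []} _ = refl

toBits : ℕ → ℕ → List Bool
toBits zero    x = []
toBits (suc n) x = does (x % 2 ≟ 1) ∷ toBits n (x / 2)

length-toBits : ∀ n x → length (toBits n x) ≡ n
length-toBits zero    x = refl
length-toBits (suc n) x = cong suc (length-toBits n (x / 2))

bit-parity : ∀ x → bit (does (x % 2 ≟ 1)) ≡ x % 2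
bit-parity x with x % 2 | m%n<n x 2
... | 0 | _ = refl
... | 1 | _ = refl
... | suc (suc _) | s≤s (s≤s ())

bit<2 : ∀ b → bit b < 2
bit<2 true  = s≤s (s≤s z≤n)
bit<2 false = s≤s z≤n

fromBits-∷ : ∀ b bs → fromBits (b ∷ bs) ≡ fromBits bs * 2 + bit b
fromBits-∷ b bs = trans (+-comm (bit b) _) (cong (_+ bit b) (*-comm 2 (fromBits bs)))

[fromBits-∷]%2 : ∀ b bs → fromBits (b ∷ bs) % 2 ≡ bit b
[fromBits-∷]%2 b bs = trans (cong (_% 2) (fromBits-∷ b bs)) ([m*n+o]%n (fromBits bs) (bit<2 b))

[fromBits-∷]/2 : ∀ b bs → fromBits (b ∷ bs) / 2 ≡ fromBits bs
[fromBits-∷]/2 b bs = trans (cong (_/ 2) (fromBits-∷ b bs)) ([m*n+o]/n (fromBits bs) (bit<2 b))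

fromBits-toBits : ∀ n {x} → x < 2 ^ n → fromBits (toBits n x) ≡ x
fromBits-toBits zero    (s≤s z≤n) = refl
fromBits-toBits (suc n) {x} x< = begin
  bit (does (x % 2 ≟ 1)) + 2 * fromBits (toBits n (x / 2))
    ≡⟨ cong₂ (λ a b → a + 2 * b) (bit-parity x)
         (fromBits-toBits n (m<n*o⇒m/o<n (subst (x <_) (*-comm 2 (2 ^ n)) x<))) ⟩
  x % 2 + 2 * (x / 2) ≡⟨ cong (x % 2 +_) (*-comm 2 (x / 2)) ⟩
  x % 2 + x / 2 * 2   ≡⟨ m≡m%n+[m/n]*n x 2 ⟨
  x                   ∎
  where open ≡-Reasoning

toBits-fromBits : ∀ bs → toBits (length bs) (fromBits bs) ≡ bs
toBits-fromBits []       = refl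
toBits-fromBits (b ∷ bs) = cong₂ _∷_
  (trans (cong (λ x → does (x ≟ 1)) ([fromBits-∷]%2 b bs)) (bit-one b))
  (trans (cong (toBits (length bs)) ([fromBits-∷]/2 b bs)) (toBits-fromBits bs))
  where
  bit-one : ∀ b → does (bit b ≟ 1) ≡ b
  bit-one true  = refl
  bit-one false = refl

fromBits-++ : ∀ xs ys → fromBits (xs ++ ys) ≡ fromBits xs + 2 ^ length xs * fromBits ys
fromBits-++ []       ys = sym (+-identityʳ _)
fromBits-++ (x ∷ xs) ys = begin
  bit x + 2 * fromBits (xs ++ ys)           ≡⟨ cong (λ z → bit x + 2 * z) (fromBits-++ xs ys) ⟩
  bit x + 2 * (fromBits xs + p * f)
    ≡⟨ solve 4 (λ b x p f → b :+ con 2 :* (x :+ p :* f) := (b :+ con 2 :* x) :+ con 2 :* p :* f)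
         refl (bit x) (fromBits xs) p f ⟩
  (bit x + 2 * fromBits xs) + 2 * p * f     ∎
  where
  open ≡-Reasoning
  p = 2 ^ length xs
  f = fromBits ys

fromBits< : ∀ bs → fromBits bs < 2 ^ length bs
fromBits< []       = s≤s z≤n
fromBits< (b ∷ bs) = begin-strict
  bit b + 2 * fromBits bs <⟨ +-monoˡ-< (2 * fromBits bs) (bit<2 b) ⟩
  2 + 2 * fromBits bs     ≡⟨ *-suc 2 (fromBits bs) ⟨
  2 * suc (fromBits bs)   ≤⟨ *-monoʳ-≤ 2 (fromBits< bs) ⟩
  2 ^ suc (length bs)     ∎
  where open ≤-Reasoning

fromBits-drop : ∀ n bs → fromBits (drop n bs) ≡ _/_ (fromBits bs) (2 ^ n) {{m^n≢0 2 n}}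
fromBits-drop zero    bs = sym (n/1≡n (fromBits bs))
fromBits-drop (suc n) [] = sym (0/n≡0 (2 ^ suc n) {{m^n≢0 2 (suc n)}})
fromBits-drop (suc n) (b ∷ bs) = begin
  fromBits (drop n bs)               ≡⟨ fromBits-drop n bs ⟩
  (fromBits bs / 2 ^ n)              ≡⟨ cong (λ x → x / 2 ^ n) ([fromBits-∷]/2 b bs) ⟨
  (fromBits (b ∷ bs) / 2 / 2 ^ n)    ≡⟨ m/n/o≡m/[n*o] (fromBits (b ∷ bs)) 2 (2 ^ n) ⟩
  fromBits (b ∷ bs) / 2 ^ suc n      ∎
  where
  open ≡-Reasoning
  instance
    _ = m^n≢0 2 n
    _ = m^n≢0 2 (suc n)

-- `take n bs` may be shorter than `n`, and then the power of two in `fromBits-++` is not `2 ^ n`;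
-- but in that case nothing is left to drop, and the second summand vanishes.
fromBits-take : ∀ n bs → fromBits (take n bs) ≡ _%_ (fromBits bs) (2 ^ n) {{m^n≢0 2 n}}
fromBits-take n bs = begin
  fromBits (take n bs)
    ≡⟨ small (take n bs) (fromBits (drop n bs)) (length-take-≤ n bs) (λ len → cong fromBits (dropped len)) ⟨
  (fromBits (take n bs) + 2 ^ length (take n bs) * fromBits (drop n bs)) % 2 ^ n
    ≡⟨ cong (_% 2 ^ n) (fromBits-++ (take n bs) (drop n bs)) ⟨
  fromBits (take n bs ++ drop n bs) % 2 ^ n
    ≡⟨ cong (λ x → fromBits x % 2 ^ n) (List.take++drop≡id n bs) ⟩
  fromBits bs % 2 ^ n ∎
  where
  open ≡-Reasoning
  instance _ = m^n≢0 2 n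
  dropped : length (take n bs) < n → drop n bs ≡ []
  dropped len = length≡0⇒[] (trans (List.length-drop n bs) (m≤n⇒m∸n≡0 (≮⇒≥ λ n< →
    <-irrefl refl (<-≤-trans len (subst (n ≤_) (sym (List.length-take n bs)) (⊓-glb ≤-refl (<⇒≤ n<)))))))
  small : ∀ xs z → length xs ≤ n → (length xs < n → z ≡ 0) →
          (fromBits xs + 2 ^ length xs * z) % 2 ^ n ≡ fromBits xs
  small xs z len h with m≤n⇒m<n∨m≡n len
  ... | inj₁ l< rewrite h l< | *-zeroʳ (2 ^ length xs) | +-identityʳ (fromBits xs) =
    m<n⇒m%n≡m (<-≤-trans (fromBits< xs) (^-monoʳ-≤ 2 len))
  ... | inj₂ refl = trans (cong (_% 2 ^ n) (trans (+-comm (fromBits xs) _)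
                      (cong (_+ fromBits xs) (*-comm (2 ^ n) z)))) ([m*n+o]%n z (fromBits< xs))

-- The bits of Y from position r on, assembled from two consecutive w-bit words
-- with W = 2 ^ w, a = 2 ^ r and b = 2 ^ (w - r).
straddle : ∀ Y W a b .{{_ : NonZero W}} .{{_ : NonZero a}} .{{_ : NonZero b}} → a * b ≡ W →
           (Y % W) / a + ((Y / W) % W * b) % W ≡ (Y / a) % W
straddle Y W a b refl = begin
  (Y % W) / a + ((Y / W) % W * b) % W ≡⟨ cong ((Y % W) / a +_) high ⟩
  l + u % a * b                       ≡⟨ +-comm l _ ⟩
  u % a * b + l                       ≡⟨ m<n⇒m%n≡m bound ⟨
  -- The high part of `u` overflows the word: it contributes a multiple of `W` and may be restored
  -- under the remainder.
  (u % a * b + l) % W                 ≡⟨ [m+kn]%n≡m%n (u % a * b + l) (u / a) W ⟨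
  (u % a * b + l + u / a * W) % W     ≡⟨ cong (_% W) regroup ⟩
  (u * b + l) % W                     ≡⟨ cong (_% W) Y/a ⟨
  (Y / a) % W                         ∎
  where
  open ≡-Reasoning
  u = Y / W
  l = (Y % W) / a
  l<b : l < b
  l<b = m<n*o⇒m/o<n (subst (Y % W <_) (*-comm a b) (m%n<n Y W))
  bound : u % a * b + l < W
  bound = ≤-trans (+-monoʳ-< (u % a * b) l<b) (subst (_≤ W) (+-comm b (u % a * b))
            (*-monoˡ-≤ b (m%n<n u a)))
  high : (u % W * b) % W ≡ u % a * b
  high = begin
    (u % W * b) % W           ≡⟨ [m+kn]%n≡m%n (u % W * b) (u / W * b) W ⟨
    (u % W * b + u / W * b * W) % W ≡⟨ cong (_% W)
      (solve 4 (λ x y z b → x :* b :+ y :* b :* z := (x :+ y :* z) :* b) refl (u % W) (u / W) W b) ⟩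
    ((u % W + u / W * W) * b) % W ≡⟨ cong (λ z → (z * b) % W) (m≡m%n+[m/n]*n u W) ⟨
    (u * b) % W               ≡⟨ m%n*o≡m*o%[n*o] u a b ⟨
    u % a * b                 ∎

  regroup : u % a * b + l + u / a * W ≡ u * b + l
  regroup = trans (solve 5 (λ x y a b l → x :* b :+ l :+ y :* (a :* b) := (x :+ y :* a) :* b :+ l)
                     refl (u % a) (u / a) a b l)
                  (cong (λ z → z * b + l) (sym (m≡m%n+[m/n]*n u a)))

  Y/a : Y / a ≡ u * b + l
  Y/a = begin
    Y / a                     ≡⟨ cong (_/ a) (m≡m%n+[m/n]*n Y W) ⟩
    (Y % W + u * W) / a       ≡⟨ cong (λ z → (Y % W + z) / a)
      (solve 3 (λ u a b → u :* (a :* b) := u :* b :* a) refl u a b) ⟩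
    (Y % W + u * b * a) / a   ≡⟨ +-distrib-/-∣ʳ (Y % W) (n∣m*n (u * b)) ⟩
    l + u * b * a / a         ≡⟨ cong (l +_) (m*n/n≡m (u * b) a) ⟩
    l + u * b                 ≡⟨ +-comm l _ ⟩
    u * b + l                 ∎

-- A field that starts at a word boundary shifts the second word by the full word size, which wraps
-- to zero, so no case distinction is needed.
readField : Expr 2
readField =
  call (op mod (op add (op shr (fetchE q) r)
                       (op shl (fetchE (op add q (lit 1))) (op sub wordSize r)))
               (op shl (lit 1) n))
    (op div (var zero) wordSize ∷ op mod (var zero) wordSize ∷ var (suc zero) ∷ [])
  where
  q = var zero
  r = var (suc zero)
  n = var (suc (suc zero))

module Arithmetic (w : ℕ) (datum mem : ℕ → ℕ) where
  open Semantics w datum mem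

  private instance
    2^w≢0 : NonZero (2 ^ w)
    2^w≢0 = m^n≢0 2 w

  module _ {n} {ρ : Vec ℕ n} where

    lit-value : ∀ {x} → x < 2 ^ w → ⟦ lit x ⟧ ρ ≡ x
    lit-value = m<n⇒m%n≡m

    add-value : ∀ {a b x y} → ⟦ a ⟧ ρ ≡ x → ⟦ b ⟧ ρ ≡ y → x + y < 2 ^ w →
                ⟦ op add a b ⟧ ρ ≡ x + y
    add-value refl refl = m<n⇒m%n≡m

    sub-value : ∀ {a b x y} → ⟦ a ⟧ ρ ≡ x → ⟦ b ⟧ ρ ≡ y → y ≤ x → x < 2 ^ w →
                ⟦ op sub a b ⟧ ρ ≡ x ∸ y
    sub-value {x = x} {y} refl refl y≤x x< = begin
      (x + 2 ^ w ∸ y) % 2 ^ w   ≡⟨ cong (λ z → (z ∸ y) % 2 ^ w) (+-comm x (2 ^ w)) ⟩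
      (2 ^ w + x ∸ y) % 2 ^ w   ≡⟨ cong (_% 2 ^ w) (+-∸-assoc (2 ^ w) y≤x) ⟩
      (2 ^ w + (x ∸ y)) % 2 ^ w ≡⟨ cong (_% 2 ^ w) (+-comm (2 ^ w) (x ∸ y)) ⟩
      (x ∸ y + 2 ^ w) % 2 ^ w   ≡⟨ [m+n]%n≡m%n (x ∸ y) (2 ^ w) ⟩
      (x ∸ y) % 2 ^ w           ≡⟨ m<n⇒m%n≡m (≤-<-trans (m∸n≤m x y) x<) ⟩
      x ∸ y                     ∎
      where open ≡-Reasoning

    mul-value : ∀ {a b x y} → ⟦ a ⟧ ρ ≡ x → ⟦ b ⟧ ρ ≡ y → x * y < 2 ^ w →
                ⟦ op mul a b ⟧ ρ ≡ x * y
    mul-value refl refl = m<n⇒m%n≡m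

    div-value : ∀ {a b x y} .{{_ : NonZero y}} → ⟦ a ⟧ ρ ≡ x → ⟦ b ⟧ ρ ≡ y → x < 2 ^ w →
                ⟦ op div a b ⟧ ρ ≡ x / y
    div-value {a} {b} {x} {y} a≡ b≡ x< = trans (cong₂ (λ x y → wrap w (quotient x y)) a≡ b≡) (lemma y)
      where
      lemma : ∀ y .{{_ : NonZero y}} → wrap w (quotient x y) ≡ x / y
      lemma (suc y) = m<n⇒m%n≡m (≤-<-trans (m/n≤m x (suc y)) x<)

    mod-value : ∀ {a b x y} .{{_ : NonZero y}} → ⟦ a ⟧ ρ ≡ x → ⟦ b ⟧ ρ ≡ y → x < 2 ^ w →
                ⟦ op mod a b ⟧ ρ ≡ x % y
    mod-value {a} {b} {x} {y} a≡ b≡ x< = trans (cong₂ (λ x y → wrap w (remainder x y)) a≡ b≡) (lemma y)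
      where
      lemma : ∀ y .{{_ : NonZero y}} → wrap w (remainder x y) ≡ x % y
      lemma (suc y) = m<n⇒m%n≡m (≤-<-trans (m%n≤m x (suc y)) x<)

    shl-value : ∀ {a b x y} → ⟦ a ⟧ ρ ≡ x → ⟦ b ⟧ ρ ≡ y → x * 2 ^ y < 2 ^ w →
                ⟦ op shl a b ⟧ ρ ≡ x * 2 ^ y
    shl-value refl refl = m<n⇒m%n≡m

    lt-value : ∀ {a b x y} → 0 < w → ⟦ a ⟧ ρ ≡ x → ⟦ b ⟧ ρ ≡ y →
               ⟦ op lt a b ⟧ ρ ≡ bit (does (x <? y))
    lt-value {x = x} {y} 0<w refl refl =
      m<n⇒m%n≡m (<-≤-trans (bit<2 (does (x <? y))) (^-monoʳ-≤ 2 0<w))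

    eq-value : ∀ {a b x y} → 0 < w → ⟦ a ⟧ ρ ≡ x → ⟦ b ⟧ ρ ≡ y →
               ⟦ op eq a b ⟧ ρ ≡ bit (does (x ≟ y))
    eq-value {x = x} {y} 0<w refl refl =
      m<n⇒m%n≡m (<-≤-trans (bit<2 (does (x ≟ y))) (^-monoʳ-≤ 2 0<w))

module _ (w : ℕ) (bits : List Bool) (mem : ℕ → ℕ) where
  open Semantics w (dataWord w bits) mem
  open Arithmetic w (dataWord w bits) mem

  -- The second word is fetched even when the field ends in the first; `suc addr` bounds its index,
  -- and past the end of the data it reads as zero. `n < w` keeps the modulus `2 ^ n` a proper word.
  readField-value : ∀ {addr n} → suc addr < 2 ^ w → n < w →
                    ⟦ readField ⟧ (addr ∷ n ∷ []) ≡ fromBits (take n (drop addr bits))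
  readField-value {addr} {n} addr< n<w = begin
    ⟦ readField ⟧ (addr ∷ n ∷ [])
      ≡⟨ cong₂ (λ q r → ⟦ body ⟧ (q ∷ r ∷ n ∷ [])) q≡ r≡ ⟩
    ⟦ body ⟧ (q ∷ r ∷ n ∷ [])
      ≡⟨ mod-value {ρ = ρ} {a = sumE} {b = op shl (lit 1) (var (suc (suc zero)))} sum≡
           (trans (shl-value {ρ = ρ} {a = lit 1} {b = var (suc (suc zero))} one≡ refl
             (subst (_< 2 ^ w) (sym (*-identityˡ (2 ^ n))) (^-monoʳ-< 2 (s≤s (s≤s z≤n)) n<w)))
             (*-identityˡ (2 ^ n)))
           (m%n<n _ (2 ^ w)) ⟩
    (Y / 2 ^ r) % 2 ^ w % 2 ^ n
      ≡⟨ m∣n⇒o%n%m≡o%m (2 ^ n) (2 ^ w) (Y / 2 ^ r)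
           (divides (2 ^ (w ∸ n)) (trans (cong (2 ^_) (sym (m∸n+n≡m (<⇒≤ n<w))))
             (^-distribˡ-+-* 2 (w ∸ n) n))) ⟩
    (Y / 2 ^ r) % 2 ^ n
      ≡⟨ cong (_% 2 ^ n) (fromBits-drop r (drop (q * w) bits)) ⟨
    fromBits (drop r (drop (q * w) bits)) % 2 ^ n
      ≡⟨ fromBits-take n _ ⟨
    fromBits (take n (drop r (drop (q * w) bits)))
      ≡⟨ cong (fromBits ∘ take n) (trans (List.drop-drop (q * w) r bits)
           (cong (λ x → drop x bits) (trans (+-comm (q * w) r) (sym (m≡m%n+[m/n]*n addr w))))) ⟩
    fromBits (take n (drop addr bits)) ∎
    where
    open ≡-Reasoning
    instance
      _ = >-nonZero (≤-<-trans z≤n n<w)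
      2^w≢0 = m^n≢0 2 w
      2^n≢0 = m^n≢0 2 n
      2^r≢0 = m^n≢0 2 (addr % w)
      2^w-r≢0 = m^n≢0 2 (w ∸ addr % w)
    q = addr / w
    r = addr % w
    r<w = m%n<n addr w
    Y = fromBits (drop (q * w) bits)
    ρ : Vec ℕ 3
    ρ = q ∷ r ∷ n ∷ []
    v₀ v₁ v₂ : Expr 3
    v₀ = var zero
    v₁ = var (suc zero)
    v₂ = var (suc (suc zero))
    hiE = fetchE (op add v₀ (lit 1))
    sumE = op add (op shr (fetchE v₀) v₁) (op shl hiE (op sub wordSize v₁))
    body = op mod sumE (op shl (lit 1) v₂)
    q≡ : ⟦ op div (var zero) wordSize ⟧ (addr ∷ n ∷ []) ≡ q
    q≡ = div-value {ρ = addr ∷ n ∷ []} {a = var zero} {b = wordSize} refl refl (<-trans (n<1+n addr) addr<)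
    r≡ : ⟦ op mod (var zero) wordSize ⟧ (addr ∷ n ∷ []) ≡ r
    r≡ = mod-value {ρ = addr ∷ n ∷ []} {a = var zero} {b = wordSize} refl refl (<-trans (n<1+n addr) addr<)
    one≡ : ⟦ lit 1 ⟧ ρ ≡ 1
    one≡ = lit-value {ρ = ρ} (≤-<-trans (s≤s z≤n) addr<)
    lo : dataWord w bits q ≡ Y % 2 ^ w
    lo = fromBits-take w (drop (q * w) bits)
    hi : ⟦ hiE ⟧ ρ ≡ (Y / 2 ^ w) % 2 ^ w
    hi = begin
      dataWord w bits (⟦ op add v₀ (lit 1) ⟧ ρ)
        ≡⟨ cong (dataWord w bits) (trans (add-value {ρ = ρ} {a = v₀} {b = lit 1} refl one≡
             (≤-<-trans (subst (_≤ suc addr) (+-comm 1 q) (s≤s (m/n≤m addr w))) addr<)) (+-comm q 1)) ⟩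
      fromBits (take w (drop (w + q * w) bits))
        ≡⟨ cong (fromBits ∘ take w) (trans (cong (λ x → drop x bits) (+-comm w (q * w)))
             (sym (List.drop-drop (q * w) w bits))) ⟩
      fromBits (take w (drop w (drop (q * w) bits)))
        ≡⟨ fromBits-take w _ ⟩
      fromBits (drop w (drop (q * w) bits)) % 2 ^ w
        ≡⟨ cong (_% 2 ^ w) (fromBits-drop w _) ⟩
      (Y / 2 ^ w) % 2 ^ w ∎
    w-r≡ : ⟦ op sub wordSize v₁ ⟧ ρ ≡ w ∸ r
    w-r≡ = sub-value {ρ = ρ} {a = wordSize} {b = v₁} refl refl (<⇒≤ r<w) (n<2^n w)
    lo≡ : ⟦ op shr (fetchE v₀) v₁ ⟧ ρ ≡ (Y % 2 ^ w) / 2 ^ r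
    lo≡ = trans (cong (λ x → (x / 2 ^ r) % 2 ^ w) lo)
            (m<n⇒m%n≡m (≤-<-trans (m/n≤m (Y % 2 ^ w) (2 ^ r)) (m%n<n Y (2 ^ w))))
    hi≡ : ⟦ op shl hiE (op sub wordSize v₁) ⟧ ρ ≡ ((Y / 2 ^ w) % 2 ^ w * 2 ^ (w ∸ r)) % 2 ^ w
    hi≡ = cong₂ (λ x y → (x * 2 ^ y) % 2 ^ w) hi w-r≡
    str = straddle Y (2 ^ w) (2 ^ r) (2 ^ (w ∸ r))
            (trans (sym (^-distribˡ-+-* 2 r (w ∸ r))) (cong (2 ^_) (m+[n∸m]≡n (<⇒≤ r<w))))
    sum≡ : ⟦ sumE ⟧ ρ ≡ (Y / 2 ^ r) % 2 ^ w
    sum≡ = trans (add-value {ρ = ρ} {a = op shr (fetchE v₀) v₁} {b = op shl hiE (op sub wordSize v₁)}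
                   lo≡ hi≡ (subst (_< 2 ^ w) (sym str) (m%n<n _ (2 ^ w)))) str

-- A self-describing sequence of tables

take-exact : ∀ {A : Set} n xs {ys : List A} → length xs ≡ n → take n (xs ++ ys) ≡ xs
take-exact zero    []       refl = refl
take-exact (suc n) (x ∷ xs) refl = cong (x ∷_) (take-exact n xs refl)

drop-exact : ∀ {A : Set} n m xs {ys : List A} → length xs ≡ n → drop (n + m) (xs ++ ys) ≡ drop m ys
drop-exact zero    m []       refl = refl
drop-exact (suc n) m (x ∷ xs) refl = drop-exact n m xs refl

table : ℕ → (ℕ → ℕ) → ℕ → List Bool
table n f zero    = []
table n f (suc c) = toBits n (f 0) ++ table n (f ∘ suc) c

length-table : ∀ n f c → length (table n f c) ≡ c * n
length-table n f zero    = refl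
length-table n f (suc c) = trans (List.length-++ (toBits n (f 0)))
  (cong₂ _+_ (length-toBits n (f 0)) (length-table n (f ∘ suc) c))

table-entry : ∀ n f {c i} rest → i < c →
              take n (drop (i * n) (table n f c ++ rest)) ≡ toBits n (f i)
table-entry n f {suc c} {zero}  rest _ =
  trans (cong (take n) (List.++-assoc (toBits n (f 0)) _ rest))
    (take-exact n (toBits n (f 0)) (length-toBits n (f 0)))
table-entry n f {suc c} {suc i} rest (s≤s i<c) = begin
  take n (drop (n + i * n) ((toBits n (f 0) ++ table n (f ∘ suc) c) ++ rest))
    ≡⟨ cong (λ z → take n (drop (n + i * n) z)) (List.++-assoc (toBits n (f 0)) _ rest) ⟩
  take n (drop (n + i * n) (toBits n (f 0) ++ table n (f ∘ suc) c ++ rest))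
    ≡⟨ cong (take n) (drop-exact n (i * n) (toBits n (f 0)) (length-toBits n (f 0))) ⟩
  take n (drop (i * n) (table n (f ∘ suc) c ++ rest)) ≡⟨ table-entry n (f ∘ suc) rest i<c ⟩
  toBits n (f (suc i)) ∎
  where open ≡-Reasoning

table-field : ∀ {n f c i base pre rest bs} → bs ≡ pre ++ table n f c ++ rest → length pre ≡ base →
              i < c → f i < 2 ^ n → fromBits (take n (drop (base + i * n) bs)) ≡ f i
table-field {n} {f} {c} {i} {base} {pre} {rest} refl len i<c fi< = begin
  fromBits (take n (drop (base + i * n) (pre ++ table n f c ++ rest)))
    ≡⟨ cong (fromBits ∘ take n) (drop-exact base (i * n) pre len) ⟩
  fromBits (take n (drop (i * n) (table n f c ++ rest)))
    ≡⟨ cong fromBits (table-entry n f rest i<c) ⟩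
  fromBits (toBits n (f i)) ≡⟨ fromBits-toBits n fi< ⟩
  f i ∎
  where open ≡-Reasoning

entry : ∀ {m} → Vec ℕ m → ℕ → ℕ
entry []       _       = 0
entry (x ∷ _)  zero    = x
entry (_ ∷ xs) (suc i) = entry xs i

entry-lookup : ∀ {m} (xs : Vec ℕ m) i → entry xs (toℕ i) ≡ lookup xs i
entry-lookup (x ∷ xs) zero    = refl
entry-lookup (x ∷ xs) (suc i) = entry-lookup xs i

record Segment : Set where
  constructor segment
  field
    width count : ℕ
    content     : ℕ → ℕ
open Segment

footprint : Segment → ℕ
footprint s = count s * width s

totalSize : ∀ {m} → Vec Segment m → ℕ
totalSize []       = 0
totalSize (s ∷ ss) = footprint s + totalSize ss

offsets : ∀ {m} → Vec Segment m → Vec ℕ m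
offsets []       = []
offsets (s ∷ ss) = 0 ∷ Vec.map (footprint s +_) (offsets ss)

payload : ∀ {m} → Vec Segment m → List Bool
payload []       = []
payload (s ∷ ss) = table (width s) (content s) (count s) ++ payload ss

length-payload : ∀ {m} (ss : Vec Segment m) → length (payload ss) ≡ totalSize ss
length-payload []       = refl
length-payload (s ∷ ss) = trans (List.length-++ (table (width s) (content s) (count s)))
  (cong₂ _+_ (length-table _ (content s) (count s)) (length-payload ss))

payload-split : ∀ {m} (ss : Vec Segment m) i → let s = lookup ss i in
  ∃[ pre ] ∃[ rest ] payload ss ≡ pre ++ table (width s) (content s) (count s) ++ rest ×
                     length pre ≡ lookup (offsets ss) i
payload-split (s ∷ ss) zero    = [] , payload ss , refl , refl
payload-split (s ∷ ss) (suc i) with payload-split ss i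
... | pre , rest , split , len =
  t ++ pre , rest , trans (cong (t ++_) split) (sym (List.++-assoc t pre _)) ,
  trans (List.length-++ t) (trans (cong₂ _+_ (length-table _ (content s) (count s)) len)
    (sym (Vec.lookup-map i (footprint s +_) (offsets ss))))
  where t = table (width s) (content s) (count s)

offset-bound : ∀ {m} (ss : Vec Segment m) i →
               lookup (offsets ss) i + footprint (lookup ss i) ≤ totalSize ss
offset-bound (s ∷ ss) zero    = m≤m+n _ _
offset-bound (s ∷ ss) (suc i) rewrite Vec.lookup-map i (footprint s +_) (offsets ss)
                                    | +-assoc (footprint s) (lookup (offsets ss) i)
                                      (footprint (lookup ss i)) =
  +-monoʳ-≤ (footprint s) (offset-bound ss i)

-- Since w is unbounded, the header has to describe its own field width 4 g:
-- g is stored in g bits behind g - 1 zeros and a one.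
gammaCode : ℕ → List Bool
gammaCode g′ = replicate g′ false ++ true ∷ toBits (suc g′) (suc g′)

-- The gamma code takes half of a field; the padding completes it, so that all later entries of the
-- header lie at multiples of the field width.
preamble : ℕ → List Bool
preamble g′ = gammaCode g′ ++ replicate (2 * suc g′) false

fieldWidth : ℕ → ℕ
fieldWidth g′ = suc g′ * 4

layout : ∀ {m} → ℕ → Vec Segment m → List Bool
layout {m} g′ ss =
  preamble g′ ++ table (fieldWidth g′) (entry (offsets ss)) m
              ++ table (fieldWidth g′) (entry (Vec.map width ss)) m ++ payload ss

length-gammaCode : ∀ g′ → length (gammaCode g′) ≡ suc g′ + suc g′
length-gammaCode g′ = trans (List.length-++ (replicate g′ false))
  (trans (cong₂ (λ a b → a + suc b) (List.length-replicate g′) (length-toBits (suc g′) (suc g′)))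
    (+-suc g′ (suc g′)))

length-preamble : ∀ g′ → length (preamble g′) ≡ fieldWidth g′
length-preamble g′ = trans (List.length-++ (gammaCode g′))
  (trans (cong₂ _+_ (length-gammaCode g′) (List.length-replicate (2 * suc g′)))
    (solve 1 (λ g → g :+ g :+ con 2 :* g := g :* con 4) refl (suc g′)))

length-layout : ∀ {m} g′ (ss : Vec Segment m) →
                length (layout g′ ss) ≡ fieldWidth g′ * (1 + 2 * m) + totalSize ss
length-layout {m} g′ ss = trans (List.length-++ (preamble g′))
  (trans (cong₂ _+_ (length-preamble g′)
    (trans (List.length-++ (table (fieldWidth g′) (entry (offsets ss)) m))
      (cong₂ _+_ (length-table _ _ m)
        (trans (List.length-++ (table (fieldWidth g′) (entry (Vec.map width ss)) m))
          (cong₂ _+_ (length-table _ _ m) (length-payload ss))))))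
    (solve 3 (λ f m t → f :+ (m :* f :+ (m :* f :+ t)) := f :* (con 1 :+ con 2 :* m) :+ t)
       refl (fieldWidth g′) m (totalSize ss)))

bitwise-xor-self : ∀ w x → bitwise Bool._xor_ w x x ≡ 0
bitwise-xor-self zero    x = refl
bitwise-xor-self (suc w) x rewrite Bool.xor-same (does (x % 2 ≟ 1)) | bitwise-xor-self w (x / 2) = refl

bitwise-xor-∷ : ∀ w a b x y → bitwise Bool._xor_ (suc w) (x * 2 + bit a) (y * 2 + bit b) ≡
                              bit (a Bool.xor b) + 2 * bitwise Bool._xor_ w x y
bitwise-xor-∷ w a b x y = cong₂ (λ p q → bit p + 2 * q)
  (cong₂ Bool._xor_ (odd x a) (odd y b))
  (cong₂ (bitwise Bool._xor_ w) ([m*n+o]/n x (bit<2 a)) ([m*n+o]/n y (bit<2 b)))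
  where
  odd : ∀ x a → does ((x * 2 + bit a) % 2 ≟ 1) ≡ a
  odd x a rewrite [m*n+o]%n x (bit<2 a) with a
  ... | true  = refl
  ... | false = refl

-- x xor (x - 1) masks the bits of x up to the lowest one.
lowest-one : ∀ w g′ y → g′ < w → let x = 2 ^ g′ * (1 + 2 * y) in
             suc (bitwise Bool._xor_ w x (x ∸ 1)) ≡ 2 ^ suc g′
lowest-one (suc w) zero y _ = cong suc (begin
  bitwise Bool._xor_ (suc w) (1 * (1 + 2 * y)) (1 * (1 + 2 * y) ∸ 1)
    ≡⟨ cong (λ x → bitwise Bool._xor_ (suc w) x (x ∸ 1)) (*-identityˡ (1 + 2 * y)) ⟩
  bitwise Bool._xor_ (suc w) (1 + 2 * y) (2 * y)
    ≡⟨ cong₂ (bitwise Bool._xor_ (suc w)) (trans (+-comm 1 _) (cong (_+ 1) (*-comm 2 y)))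
         (trans (*-comm 2 y) (sym (+-identityʳ _))) ⟩
  bitwise Bool._xor_ (suc w) (y * 2 + 1) (y * 2 + 0) ≡⟨ bitwise-xor-∷ w true false y y ⟩
  1 + 2 * bitwise Bool._xor_ w y y                   ≡⟨ cong (λ z → 1 + 2 * z) (bitwise-xor-self w y) ⟩
  1 ∎)
  where open ≡-Reasoning
lowest-one (suc w) (suc g′) y (s≤s g′<w) = begin
  suc (bitwise Bool._xor_ (suc w) (2 * 2 ^ g′ * z) (2 * 2 ^ g′ * z ∸ 1))
    ≡⟨ cong (λ x → suc (bitwise Bool._xor_ (suc w) x (x ∸ 1)))
      (trans (*-assoc 2 (2 ^ g′) z) (*-comm 2 x′)) ⟩
  suc (bitwise Bool._xor_ (suc w) (x′ * 2) (x′ * 2 ∸ 1))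
    ≡⟨ cong₂ (λ a b → suc (bitwise Bool._xor_ (suc w) a b)) (sym (+-identityʳ (x′ * 2))) (pred-double x′) ⟩
  suc (bitwise Bool._xor_ (suc w) (x′ * 2 + 0) ((x′ ∸ 1) * 2 + 1))
    ≡⟨ cong suc (bitwise-xor-∷ w false true x′ (x′ ∸ 1)) ⟩
  2 + 2 * bitwise Bool._xor_ w x′ (x′ ∸ 1) ≡⟨ *-suc 2 _ ⟨
  2 * suc (bitwise Bool._xor_ w x′ (x′ ∸ 1)) ≡⟨ cong (2 *_) (lowest-one w g′ y g′<w) ⟩
  2 ^ suc (suc g′) ∎
  where
  open ≡-Reasoning
  z = 1 + 2 * y
  x′ = 2 ^ g′ * z
  instance
    2^g′≢0 = m^n≢0 2 g′
    x′≢0 : NonZero x′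
    x′≢0 = m*n≢0 (2 ^ g′) z
  pred-double : ∀ x .{{_ : NonZero x}} → x * 2 ∸ 1 ≡ (x ∸ 1) * 2 + 1
  pred-double (suc x) = +-comm 1 (x * 2)

-- The lowest one of the first word is bit `g′`, so the mask plus one is `2 ^ g` for `g = suc g′`.
-- Division by it brings the stored `g` to the low end, and the remainder cuts off what follows, as
-- `g < 2 ^ g`.
readUnit : ∀ {n} → Expr n
readUnit =
  call (call (op mod (op div (var zero) (var (suc zero))) (var (suc zero)))
         (var zero ∷ op add (op xor (var zero) (op sub (var zero) (lit 1))) (lit 1) ∷ []))
    (fetchE (lit 0) ∷ [])

-- The header is counted in fields: the preamble is field 0, the offsets of the `m` tables start at
-- field 1 and their widths at field `1 + m`.
readHeader : ℕ → Expr 2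
readHeader k = call readField (op mul (var zero) (op add (var (suc zero)) (lit k)) ∷ var zero ∷ [])

readTable : ℕ → Expr 4
readTable m =
  call readField
    (op add (op mul f (lit (1 + 2 * m))) (op add base (op mul i n)) ∷ n ∷ [])
  where
  f = var zero
  i = var (suc zero)
  base = var (suc (suc zero))
  n = var (suc (suc (suc zero)))

readFrom : ℕ → Expr 3
readFrom m =
  call (readTable m)
    (f ∷ i ∷ call (readHeader 1) (f ∷ s ∷ []) ∷ call (readHeader (1 + m)) (f ∷ s ∷ []) ∷ [])
  where
  f = var zero
  s = var (suc zero)
  i = var (suc (suc zero))

readSegment : ∀ {m n} → Fin m → Expr n → Expr n
readSegment {m} s e = call (readFrom m) (op mul readUnit (lit 4) ∷ lit (toℕ s) ∷ e ∷ [])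

record Fits (w g′ : ℕ) {m} (ss : Vec Segment m) : Set where
  field
    header-fits : fieldWidth g′ < w
    header-room : fieldWidth g′ * (1 + 2 * m) + totalSize ss + 1 < 2 ^ w
    sizes-fit   : totalSize ss < 2 ^ fieldWidth g′
    widths-fit  : ∀ i → width (lookup ss i) < 2 ^ fieldWidth g′
    width<w     : ∀ i → width (lookup ss i) < w
    content-fit : ∀ i j → j < count (lookup ss i) → content (lookup ss i) j < 2 ^ width (lookup ss i)

module Reading (w g′ : ℕ) {m} (ss : Vec Segment m) (mem : ℕ → ℕ) (fits : Fits w g′ ss) where
  open Fits fits
  private
    bits = layout g′ ss
    g = suc g′
    f = fieldWidth g′
  open Semantics w (dataWord w bits) mem
  open Arithmetic w (dataWord w bits) mem

  private
    instance
      2^w≢0 = m^n≢0 2 w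
      2^g≢0 = m^n≢0 2 g

    2^w>1 : 1 < 2 ^ w
    2^w>1 = ≤-<-trans (m≤n+m 1 (f * (1 + 2 * m) + totalSize ss)) header-room

    g≤f : g ≤ f
    g≤f = m≤m*n g 4

    2g≤w : g + g ≤ w
    2g≤w = ≤-trans (subst (g + g ≤_) (solve 1 (λ g → g :+ g :+ (g :+ g) := g :* con 4) refl g)
             (m≤m+n (g + g) (g + g))) (<⇒≤ header-fits)

    f<2^w : f < 2 ^ w
    f<2^w = <-trans header-fits (n<2^n w)

    fields≤ : ∀ {k} → k ≤ 2 * m → suc (f * (1 + k)) < 2 ^ w
    fields≤ {k} k≤ = ≤-<-trans (begin
      suc (f * (1 + k))                    ≡⟨ +-comm 1 _ ⟩
      f * (1 + k) + 1                      ≤⟨ +-monoˡ-≤ 1 (*-monoʳ-≤ f (s≤s k≤)) ⟩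
      f * (1 + 2 * m) + 1                  ≤⟨ +-monoˡ-≤ 1 (m≤m+n (f * (1 + 2 * m)) (totalSize ss)) ⟩
      f * (1 + 2 * m) + totalSize ss + 1   ∎) header-room
      where open ≤-Reasoning

    small : ∀ {k} → k ≤ 2 * m → 1 + k < 2 ^ w
    small {k} k≤ = ≤-<-trans (m≤n*m (1 + k) f) (<-trans (n<1+n _) (fields≤ k≤))

  private
    -- Since `4 * g < w`, the whole gamma code of `2 * g` bits lies in the first word; `z` stands
    -- for the bits after it, about which nothing is known.
    first-word : ∃[ z ] dataWord w bits 0 ≡ (suc g′ + 2 ^ g * z) * 2 ^ g + 2 ^ g′
    first-word = fromBits tail , (begin
      fromBits (take w bits)
        ≡⟨ cong fromBits word-split ⟩
      fromBits (gammaCode g′ ++ tail)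
        ≡⟨ fromBits-++ (gammaCode g′) tail ⟩
      fromBits (gammaCode g′) + 2 ^ length (gammaCode g′) * fromBits tail
        ≡⟨ cong₂ (λ a b → a + 2 ^ b * fromBits tail) head-value (length-gammaCode g′) ⟩
      2 ^ g′ + 2 ^ g * g + 2 ^ (g + g) * fromBits tail
        ≡⟨ cong (λ a → 2 ^ g′ + 2 ^ g * g + a * fromBits tail) (^-distribˡ-+-* 2 g g) ⟩
      2 ^ g′ + 2 ^ g * g + 2 ^ g * 2 ^ g * fromBits tail
        ≡⟨ solve 4 (λ p q g z → p :+ q :* g :+ q :* q :* z := (g :+ q :* z) :* q :+ p)
             refl (2 ^ g′) (2 ^ g) g (fromBits tail) ⟩
      (g + 2 ^ g * fromBits tail) * 2 ^ g + 2 ^ g′ ∎)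
      where
      open ≡-Reasoning
      rest = replicate (2 * g) false ++ table f (entry (offsets ss)) m
               ++ table f (entry (Vec.map width ss)) m ++ payload ss
      tail = take (w ∸ (g + g)) rest
      take-++ : ∀ n xs {ys : List Bool} → length xs ≤ n → take n (xs ++ ys) ≡ xs ++ take (n ∸ length xs) ys
      take-++ n       []       _         = refl
      take-++ (suc n) (x ∷ xs) (s≤s len) = cong (x ∷_) (take-++ n xs len)
      word-split : take w bits ≡ gammaCode g′ ++ tail
      word-split = begin
        take w bits                     ≡⟨ cong (take w) (List.++-assoc (gammaCode g′) _ _) ⟩
        take w (gammaCode g′ ++ rest)   ≡⟨ take-++ w (gammaCode g′)
          (subst (_≤ w) (sym (length-gammaCode g′)) 2g≤w) ⟩
        gammaCode g′ ++ take (w ∸ length (gammaCode g′)) rest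
          ≡⟨ cong (λ l → gammaCode g′ ++ take (w ∸ l) rest) (length-gammaCode g′) ⟩
        gammaCode g′ ++ tail            ∎
      zeros : ∀ n → fromBits (replicate n false) ≡ 0
      zeros zero    = refl
      zeros (suc n) rewrite zeros n = refl
      head-value : fromBits (gammaCode g′) ≡ 2 ^ g′ + 2 ^ g * g
      head-value = begin
        fromBits (gammaCode g′) ≡⟨ fromBits-++ (replicate g′ false) _ ⟩
        fromBits (replicate g′ false) + 2 ^ length (replicate g′ false) * (1 + 2 * fromBits (toBits g g))
          ≡⟨ cong₂ _+_ (zeros g′) (cong₂ (λ a b → 2 ^ a * (1 + 2 * b)) (List.length-replicate g′)
               (fromBits-toBits g (n<2^n g))) ⟩
        2 ^ g′ * (1 + 2 * g)
          ≡⟨ solve 2 (λ p g → p :* (con 1 :+ con 2 :* g) := p :+ con 2 :* p :* g) refl (2 ^ g′) g ⟩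
        2 ^ g′ + 2 ^ g * g ∎

  readUnit-value : ∀ {n} {ρ : Vec ℕ n} → ⟦ readUnit ⟧ ρ ≡ g
  readUnit-value {ρ = ρ} = begin
    ⟦ readUnit ⟧ ρ
      ≡⟨ cong (λ z → ⟦ body ⟧ (dataWord w bits z ∷ [])) (lit-value {ρ = ρ} (m^n>0 2 w)) ⟩
    ⟦ body ⟧ (x ∷ [])
      ≡⟨ cong (λ p → ⟦ inner ⟧ (x ∷ p ∷ [])) p≡ ⟩
    ⟦ inner ⟧ (x ∷ 2 ^ g ∷ [])
      ≡⟨ mod-value {ρ = x ∷ 2 ^ g ∷ []} {a = op div (var zero) (var (suc zero))} {b = var (suc zero)}
           (div-value {ρ = x ∷ 2 ^ g ∷ []} {a = var zero} {b = var (suc zero)} refl refl x<)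
           refl (≤-<-trans (m/n≤m x (2 ^ g)) x<) ⟩
    x / 2 ^ g % 2 ^ g
      ≡⟨ cong (λ y → y / 2 ^ g % 2 ^ g) x≡ ⟩
    ((g + 2 ^ g * z) * 2 ^ g + 2 ^ g′) / 2 ^ g % 2 ^ g
      ≡⟨ cong (_% 2 ^ g) ([m*n+o]/n (g + 2 ^ g * z) (^-monoʳ-< 2 (s≤s (s≤s z≤n)) (n<1+n g′))) ⟩
    (g + 2 ^ g * z) % 2 ^ g
      ≡⟨ cong (_% 2 ^ g) (trans (+-comm g _) (cong (_+ g) (*-comm (2 ^ g) z))) ⟩
    (z * 2 ^ g + g) % 2 ^ g
      ≡⟨ [m*n+o]%n z (n<2^n g) ⟩
    g ∎
    where
    open ≡-Reasoning
    x = dataWord w bits 0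
    z = proj₁ first-word
    x≡ = proj₂ first-word
    inner : Expr 2
    inner = op mod (op div (var zero) (var (suc zero))) (var (suc zero))
    mask = op xor (var zero) (op sub (var zero) (lit 1))
    body : Expr 1
    body = call inner (var zero ∷ op add mask (lit 1) ∷ [])
    x< : x < 2 ^ w
    x< = subst (_< 2 ^ w) (sym (fromBits-take w bits)) (m%n<n _ (2 ^ w))
    x-odd : x ≡ 2 ^ g′ * (1 + 2 * (g + 2 ^ g * z))
    x-odd = trans x≡ (solve 2 (λ p y → y :* (con 2 :* p) :+ p := p :* (con 1 :+ con 2 :* y))
              refl (2 ^ g′) (g + 2 ^ g * z))

    1≤x : 1 ≤ x
    1≤x = subst (1 ≤_) (sym x≡) (≤-trans (m^n>0 2 g′) (m≤n+m (2 ^ g′) _))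
    x-1≡ : ⟦ op sub (var zero) (lit 1) ⟧ (x ∷ []) ≡ x ∸ 1
    x-1≡ = sub-value {ρ = x ∷ []} {a = var zero} {b = lit 1} refl (lit-value {ρ = x ∷ []} 2^w>1) 1≤x x<
    low : suc (bitwise Bool._xor_ w x (x ∸ 1)) ≡ 2 ^ g
    low = trans (cong (λ y → suc (bitwise Bool._xor_ w y (y ∸ 1))) x-odd)
            (lowest-one w g′ (g + 2 ^ g * z) (≤-trans (m≤m+n g g) 2g≤w))
    p≡ : ⟦ op add mask (lit 1) ⟧ (x ∷ []) ≡ 2 ^ g
    p≡ = trans (add-value {ρ = x ∷ []} {a = mask} {b = lit 1}
                  (cong (bitwise Bool._xor_ w x) x-1≡) (lit-value {ρ = x ∷ []} 2^w>1)
                  (subst (_< 2 ^ w) (trans (sym low) (+-comm 1 _))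
                    (^-monoʳ-< 2 (s≤s (s≤s z≤n)) (≤-<-trans g≤f header-fits))))
               (trans (+-comm _ 1) low)

  private
    header-value : ∀ k (i : Fin m) {xs : Vec ℕ m} {pre rest} → suc (toℕ i + k) ≤ 1 + 2 * m → 0 < k →
                   bits ≡ pre ++ table f (entry xs) m ++ rest → length pre ≡ f * k →
                   lookup xs i < 2 ^ f → ⟦ readHeader k ⟧ (f ∷ toℕ i ∷ []) ≡ lookup xs i
    header-value k i {xs} {pre} {rest} ≤2m 0<k split len fit = begin
      ⟦ readHeader k ⟧ ρ
        ≡⟨ cong (λ a → ⟦ readField ⟧ (a ∷ f ∷ [])) address ⟩
      ⟦ readField ⟧ (f * (toℕ i + k) ∷ f ∷ [])
        ≡⟨ readField-value w bits mem room header-fits ⟩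
      fromBits (take f (drop (f * (toℕ i + k)) bits))
        ≡⟨ cong (λ a → fromBits (take f (drop a bits)))
             (solve 3 (λ f i k → f :* (i :+ k) := f :* k :+ i :* f) refl f (toℕ i) k) ⟩
      fromBits (take f (drop (f * k + toℕ i * f) bits))
        ≡⟨ table-field {n = f} {f = entry xs} {pre = pre} {rest} split len (Fin.toℕ<n i)
             (subst (_< 2 ^ f) (sym (entry-lookup xs i)) fit) ⟩
      entry xs (toℕ i)
        ≡⟨ entry-lookup xs i ⟩
      lookup xs i ∎
      where
      open ≡-Reasoning
      ρ : Vec ℕ 2
      ρ = f ∷ toℕ i ∷ []
      suc-pred-k : suc (pred (toℕ i + k)) ≡ toℕ i + k
      suc-pred-k = suc-pred (toℕ i + k) {{>-nonZero (<-≤-trans 0<k (m≤n+m k (toℕ i)))}}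
      room : suc (f * (toℕ i + k)) < 2 ^ w
      room = subst (λ z → suc (f * z) < 2 ^ w) suc-pred-k
               (fields≤ (≤-trans pred[n]≤n (≤-pred ≤2m)))
      sum< : toℕ i + k < 2 ^ w
      sum< = subst (_< 2 ^ w) suc-pred-k (small (≤-trans pred[n]≤n (≤-pred ≤2m)))
      address : ⟦ op mul (var zero) (op add (var (suc zero)) (lit k)) ⟧ ρ ≡ f * (toℕ i + k)
      address = mul-value {ρ = ρ} {a = var zero} {b = op add (var (suc zero)) (lit k)} refl
        (add-value {ρ = ρ} {a = var (suc zero)} {b = lit k} refl
          (lit-value {ρ = ρ} (≤-<-trans (m≤n+m k (toℕ i)) sum<)) sum<)
        (<-trans (n<1+n _) room)

  readSegment-value : ∀ {n} {ρ : Vec ℕ n} (i : Fin m) {e j} → ⟦ e ⟧ ρ ≡ j → j < count (lookup ss i) →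
                      ⟦ readSegment i e ⟧ ρ ≡ content (lookup ss i) j
  readSegment-value {ρ = ρ} i {e} {j} e≡ j< = begin
    ⟦ readSegment i e ⟧ ρ
      ≡⟨ cong₂ (λ a b → ⟦ readFrom m ⟧ (a ∷ b)) unit≡
           (cong₂ (λ a b → a ∷ b ∷ []) (lit-value {ρ = ρ} (<-trans (n<1+n (toℕ i)) (small i≤))) e≡) ⟩
    ⟦ readFrom m ⟧ (f ∷ toℕ i ∷ j ∷ [])
      ≡⟨ cong₂ (λ a b → ⟦ readTable m ⟧ (f ∷ j ∷ a ∷ b ∷ [])) base≡ width≡ ⟩
    ⟦ readTable m ⟧ (f ∷ j ∷ base ∷ n ∷ [])
      ≡⟨ cong (λ a → ⟦ readField ⟧ (a ∷ n ∷ [])) address≡ ⟩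
    ⟦ readField ⟧ (f * (1 + 2 * m) + (base + j * n) ∷ n ∷ [])
      ≡⟨ readField-value w bits mem room (width<w i) ⟩
    fromBits (take n (drop (f * (1 + 2 * m) + (base + j * n)) bits))
      ≡⟨ cong (λ a → fromBits (take n (drop a bits))) (sym (+-assoc (f * (1 + 2 * m)) base _)) ⟩
    fromBits (take n (drop (f * (1 + 2 * m) + base + j * n) bits))
      ≡⟨ table-field {n = n} {f = content s} {c = count s} {pre = pre} {proj₁ (proj₂ (payload-split ss i))}
        split
           (trans (List.length-++ header)
             (cong₂ _+_ header-length (proj₂ (proj₂ (proj₂ (payload-split ss i))))))
           j< (content-fit i j j<) ⟩
    content s j ∎
    where
    open ≡-Reasoning
    s = lookup ss i
    base = lookup (offsets ss) i
    n = width s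
    i≤ : toℕ i ≤ 2 * m
    i≤ = ≤-trans (<⇒≤ (Fin.toℕ<n i)) (m≤n*m m 2)
    unit≡ : ⟦ op mul readUnit (lit 4) ⟧ ρ ≡ f
    unit≡ = mul-value {ρ = ρ} {a = readUnit} {b = lit 4} (readUnit-value {ρ = ρ})
              (lit-value {ρ = ρ} (≤-<-trans (m≤n*m 4 g) f<2^w)) f<2^w
    t₁ = table f (entry (offsets ss)) m
    t₂ = table f (entry (Vec.map width ss)) m
    base≡ : ⟦ readHeader 1 ⟧ (f ∷ toℕ i ∷ []) ≡ base
    base≡ = header-value 1 i {xs = offsets ss} {pre = preamble g′} {rest = t₂ ++ payload ss}
      (≤-trans (s≤s (≤-reflexive (+-comm (toℕ i) 1))) (s≤s (≤-trans (Fin.toℕ<n i) (m≤n*m m 2))))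
      (s≤s z≤n) refl (trans (length-preamble g′) (sym (*-identityʳ f)))
      (≤-<-trans (≤-trans (m≤m+n base (footprint s)) (offset-bound ss i)) sizes-fit)
    width≡ : ⟦ readHeader (1 + m) ⟧ (f ∷ toℕ i ∷ []) ≡ n
    width≡ = trans (header-value (1 + m) i {xs = Vec.map width ss} {pre = preamble g′ ++ t₁}
      {rest = payload ss}
      (s≤s (≤-trans (≤-reflexive (+-suc (toℕ i) m)) (≤-trans (+-monoˡ-≤ m (Fin.toℕ<n i))
        (≤-reflexive (cong (m +_) (sym (+-identityʳ m)))))))
      (s≤s z≤n) (sym (List.++-assoc (preamble g′) t₁ _))
      (trans (List.length-++ (preamble g′)) (trans (cong₂ _+_ (length-preamble g′) (length-table f _ m))
        (trans (cong (f +_) (*-comm m f)) (sym (*-suc f m)))))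
      (subst (_< 2 ^ f) (sym (Vec.lookup-map i width ss)) (widths-fit i)))
      (Vec.lookup-map i width ss)
    header = preamble g′ ++ t₁ ++ t₂
    header-length : length header ≡ f * (1 + 2 * m)
    header-length = trans (List.length-++ (preamble g′)) (trans (cong₂ _+_ (length-preamble g′)
      (trans (List.length-++ t₁) (cong₂ _+_ (length-table f _ m) (length-table f _ m))))
      (solve 2 (λ f m → f :+ (m :* f :+ m :* f) := f :* (con 1 :+ con 2 :* m)) refl f m))

    pre = header ++ proj₁ (payload-split ss i)
    split : bits ≡ pre ++ table n (content s) (count s) ++ proj₁ (proj₂ (payload-split ss i))
    split = trans (cong (λ z → preamble g′ ++ t₁ ++ t₂ ++ z) (proj₁ (proj₂ (proj₂ (payload-split ss i)))))
      (sym (trans (List.++-assoc header (proj₁ (payload-split ss i)) _)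
        (trans (List.++-assoc (preamble g′) (t₁ ++ t₂) _)
          (cong (preamble g′ ++_) (List.++-assoc t₁ t₂ _)))))
    room : suc (f * (1 + 2 * m) + (base + j * n)) < 2 ^ w
    room = ≤-<-trans (≤-trans (≤-reflexive (+-comm 1 _)) (+-monoˡ-≤ 1 (+-monoʳ-≤ (f * (1 + 2 * m))
      (≤-trans (+-monoʳ-≤ base (*-monoˡ-≤ n (<⇒≤ j<))) (offset-bound ss i))))) header-room
    ρ′ : Vec ℕ 4
    ρ′ = f ∷ j ∷ base ∷ n ∷ []
    below : ∀ {x} → x ≤ f * (1 + 2 * m) + (base + j * n) → x < 2 ^ w
    below x≤ = ≤-<-trans x≤ (<-trans (n<1+n _) room)
    address≡ : ⟦ op add (op mul (var zero) (lit (1 + 2 * m)))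
                 (op add (var (suc (suc zero))) (op mul (var (suc zero)) (var (suc (suc (suc zero)))))) ⟧ ρ′
               ≡ f * (1 + 2 * m) + (base + j * n)
    address≡ = add-value {ρ = ρ′} {a = op mul (var zero) (lit (1 + 2 * m))}
                 {b = op add (var (suc (suc zero))) (op mul (var (suc zero)) (var (suc (suc (suc zero)))))}
      (mul-value {ρ = ρ′} {a = var zero} {b = lit (1 + 2 * m)} refl (lit-value {ρ = ρ′} (small ≤-refl))
        (below (m≤m+n (f * (1 + 2 * m)) (base + j * n))))
      (add-value {ρ = ρ′} {a = var (suc (suc zero))}
        {b = op mul (var (suc zero)) (var (suc (suc (suc zero))))} refl
        (mul-value {ρ = ρ′} {a = var (suc zero)} {b = var (suc (suc (suc zero)))} refl refl
          (below (≤-trans (m≤n+m (j * n) base) (m≤n+m (base + j * n) (f * (1 + 2 * m))))))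
        (below (m≤n+m (base + j * n) (f * (1 + 2 * m)))))
      (below ≤-refl)

-- Constant-time access to a monotone sequence

-- The lattice path of `f` from the point `(r , y)`, cut after a given number of steps: a one moves
-- to the next argument, a zero raises the value. A value is recovered by counting the zeros before
-- its one.
unary : (ℕ → ℕ) → ℕ → ℕ → ℕ → List Bool
unary f zero    r y = []
unary f (suc n) r y with f r ≟ y
... | yes _ = true ∷ unary f n (suc r) y
... | no  _ = false ∷ unary f n r (suc y)

zerosBefore : List Bool → ℕ → ℕ
zerosBefore []           i       = 0
zerosBefore (true ∷ bs)  zero    = 0
zerosBefore (true ∷ bs)  (suc i) = zerosBefore bs i
zerosBefore (false ∷ bs) i       = suc (zerosBefore bs i)

length-unary : ∀ f n r y → length (unary f n r y) ≡ n
length-unary f zero    r y = refl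
length-unary f (suc n) r y with f r ≟ y
... | yes _ = cong suc (length-unary f n (suc r) y)
... | no  _ = cong suc (length-unary f n r (suc y))

zerosBefore≤ : ∀ bs i → zerosBefore bs i ≤ length bs
zerosBefore≤ []           i       = z≤n
zerosBefore≤ (true ∷ bs)  zero    = z≤n
zerosBefore≤ (true ∷ bs)  (suc i) = m≤n⇒m≤1+n (zerosBefore≤ bs i)
zerosBefore≤ (false ∷ bs) i       = s≤s (zerosBefore≤ bs i)

Monotone : (ℕ → ℕ) → Set
Monotone f = ∀ r → f r ≤ f (suc r)

monotone-+ : ∀ {f} → Monotone f → ∀ r i → f r ≤ f (r + i)
monotone-+ {f} mono r zero    = ≤-reflexive (cong f (sym (+-identityʳ r)))
monotone-+ {f} mono r (suc i) =
  ≤-trans (monotone-+ mono r i) (subst (λ x → f (r + i) ≤ f x) (sym (+-suc r i)) (mono (r + i)))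

monotone-≤ : ∀ {f} → Monotone f → ∀ {r s} → r ≤ s → f r ≤ f s
monotone-≤ {f} mono {r} {s} r≤s = subst (λ x → f r ≤ f x) (m+[n∸m]≡n r≤s) (monotone-+ mono r (s ∸ r))

-- The one that belongs to `r + i` is preceded by `i` ones and `f (r + i) - y` zeros; the second
-- hypothesis says that it lies within the `n` bits that are kept.
unary-decode : ∀ {f} → Monotone f → ∀ n r y i → y ≤ f r → f (r + i) + i < y + n →
               y + zerosBefore (unary f n r y) i ≡ f (r + i)
unary-decode {f} mono zero r y i y≤ f< =
  contradiction (≤-trans y≤ (monotone-+ mono r i))
    (<⇒≱ (≤-<-trans (m≤m+n _ i) (subst (f (r + i) + i <_) (+-identityʳ y) f<)))
unary-decode {f} mono (suc n) r y i y≤ f< with f r ≟ y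
unary-decode {f} mono (suc n) r y zero y≤ f< | yes refl =
  trans (+-identityʳ (f r)) (cong f (sym (+-identityʳ r)))
unary-decode {f} mono (suc n) r y (suc i) y≤ f< | yes refl =
  trans (unary-decode mono n (suc r) y i (mono r)
          (≤-pred (subst₂ _≤_ (cong suc (trans (+-suc _ i) (cong (λ x → suc (f x + i)) (+-suc r i))))
                              (+-suc y n) f<)))
        (cong f (sym (+-suc r i)))
... | no fr≢y =
  trans (+-suc y _) (unary-decode mono n r (suc y) i (≤∧≢⇒< y≤ (fr≢y ∘ sym))
                      (subst (f (r + i) + i <_) (+-suc y n) f<))

least : (ℕ → ℕ) → ℕ → ℕ → ℕ
least f j zero    = 0
least f j (suc n) with f 0 ≟ j
... | yes _ = 0
... | no  _ = suc (least (f ∘ suc) j n)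

least≤ : ∀ f j n → least f j n ≤ n
least≤ f j zero    = z≤n
least≤ f j (suc n) with f 0 ≟ j
... | yes _ = z≤n
... | no  _ = s≤s (least≤ (f ∘ suc) j n)

least-correct : ∀ f {j n r} → r < n → f r ≡ j → f (least f j n) ≡ j × least f j n ≤ r
least-correct f {j} {suc n} {r} r<n fr≡j with f 0 ≟ j
least-correct f {j} {suc n} {r} r<n fr≡j | yes f0≡j = f0≡j , z≤n
least-correct f {j} {suc n} {zero} r<n fr≡j | no f0≢j = contradiction fr≡j f0≢j
least-correct f {j} {suc n} {suc r} (s≤s r<n) fr≡j | no f0≢j
  with least-correct (f ∘ suc) r<n fr≡j
... | eqn , le = eqn , s≤s le

-- The lookup table of the method of four Russians: an index combines a block code with a position
-- in the block, so that decoding is a single read.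
decodeTable : (h : ℕ) .{{_ : NonZero h}} → ℕ → ℕ
decodeTable h t = zerosBefore (toBits h (t / h)) (t % h)

decodeTable≤ : ∀ h .{{_ : NonZero h}} t → decodeTable h t ≤ h
decodeTable≤ h t = subst (decodeTable h t ≤_) (length-toBits h (t / h))
  (zerosBefore≤ (toBits h (t / h)) (t % h))

-- The points p r = v r + r are grouped by p r / h; ordinal r numbers the nonempty
-- groups, so that it grows by at most one per step.
module Blocks (v : ℕ → ℕ) (mono : Monotone v) (N : ℕ) (half full : ℕ)
  .{{half≢0 : NonZero half}} .{{full≢0 : NonZero full}} (halves : half + half ≤ full) where

  -- The position of the one for `r` in the unary code of the whole sequence. Grouping by it,
  -- instead of by `r`, bounds the number of arguments in a group and the growth of `v` inside it at
  -- once.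
  point : ℕ → ℕ
  point r = v r + r

  ordinal : ℕ → ℕ
  ordinal zero    = 0
  ordinal (suc r) with point (suc r) / half ≟ point r / half
  ... | yes _ = ordinal r
  ... | no  _ = suc (ordinal r)

  firstOf : ℕ → ℕ
  firstOf j = least ordinal j N

  blockOrdinal blockCode groupFirst groupValue groupCode : ℕ → ℕ
  blockOrdinal b = ordinal (b * half)
  blockCode b    = fromBits (unary ordinal full (b * half) (ordinal (b * half)))
  groupFirst     = firstOf
  groupValue j   = v (firstOf j)
  groupCode j    = fromBits (unary v full (firstOf j) (v (firstOf j)))

  ordinal-monotone : Monotone ordinal
  ordinal-monotone r with point (suc r) / half ≟ point r / half
  ... | yes _ = ≤-refl
  ... | no  _ = n≤1+n _

  ordinal-step : ∀ r → ordinal (suc r) ≤ suc (ordinal r)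
  ordinal-step r with point (suc r) / half ≟ point r / half
  ... | yes _ = n≤1+n _
  ... | no  _ = ≤-refl

  ordinal-+ : ∀ r i → ordinal (r + i) ≤ ordinal r + i
  ordinal-+ r zero    = ≤-reflexive (trans (cong ordinal (+-identityʳ r)) (sym (+-identityʳ _)))
  ordinal-+ r (suc i) = subst₂ _≤_ (cong ordinal (sym (+-suc r i))) (sym (+-suc _ i))
    (≤-trans (ordinal-step (r + i)) (s≤s (ordinal-+ r i)))

  point-monotone : Monotone point
  point-monotone r = +-mono-≤ (mono r) (n≤1+n r)

  -- Each new group raises the quotient by at least one. This bounds the number of nonempty groups
  -- even when long jumps of `v` leave many groups empty.
  ordinal≤ : ∀ r → ordinal r ≤ point r / half
  ordinal≤ zero    = z≤n
  ordinal≤ (suc r) with point (suc r) / half ≟ point r / half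
  ... | yes same = subst (ordinal r ≤_) (sym same) (ordinal≤ r)
  ... | no  diff = ≤-<-trans (ordinal≤ r)
    (≤∧≢⇒< (/-monoˡ-≤ half (point-monotone r)) (diff ∘ sym))

  -- `ordinal` is monotone, so equal values at both ends exclude a new group at any step between
  -- them.
  same-group : ∀ s i → ordinal s ≡ ordinal (s + i) → point s / half ≡ point (s + i) / half
  same-group s zero    _    = cong (λ x → point x / half) (sym (+-identityʳ s))
  same-group s (suc i) same rewrite +-suc s i
    with point (suc (s + i)) / half ≟ point (s + i) / half
  ... | yes eqn = trans (same-group s i same) (sym eqn)
  ... | no  _   = contradiction (monotone-+ ordinal-monotone s i) (<⇒≱ (≤-reflexive (sym same)))

  group-narrow : ∀ {s r} → s ≤ r → ordinal s ≡ ordinal r → point r < point s + half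
  group-narrow {s} {r} s≤r same = begin-strict
    point r                                 ≡⟨ m≡m%n+[m/n]*n (point r) half ⟩
    point r % half + point r / half * half  <⟨ +-monoˡ-< _ (m%n<n (point r) half) ⟩
    half + point r / half * half            ≡⟨ cong (λ q → half + q * half) same/ ⟨
    half + point s / half * half            ≤⟨ +-monoʳ-≤ half (m/n*n≤m (point s) half) ⟩
    half + point s                          ≡⟨ +-comm half (point s) ⟩
    point s + half                          ∎
    where
    open ≤-Reasoning
    same/ : point s / half ≡ point r / half
    same/ = subst (λ x → point s / half ≡ point x / half) (m+[n∸m]≡n s≤r)
              (same-group s (r ∸ s) (trans same (cong ordinal (sym (m+[n∸m]≡n s≤r)))))

  decode : ∀ {f} → Monotone f → ∀ r i → i < full → f (r + i) + i < f r + full →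
           f r + decodeTable full (fromBits (unary f full r (f r)) * full + i) ≡ f (r + i)
  decode {f} mf r i i< f< = begin
    f r + decodeTable full (c * full + i)
      ≡⟨ cong₂ (λ a b → f r + zerosBefore (toBits full a) b) ([m*n+o]/n c {full} i<)
        ([m*n+o]%n c {full} i<) ⟩
    f r + zerosBefore (toBits full (fromBits bs)) i
      ≡⟨ cong (λ n → f r + zerosBefore (toBits n (fromBits bs)) i) (sym (length-unary f full r (f r))) ⟩
    f r + zerosBefore (toBits (length bs) (fromBits bs)) i
      ≡⟨ cong (λ z → f r + zerosBefore z i) (toBits-fromBits bs) ⟩
    f r + zerosBefore bs i
      ≡⟨ unary-decode mf full r (f r) i ≤-refl f< ⟩
    f (r + i) ∎
    where
    open ≡-Reasoning
    bs = unary f full r (f r)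
    c = fromBits bs

  half≤full : half ≤ full
  half≤full = ≤-trans (m≤m+n half half) halves

  -- `ordinal` has slope at most one, so over fewer than `half` arguments its path has fewer than
  -- `2 * half` bits, which fit into a code of `full` bits. No such bound holds for `v` itself; this
  -- is why there are two levels.
  ordinal-access : ∀ r → ordinal r ≡ blockOrdinal (r / half) +
                         decodeTable full (blockCode (r / half) * full + r % half)
  ordinal-access r =
    sym (trans (decode {ordinal} ordinal-monotone s i (<-≤-trans i<half half≤full) narrow)
               (cong ordinal r≡))
    where
    s = r / half * half
    i = r % half
    i<half = m%n<n r half
    r≡ : s + i ≡ r
    r≡ = trans (+-comm s i) (sym (m≡m%n+[m/n]*n r half))
    narrow : ordinal (s + i) + i < ordinal s + full
    narrow = begin-strict
      ordinal (s + i) + i     ≤⟨ +-monoˡ-≤ i (ordinal-+ s i) ⟩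
      ordinal s + i + i       ≡⟨ +-assoc (ordinal s) i i ⟩
      ordinal s + (i + i)     <⟨ +-monoʳ-< (ordinal s) (<-≤-trans (+-mono-< i<half i<half) halves) ⟩
      ordinal s + full        ∎
      where open ≤-Reasoning

  group-first : ∀ {r} → r < N → ordinal (groupFirst (ordinal r)) ≡ ordinal r × groupFirst (ordinal r) ≤ r
  group-first r<N = least-correct ordinal r<N refl

  group-offset : ∀ {r} → r < N → r ∸ groupFirst (ordinal r) < full
  group-offset {r} r<N = <-≤-trans (+-cancelˡ-< s (r ∸ s) half (begin-strict
    s + (r ∸ s)       ≡⟨ m+[n∸m]≡n s≤r ⟩
    r                 <⟨ +-cancelˡ-< (v s) r (s + half) (begin-strict
                           v s + r             ≤⟨ +-monoˡ-≤ r (monotone-≤ mono s≤r) ⟩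
                           v r + r             <⟨ group-narrow s≤r (proj₁ (group-first r<N)) ⟩
                           v s + s + half      ≡⟨ +-assoc (v s) s half ⟩
                           v s + (s + half)    ∎) ⟩
    s + half          ∎)) half≤full
    where
    open ≤-Reasoning
    s = groupFirst (ordinal r)
    s≤r = proj₂ (group-first r<N)

  -- Groups begin at irregular places, so decoding starts at the first member of the group, which is
  -- stored along with its value; `group-narrow` keeps the path up to `r` short.
  value-access : ∀ {r} → r < N → v r ≡ groupValue (ordinal r) +
    decodeTable full (groupCode (ordinal r) * full + (r ∸ groupFirst (ordinal r)))
  value-access {r} r<N =
    sym (trans (decode {v} mono s (r ∸ s) (group-offset r<N) narrow) (cong v r≡))
    where
    s = groupFirst (ordinal r)
    s≤r = proj₂ (group-first r<N)
    r≡ = m+[n∸m]≡n s≤r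
    narrow : v (s + (r ∸ s)) + (r ∸ s) < v s + full
    narrow = +-cancelʳ-< s (v (s + (r ∸ s)) + (r ∸ s)) (v s + full) (begin-strict
      v (s + (r ∸ s)) + (r ∸ s) + s ≡⟨ cong₂ (λ a b → a + b) (cong (λ x → v x + (r ∸ s)) r≡)
        (refl {x = s}) ⟩
      v r + (r ∸ s) + s             ≡⟨ +-assoc (v r) (r ∸ s) s ⟩
      v r + (r ∸ s + s)             ≡⟨ cong (v r +_) (m∸n+n≡m s≤r) ⟩
      v r + r                       <⟨ group-narrow s≤r (proj₁ (group-first r<N)) ⟩
      v s + s + half                ≤⟨ +-monoʳ-≤ (v s + s) half≤full ⟩
      v s + s + full                ≡⟨ solve 3 (λ a b c → a :+ b :+ c := a :+ c :+ b) refl (v s) s full ⟩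
      v s + full + s                ∎)
      where open ≤-Reasoning

  code-bound : ∀ f r → fromBits (unary f full r (f r)) < 2 ^ full
  code-bound f r = <-≤-trans (fromBits< (unary f full r (f r)))
                     (^-monoʳ-≤ 2 (≤-reflexive (length-unary f full r (f r))))


-- Ranks in sorted lists

-- The pigeonhole principle for a relation in place of a function: it also covers images that are
-- only known to exist, such as an edge that witnesses an arc.
length-≤-by : ∀ {A B : Set} {xs : List A} {ys : List B} (R : A → B → Set) → Unique xs →
              (∀ {x} → x ∈ xs → ∃[ y ] y ∈ ys × R x y) →
              (∀ {x x′ y} → x ∈ xs → x′ ∈ xs → R x y → R x′ y → x ≡ x′) →
              length xs ≤ length ys
length-≤-by {xs = []} R _ _ _ = z≤n
length-≤-by {A} {B} {xs = x ∷ xs} {ys} R (x∉ ∷ uniq) image inj with image (here refl)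
... | b , b∈ , xRb with ∈-∃++ b∈
... | ps , qs , refl = begin
  suc (length xs)             ≤⟨ s≤s (length-≤-by R uniq image′ (λ p q → inj (there p) (there q))) ⟩
  suc (length (ps ++ qs))     ≡⟨ cong suc (List.length-++ ps) ⟩
  suc (length ps + length qs) ≡⟨ +-suc (length ps) (length qs) ⟨
  length ps + length (b ∷ qs) ≡⟨ List.length-++ ps ⟨
  length (ps ++ b ∷ qs)       ∎
  where
  open ≤-Reasoning
  image′ : ∀ {z} → z ∈ xs → ∃[ y ] y ∈ ps ++ qs × R z y
  image′ z∈ with image (there z∈)
  ... | y , y∈ , zRy with ∈-++⁻ ps y∈
  ... | inj₁ p           = y , ∈-++⁺ˡ p , zRy
  ... | inj₂ (there q)   = y , ∈-++⁺ʳ ps q , zRy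
  ... | inj₂ (here refl) = contradiction (inj (here refl) (there z∈) xRb zRy) (All.lookup x∉ z∈)

length-≤ : ∀ {A B : Set} {xs : List A} {ys : List B} (f : A → B) → Unique xs →
           (∀ {x} → x ∈ xs → f x ∈ ys) →
           (∀ {x y} → x ∈ xs → y ∈ xs → f x ≡ f y → x ≡ y) → length xs ≤ length ys
length-≤ f uniq f∈ inj = length-≤-by (λ x y → f x ≡ y) uniq (λ x∈ → _ , f∈ x∈ , refl)
  (λ x∈ x′∈ p q → inj x∈ x′∈ (trans p (sym q)))

length-filter-⊎ : ∀ {A : Set} {P Q R : A → Set} (P? : ∀ x → Dec (P x)) (Q? : ∀ x → Dec (Q x))
                  (R? : ∀ x → Dec (R x)) → (∀ {x} → P x → Q x ⊎ R x) → (∀ {x} → Q x → P x) →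
                  (∀ {x} → R x → P x) → (∀ {x} → Q x → ¬ R x) → ∀ xs →
                  length (filter P? xs) ≡ length (filter Q? xs) + length (filter R? xs)
length-filter-⊎ P? Q? R? split Q⇒P R⇒P disj [] = refl
length-filter-⊎ P? Q? R? split Q⇒P R⇒P disj (x ∷ xs)
  with P? x | Q? x | R? x | length-filter-⊎ P? Q? R? split Q⇒P R⇒P disj xs
... | yes p | yes q | yes r | ih = contradiction r (disj q)
... | yes p | yes q | no ¬r | ih = cong suc ih
... | yes p | no ¬q | yes r | ih = trans (cong suc ih) (sym (+-suc _ _))
... | yes p | no ¬q | no ¬r | ih = [ (λ q → contradiction q ¬q) , (λ r → contradiction r ¬r) ]′ (split p)
... | no ¬p | yes q | _     | ih = contradiction (Q⇒P q) ¬p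
... | no ¬p | no ¬q | yes r | ih = contradiction (R⇒P r) ¬p
... | no ¬p | no ¬q | no ¬r | ih = ih

at : ∀ {A : Set} → A → List A → ℕ → A
at d []       _       = d
at d (x ∷ _)  zero    = x
at d (_ ∷ xs) (suc i) = at d xs i

at-∈ : ∀ {A : Set} {d : A} {xs i} → i < length xs → at d xs i ∈ xs
at-∈ {xs = x ∷ xs} {zero}  _         = here refl
at-∈ {xs = x ∷ xs} {suc i} (s≤s i<) = there (at-∈ i<)

at-++ʳ : ∀ {A : Set} {d : A} xs {ys} i → at d (xs ++ ys) (length xs + i) ≡ at d ys i
at-++ʳ []       i = refl
at-++ʳ (x ∷ xs) i = at-++ʳ xs i

at-++ˡ : ∀ {A : Set} {d : A} xs {ys i} → i < length xs → at d (xs ++ ys) i ≡ at d xs i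
at-++ˡ (x ∷ xs) {i = zero}  _         = refl
at-++ˡ (x ∷ xs) {i = suc i} (s≤s i<) = at-++ˡ xs i<

module _ {A B : Set} (row : A → List B) where

  rowStart : List A → ℕ → ℕ
  rowStart xs i = length (concatMap row (take i xs))

  rowStart-suc : ∀ {d} xs {i} → i < length xs →
                 rowStart xs (suc i) ≡ rowStart xs i + length (row (at d xs i))
  rowStart-suc (x ∷ xs) {zero}  _         = cong length (List.++-identityʳ (row x))
  rowStart-suc {d} (x ∷ xs) {suc i} (s≤s i<) = begin
    length (row x ++ concatMap row (take (suc i) xs)) ≡⟨ List.length-++ (row x) ⟩
    length (row x) + rowStart xs (suc i)              ≡⟨ cong (length (row x) +_) (rowStart-suc xs i<) ⟩
    length (row x) + (rowStart xs i + length (row (at d xs i)))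
      ≡⟨ +-assoc (length (row x)) (rowStart xs i) _ ⟨
    length (row x) + rowStart xs i + length (row (at d xs i))
      ≡⟨ cong (_+ length (row (at d xs i))) (List.length-++ (row x)) ⟨
    length (row x ++ concatMap row (take i xs)) + length (row (at d xs i)) ∎
    where open ≡-Reasoning

  rowStart≤ : ∀ xs i → rowStart xs i ≤ length (concatMap row xs)
  rowStart≤ xs       zero    = z≤n
  rowStart≤ []       (suc i) = z≤n
  rowStart≤ (x ∷ xs) (suc i) = subst₂ _≤_ (sym (List.length-++ (row x))) (sym (List.length-++ (row x)))
                                 (+-monoʳ-≤ (length (row x)) (rowStart≤ xs i))

  at-row : ∀ {d e} xs {i j} → i < length xs → j < length (row (at d xs i)) →
           at e (concatMap row xs) (rowStart xs i + j) ≡ at e (row (at d xs i)) j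
  at-row (x ∷ xs) {zero}  _ j< = at-++ˡ (row x) j<
  at-row {d} {e} (x ∷ xs) {suc i} {j} (s≤s i<) j< = begin
    at e (row x ++ concatMap row xs) (length (row x ++ concatMap row (take i xs)) + j)
      ≡⟨ cong (λ n → at e (row x ++ concatMap row xs) (n + j)) (List.length-++ (row x)) ⟩
    at e (row x ++ concatMap row xs) (length (row x) + rowStart xs i + j)
      ≡⟨ cong (at e (row x ++ concatMap row xs)) (+-assoc (length (row x)) _ j) ⟩
    at e (row x ++ concatMap row xs) (length (row x) + (rowStart xs i + j))
      ≡⟨ at-++ʳ (row x) _ ⟩
    at e (concatMap row xs) (rowStart xs i + j) ≡⟨ at-row xs i< j< ⟩
    at e (row (at d xs i)) j ∎
    where open ≡-Reasoning

module Ranked {A : Set} (_⊏_ : A → A → Set) (order : IsStrictTotalOrder _≡_ _⊏_) where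
  open IsStrictTotalOrder order using ()
    renaming (compare to ⊏-cmp; irrefl to ⊏-irrefl; trans to ⊏-trans; _<?_ to _⊏?_) public

  infix 4 _⊑_
  _⊑_ : A → A → Set
  x ⊑ y = ¬ (y ⊏ x)

  ⊏⇒⊑ : ∀ {x y} → x ⊏ y → x ⊑ y
  ⊏⇒⊑ p q = ⊏-irrefl refl (⊏-trans p q)

  ⊑-refl : ∀ {x} → x ⊑ x
  ⊑-refl = ⊏-irrefl refl

  ⊑-split : ∀ {x y} → x ⊑ y → x ⊏ y ⊎ x ≡ y
  ⊑-split {x} {y} x⊑y with ⊏-cmp x y
  ... | tri< p _ _ = inj₁ p
  ... | tri≈ _ p _ = inj₂ p
  ... | tri> _ _ p = contradiction p x⊑y

  ⊏-⊑-trans : ∀ {x y z} → x ⊏ y → y ⊑ z → x ⊏ z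
  ⊏-⊑-trans p q with ⊑-split q
  ... | inj₁ r    = ⊏-trans p r
  ... | inj₂ refl = p

  ⊑-trans : ∀ {x y z} → x ⊑ y → y ⊑ z → x ⊑ z
  ⊑-trans p q r = q (⊏-⊑-trans r p)

  ⊑-antisym : ∀ {x y} → x ⊑ y → y ⊑ x → x ≡ y
  ⊑-antisym p q with ⊑-split p
  ... | inj₁ r = contradiction r q
  ... | inj₂ r = r

  rank : A → List A → ℕ
  rank x xs = length (filter (_⊏? x) xs)

  within : ∀ lo hi x → Dec (lo ⊑ x × x ⊏ hi)
  within lo hi x = ¬? (x ⊏? lo) ×-dec (x ⊏? hi)

  between : A → A → List A → ℕ
  between lo hi xs = length (filter (within lo hi) xs)

  Sorted : List A → Set
  Sorted = AllPairs _⊏_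

  sorted⇒unique : ∀ {xs} → Sorted xs → Unique xs
  sorted⇒unique = AllPairs.map (λ x⊏y x≡y → ⊏-irrefl x≡y x⊏y)

  at-rank : ∀ {d xs x} → Sorted xs → x ∈ xs → at d xs (rank x xs) ≡ x
  at-rank {d} {x ∷ xs} (x⊏ ∷ _) (here refl)
    rewrite List.filter-none (_⊏? x) {x ∷ xs} (⊏-irrefl refl ∷ All.map ⊏⇒⊑ x⊏) = refl
  at-rank {d} {y ∷ xs} {x} (y⊏ ∷ s) (there x∈)
    rewrite List.filter-accept (_⊏? x) {y} {xs} (All.lookup y⊏ x∈) = at-rank s x∈

  rank< : ∀ {xs x} → x ∈ xs → rank x xs < length xs
  rank< {xs} {x} x∈ = List.filter-notAll (_⊏? x) xs (Any.map (λ { refl → ⊏-irrefl refl }) x∈)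

  rank≤ : ∀ xs x → rank x xs ≤ length xs
  rank≤ xs x = List.length-filter (_⊏? x) xs

  rank-split : ∀ {lo hi} → lo ⊑ hi → ∀ xs → rank hi xs ≡ rank lo xs + between lo hi xs
  rank-split {lo} {hi} lo⊑hi = length-filter-⊎ (_⊏? hi) (_⊏? lo) (within lo hi)
    (λ {x} x⊏hi → case x ⊏? lo of λ where
      (yes p) → inj₁ p
      (no ¬p) → inj₂ (¬p , x⊏hi))
    (λ x⊏lo → ⊏-⊑-trans x⊏lo lo⊑hi) proj₂ (λ x⊏lo (lo⊑x , _) → lo⊑x x⊏lo)

  between-split : ∀ {lo mid hi} → lo ⊑ mid → mid ⊑ hi → ∀ xs →
                  between lo hi xs ≡ between lo mid xs + between mid hi xs
  between-split {lo} {mid} {hi} lo⊑mid mid⊑hi =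
    length-filter-⊎ (within lo hi) (within lo mid) (within mid hi)
      (λ {x} (lo⊑x , x⊏hi) → case x ⊏? mid of λ where
        (yes p) → inj₁ (lo⊑x , p)
        (no ¬p) → inj₂ (¬p , x⊏hi))
      (λ (lo⊑x , x⊏mid) → lo⊑x , ⊏-⊑-trans x⊏mid mid⊑hi)
      (λ (mid⊑x , x⊏hi) → ⊑-trans lo⊑mid mid⊑x , x⊏hi)
      (λ (_ , x⊏mid) (mid⊑x , _) → mid⊑x x⊏mid)

  rank-monotone : ∀ {x y} → x ⊑ y → ∀ xs → rank x xs ≤ rank y xs
  rank-monotone x⊑y xs = ≤-trans (m≤m+n _ _) (≤-reflexive (sym (rank-split x⊑y xs)))

  between≤ : ∀ lo hi xs → between lo hi xs ≤ length xs
  between≤ lo hi xs = List.length-filter (within lo hi) xs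

  between< : ∀ {lo hi xs} → hi ∈ xs → between lo hi xs < length xs
  between< {lo} {hi} {xs} hi∈ =
    List.filter-notAll (within lo hi) xs (Any.map (λ { refl (_ , p) → ⊏-irrefl refl p }) hi∈)

  at-strict : ∀ {d xs} → Sorted xs → ∀ {i j} → i < j → j < length xs → at d xs i ⊏ at d xs j
  at-strict {xs = x ∷ xs} (x⊏ ∷ s) {zero}  {suc j} _ (s≤s j<) = All.lookup x⊏ (at-∈ j<)
  at-strict {xs = x ∷ xs} (x⊏ ∷ s) {suc i} {suc j} (s≤s i<j) (s≤s j<) = at-strict s i<j j<

  at-sorted : ∀ {d xs} → Sorted xs → ∀ {i j} → i ≤ j → j < length xs → at d xs i ⊑ at d xs j
  at-sorted s i≤j j< with m≤n⇒m<n∨m≡n i≤j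
  ... | inj₁ i<j  = ⊏⇒⊑ (at-strict s i<j j<)
  ... | inj₂ refl = ⊑-refl

  minimum : ∀ {P : A → Set} (P? : ∀ x → Dec (P x)) xs → Any P xs →
            ∃[ y ] y ∈ xs × P y × (∀ {z} → z ∈ xs → P z → y ⊑ z)
  minimum P? (y ∷ xs) any with P? y | Any.any? P? xs
  minimum P? (y ∷ xs) (here py) | no ¬py | _ = contradiction py ¬py
  minimum P? (y ∷ xs) (there any) | no ¬py | _ with minimum P? xs any
  ... | m , m∈ , pm , least = m , there m∈ , pm , λ where
    (here refl) pz → contradiction pz ¬py
    (there z∈)  pz → least z∈ pz
  minimum P? (y ∷ xs) _ | yes py | no none = y , here refl , py , λ where
    (here refl) _  → ⊑-refl
    (there z∈)  pz → contradiction (Any.map (λ { refl → pz }) z∈) none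
  minimum P? (y ∷ xs) _ | yes py | yes any with minimum P? xs any
  ... | m , m∈ , pm , least with y ⊏? m
  ... | yes y⊏m = y , here refl , py , λ where
    (here refl) _  → ⊑-refl
    (there z∈)  pz → ⊏⇒⊑ (⊏-⊑-trans y⊏m (least z∈ pz))
  ... | no m⊑y = m , there m∈ , pm , λ where
    (here refl) _  → m⊑y
    (there z∈)  pz → least z∈ pz

-- Strings in reversed order of reading, compared lexicographically

module _ {σ : ℕ} where

  infix 4 _<ₗ_
  _<ₗ_ : ∀ {ℓ} → Vec (Fin σ) ℓ → Vec (Fin σ) ℓ → Set
  _<ₗ_ = Lex.Lex-< _≡_ Fin._<_

  lexOrder : ∀ {ℓ} → IsStrictTotalOrder _≡_ (_<ₗ_ {ℓ})
  lexOrder {ℓ} = record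
    { isStrictPartialOrder = record
      { isEquivalence = isEquivalence
      ; irrefl = λ { refl → L.irrefl (Pointwise.refl refl) }
      ; trans = L.trans
      ; <-resp-≈ = (λ { refl p → p }) , (λ { refl p → p }) }
    ; compare = λ x y → case L.compare x y of λ where
        (tri< a b c) → tri< a (b ∘ Pointwise.≡⇒Pointwise-≡) c
        (tri≈ a b c) → tri≈ a (Pointwise.Pointwise-≡⇒≡ b) c
        (tri> a b c) → tri> a (b ∘ Pointwise.≡⇒Pointwise-≡) c
    }
    where
    module L = IsStrictTotalOrder (Lex.<-isStrictTotalOrder (Fin.<-isStrictTotalOrder {σ}) {ℓ})

  tail-< : ∀ {ℓ c} {ρ τ : Vec (Fin σ) ℓ} → c ∷ ρ <ₗ c ∷ τ → ρ <ₗ τ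
  tail-< (Lex.this c<c _) = contradiction c<c (<-irrefl refl)
  tail-< (Lex.next _ ρ<τ) = ρ<τ

  head-≤ : ∀ {ℓ c d} {ρ τ : Vec (Fin σ) ℓ} → c ∷ ρ <ₗ d ∷ τ → toℕ c ≤ toℕ d
  head-≤ (Lex.this c<d _)  = <⇒≤ c<d
  head-≤ (Lex.next refl _) = ≤-refl

  -- In this order of reading, front removes the first letter of the string.
  front : ∀ {ℓ} → Vec (Fin σ) (suc ℓ) → Vec (Fin σ) ℓ
  front (x ∷ [])        = []
  front (x ∷ ys@(_ ∷ _)) = x ∷ front ys

  front-∷ʳ : ∀ {ℓ} (ρ : Vec (Fin σ) ℓ) b → front (ρ ∷ʳ b) ≡ ρ
  front-∷ʳ []           b = refl
  front-∷ʳ (x ∷ [])     b = refl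
  front-∷ʳ (x ∷ y ∷ ρ) b = cong (x ∷_) (front-∷ʳ (y ∷ ρ) b)

  -- The deleted letter is the least significant one in this order. It may be the only difference,
  -- so the order survives only weakly.
  front-⊑ : ∀ {ℓ} {ρ τ : Vec (Fin σ) (suc ℓ)} → ρ <ₗ τ → ¬ (front τ <ₗ front ρ)
  front-⊑ {ρ = x ∷ []}     {y ∷ []}     _ = λ { (Lex.base ()) }
  front-⊑ {ρ = x ∷ _ ∷ _} {y ∷ _ ∷ _} (Lex.this x<y _) q = contradiction (head-≤ q) (<⇒≱ x<y)
  front-⊑ {ρ = x ∷ _ ∷ _} {y ∷ _ ∷ _} (Lex.next refl p) q = front-⊑ p (tail-< q)

  module _ {ℓ : ℕ} where
    open Ranked (_<ₗ_ {ℓ}) lexOrder public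

  product-sorted : ∀ {ℓ} {cs : List (Fin σ)} {ρs : List (Vec (Fin σ) ℓ)} → AllPairs Fin._<_ cs →
                   Sorted ρs → Sorted (cartesianProductWith _∷_ cs ρs)
  product-sorted [] s = []
  product-sorted {cs = c ∷ cs} {ρs} (c< ∷ cs<) s =
    AllPairs.++⁺ (AllPairs.map⁺ (AllPairs.map (Lex.next refl) s)) (product-sorted cs< s)
      (All.map⁺ (All.tabulate λ {ρ} _ → All.tabulate λ {τ} τ∈ → smaller τ∈ c<))
    where
    smaller : ∀ {ρ ds τ} → τ ∈ cartesianProductWith _∷_ ds ρs → All (c Fin.<_) ds → c ∷ ρ <ₗ τ
    smaller {ds = d ∷ ds} τ∈ (c<d ∷ c<ds) with ∈-++⁻ (map (d ∷_) ρs) τ∈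
    ... | inj₂ τ∈′ = smaller τ∈′ c<ds
    ... | inj₁ τ∈′ with ∈-map⁻ (d ∷_) τ∈′
    ... | _ , _ , refl = Lex.this c<d refl

  allMers-sorted : ∀ ℓ → Sorted (allMers σ ℓ)
  allMers-sorted zero    = [] ∷ []
  allMers-sorted (suc ℓ) = product-sorted (AllPairs.tabulate⁺-< id) (allMers-sorted ℓ)

  ∈-allMers : ∀ {ℓ} (ρ : Vec (Fin σ) ℓ) → ρ ∈ allMers σ ℓ
  ∈-allMers []      = here refl
  ∈-allMers (c ∷ ρ) = ∈-cartesianProductWith⁺ _∷_ (∈-allFin c) (∈-allMers ρ)

-- Strings and vertices of a Wheeler graph

module Reversed {σ : ℕ} (W : LabeledGraph σ) where
  open LabeledGraph W

  Mer : ℕ → Set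
  Mer ℓ = Vec (Fin σ) ℓ

  -- The recursion removes the last letter of the string, which is the head here: W1 and W2 compare
  -- edges by their labels and sources, so arguments lead from a vertex back to its predecessors.
  RReach : ∀ {ℓ} → Mer ℓ → Vertex → Set
  RReach []      v = ⊤
  RReach (c ∷ ρ) v = ∃[ p ] Edge p v c × RReach ρ p

  RContains : ∀ {ℓ} → Mer ℓ → Set
  RContains ρ = ∃[ v ] RReach ρ v

  rreach? : ∀ {ℓ} (ρ : Mer ℓ) v → Dec (RReach ρ v)
  rreach? []      v = yes tt
  rreach? (c ∷ ρ) v = Fin.any? λ p → edge? p v c ×-dec rreach? ρ p

  rcontains? : ∀ {ℓ} (ρ : Mer ℓ) → Dec (RContains ρ)
  rcontains? ρ = Fin.any? (rreach? ρ)

  RWalk : ∀ {ℓ} → Vertex → Mer ℓ → Vertex → Set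
  RWalk u []      v = u ≡ v
  RWalk u (c ∷ ρ) v = ∃[ p ] Edge p v c × RWalk u ρ p

  rwalk-∷ʳ⁺ : ∀ {ℓ u x v a} (ρ : Mer ℓ) → Edge u x a → RWalk x ρ v → RWalk u (ρ ∷ʳ a) v
  rwalk-∷ʳ⁺ []      e refl        = _ , e , refl
  rwalk-∷ʳ⁺ (c ∷ ρ) e (p , e′ , r) = p , e′ , rwalk-∷ʳ⁺ ρ e r

  rwalk-∷ʳ⁻ : ∀ {ℓ u v a} (ρ : Mer ℓ) → RWalk u (ρ ∷ʳ a) v → ∃[ x ] Edge u x a × RWalk x ρ v
  rwalk-∷ʳ⁻ []      (p , e , refl) = _ , e , refl
  rwalk-∷ʳ⁻ (c ∷ ρ) (p , e′ , r) with rwalk-∷ʳ⁻ ρ r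
  ... | x , e , r′ = x , e , p , e′ , r′

  walk⇒rwalk : ∀ {ℓ u v} (α : Mer ℓ) → Walk W u α v → RWalk u (reverse α) v
  walk⇒rwalk []      []      = refl
  walk⇒rwalk (a ∷ α) (e ∷ p) = subst (λ ρ → RWalk _ ρ _) (sym (Vec.reverse-∷ a α))
                                 (rwalk-∷ʳ⁺ (reverse α) e (walk⇒rwalk α p))

  rwalk⇒walk : ∀ {ℓ u v} (α : Mer ℓ) → RWalk u (reverse α) v → Walk W u α v
  rwalk⇒walk []      refl = []
  rwalk⇒walk (a ∷ α) r with rwalk-∷ʳ⁻ (reverse α) (subst (λ ρ → RWalk _ ρ _) (Vec.reverse-∷ a α) r)
  ... | x , e , r′ = e ∷ rwalk⇒walk α r′

  rwalk⇒rreach : ∀ {ℓ u v} (ρ : Mer ℓ) → RWalk u ρ v → RReach ρ v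
  rwalk⇒rreach []      _           = tt
  rwalk⇒rreach (c ∷ ρ) (p , e , r) = p , e , rwalk⇒rreach ρ r

  rreach⇒rwalk : ∀ {ℓ v} (ρ : Mer ℓ) → RReach ρ v → ∃[ u ] RWalk u ρ v
  rreach⇒rwalk []      _           = _ , refl
  rreach⇒rwalk (c ∷ ρ) (p , e , r) with rreach⇒rwalk ρ r
  ... | u , r′ = u , p , e , r′

  reaches⇒ : ∀ {ℓ v} {α : Mer ℓ} → Reaches W α v → RReach (reverse α) v
  reaches⇒ {α = α} (u , p) = rwalk⇒rreach (reverse α) (walk⇒rwalk α p)

  reaches⇐ : ∀ {ℓ v} {α : Mer ℓ} → RReach (reverse α) v → Reaches W α v
  reaches⇐ {α = α} r with rreach⇒rwalk (reverse α) r
  ... | u , r′ = u , rwalk⇒walk α r′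

  contains⇒ : ∀ {ℓ} {α : Mer ℓ} → Contains W α → RContains (reverse α)
  contains⇒ (v , r) = v , reaches⇒ r

  contains⇐ : ∀ {ℓ} {α : Mer ℓ} → RContains (reverse α) → Contains W α
  contains⇐ (v , r) = v , reaches⇐ r

  rreach-front : ∀ {ℓ v} (ρ : Mer (suc ℓ)) → RReach ρ v → RReach (front ρ) v
  rreach-front (c ∷ [])        _           = tt
  rreach-front (c ∷ ρ@(_ ∷ _)) (p , e , r) = p , e , rreach-front ρ r

  merList : ∀ ℓ → List (Mer ℓ)
  merList ℓ = filter rcontains? (allMers σ ℓ)

  merList-sorted : ∀ ℓ → Sorted (merList ℓ)
  merList-sorted ℓ = AllPairs.filter⁺ rcontains? (allMers-sorted ℓ)

  ∈-merList : ∀ {ℓ} {ρ : Mer ℓ} → RContains ρ → ρ ∈ merList ℓ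
  ∈-merList r = ∈-filter⁺ rcontains? (∈-allMers _) r

  ∈-merList⁻ : ∀ {ℓ} {ρ : Mer ℓ} → ρ ∈ merList ℓ → RContains ρ
  ∈-merList⁻ {ℓ} ρ∈ = proj₂ (∈-filter⁻ rcontains? {xs = allMers σ ℓ} ρ∈)

  allMers-unique : ∀ ℓ → Unique (allMers σ ℓ)
  allMers-unique ℓ = sorted⇒unique (allMers-sorted ℓ)

  merList≤merCount : ∀ ℓ → length (merList ℓ) ≤ merCount W ℓ
  merList≤merCount ℓ = length-≤ reverse (sorted⇒unique (merList-sorted ℓ))
    (λ {ρ} ρ∈ → ∈-filter⁺ (contains? W) (∈-allMers (reverse ρ))
      (contains⇐ (subst RContains (sym (Vec.reverse-involutive ρ)) (∈-merList⁻ ρ∈))))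
    (λ _ _ → Vec.reverse-injective)

  Same : ∀ {ℓ} → Mer ℓ → Mer ℓ → Set
  Same ρ τ = ∀ x → (RReach ρ x → RReach τ x) × (RReach τ x → RReach ρ x)

  same? : ∀ {ℓ} (ρ τ : Mer ℓ) → Dec (Same ρ τ)
  same? ρ τ = Fin.all? λ x → (rreach? ρ x →-dec rreach? τ x) ×-dec (rreach? τ x →-dec rreach? ρ x)

  same-refl : ∀ {ℓ} {ρ : Mer ℓ} → Same ρ ρ
  same-refl x = id , id

  same-reflexive : ∀ {ℓ} {ρ τ : Mer ℓ} → ρ ≡ τ → Same ρ τ
  same-reflexive refl x = id , id

  same-sym : ∀ {ℓ} {ρ τ : Mer ℓ} → Same ρ τ → Same τ ρ
  same-sym s x = proj₂ (s x) , proj₁ (s x)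

  same-trans : ∀ {ℓ} {ρ τ υ : Mer ℓ} → Same ρ τ → Same τ υ → Same ρ υ
  same-trans s t x = proj₁ (t x) ∘ proj₁ (s x) , proj₂ (s x) ∘ proj₂ (t x)

  same-∷ : ∀ {ℓ} c {ρ τ : Mer ℓ} → Same ρ τ → Same (c ∷ ρ) (c ∷ τ)
  same-∷ c s x = (λ (p , e , r) → p , e , proj₁ (s p) r) , (λ (p , e , r) → p , e , proj₂ (s p) r)

  same-contains : ∀ {ℓ} {ρ τ : Mer ℓ} → Same ρ τ → RContains ρ → RContains τ
  same-contains s (v , r) = v , proj₁ (s v) r

  firstSpec : ∀ {ℓ} {ρ : Mer ℓ} → RContains ρ →
              ∃[ φ ] φ ∈ merList ℓ × Same ρ φ × (∀ {τ} → τ ∈ merList ℓ → Same ρ τ → φ ⊑ τ)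
  firstSpec {ℓ} {ρ} r = minimum (same? ρ) (merList ℓ) (Any.map (λ { refl → same-refl }) (∈-merList r))

  -- The least string of a class is its name, so that classes can be listed, counted and ranked as
  -- strings. A string that does not occur is its own value by default.
  first : ∀ {ℓ} → Mer ℓ → Mer ℓ
  first ρ with rcontains? ρ
  ... | yes r = proj₁ (firstSpec r)
  ... | no  _ = ρ

  module _ {ℓ : ℕ} where

    first-props : ∀ {ρ : Mer ℓ} → RContains ρ → RContains (first ρ) × Same ρ (first ρ) ×
                  (∀ {τ} → RContains τ → Same ρ τ → first ρ ⊑ τ)
    first-props {ρ} r with rcontains? ρ
    ... | no ¬r = contradiction r ¬r
    ... | yes r with firstSpec r
    ... | φ , φ∈ , s , least = ∈-merList⁻ φ∈ , s , least ∘ ∈-merList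

    first-contained : ∀ {ρ : Mer ℓ} → RContains ρ → RContains (first ρ)
    first-contained r = proj₁ (first-props r)

    first-same : ∀ {ρ : Mer ℓ} → RContains ρ → Same ρ (first ρ)
    first-same r = proj₁ (proj₂ (first-props r))

    first-least : ∀ {ρ τ : Mer ℓ} → RContains ρ → RContains τ → Same ρ τ → first ρ ⊑ τ
    first-least r = proj₂ (proj₂ (first-props r))

    first⊑ : ∀ {ρ : Mer ℓ} → RContains ρ → first ρ ⊑ ρ
    first⊑ {ρ} r = first-least r r (same-refl {ρ = ρ})

    first-cong : ∀ {ρ τ : Mer ℓ} → RContains ρ → RContains τ → Same ρ τ → first ρ ≡ first τ
    first-cong {ρ} {τ} r t s = ⊑-antisym
      (first-least r (first-contained t) (same-trans {ρ = ρ} {τ} s (first-same t)))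
      (first-least t (first-contained r) (same-trans {ρ = τ} {ρ} (same-sym {ρ = ρ} s) (first-same r)))

    first-first : ∀ {ρ : Mer ℓ} → RContains ρ → first (first ρ) ≡ first ρ
    first-first r = sym (first-cong r (first-contained r) (first-same r))

    IsFirst : Mer ℓ → Set
    IsFirst ρ = RContains ρ × ρ ≡ first ρ

    isFirst? : ∀ ρ → Dec (IsFirst ρ)
    isFirst? ρ = rcontains? ρ ×-dec Vec.≡-dec Fin._≟_ ρ (first ρ)

  firsts : ∀ ℓ → List (Mer ℓ)
  firsts ℓ = filter isFirst? (allMers σ ℓ)

  firsts-sorted : ∀ ℓ → Sorted (firsts ℓ)
  firsts-sorted ℓ = AllPairs.filter⁺ isFirst? (allMers-sorted ℓ)

  ∈-firsts⁻ : ∀ {ℓ} {ρ : Mer ℓ} → ρ ∈ firsts ℓ → IsFirst ρ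
  ∈-firsts⁻ {ℓ} ρ∈ = proj₂ (∈-filter⁻ isFirst? {xs = allMers σ ℓ} ρ∈)

  ∈-firsts : ∀ {ℓ} {ρ : Mer ℓ} → RContains ρ → first ρ ∈ firsts ℓ
  ∈-firsts r = ∈-filter⁺ isFirst? (∈-allMers _) (first-contained r , sym (first-first r))

  firsts≤merList : ∀ ℓ → length (firsts ℓ) ≤ length (merList ℓ)
  firsts≤merList ℓ = length-≤ id (sorted⇒unique (firsts-sorted ℓ))
    (λ ρ∈ → ∈-merList (proj₁ (∈-firsts⁻ ρ∈))) (λ _ _ → id)

  -- `offset` counts all contained strings from the representative up to `ρ`. That they all belong
  -- to the class is `class-convex`, so membership is not tested.
  classId offset : ∀ {ℓ} → Mer ℓ → ℕ
  classId {ℓ} ρ = rank (first ρ) (firsts ℓ)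
  offset  {ℓ} ρ = between (first ρ) ρ (merList ℓ)

  classId< : ∀ {ℓ} {ρ : Mer ℓ} → RContains ρ → classId ρ < length (firsts ℓ)
  classId< r = rank< (∈-firsts r)

  at-classId : ∀ {ℓ d} {ρ : Mer ℓ} → RContains ρ → at d (firsts ℓ) (classId ρ) ≡ first ρ
  at-classId {ℓ} r = at-rank (firsts-sorted ℓ) (∈-firsts r)

  -- Each extensible string is the tail of a string that is one letter longer, so their number is
  -- bounded by the number of those; contained strings in general may end only in vertices without
  -- outgoing edges.
  RightExtensible : ∀ {ℓ} → Mer ℓ → Set
  RightExtensible ρ = ∃[ c ] RContains (c ∷ ρ)

  rightExtensible? : ∀ {ℓ} (ρ : Mer ℓ) → Dec (RightExtensible ρ)
  rightExtensible? ρ = Fin.any? λ c → rcontains? (c ∷ ρ)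

  tail-contained : ∀ {ℓ c} {ρ : Mer ℓ} → RContains (c ∷ ρ) → RContains ρ
  tail-contained (_ , p , _ , r) = p , r

  rightList : ∀ ℓ → List (Mer ℓ)
  rightList ℓ = filter rightExtensible? (allMers σ ℓ)

  rightList≤ : ∀ ℓ → length (rightList ℓ) ≤ length (merList (suc ℓ))
  rightList≤ ℓ = length-≤-by (λ ρ τ → ρ ≡ Vec.tail τ)
    (AllPairs.filter⁺ rightExtensible? (allMers-unique ℓ))
    (λ ρ∈ → let (c , r) = proj₂ (∈-filter⁻ rightExtensible? {xs = allMers σ ℓ} ρ∈)
             in c ∷ _ , ∈-merList r , refl)
    (λ _ _ p q → trans p (sym q))

-- Consequences of the Wheeler order: intervals, classes and offsets

module Wheeler {σ : ℕ} (W : LabeledGraph σ) (O : WheelerOrder W) (det : Deterministic W) where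
  open LabeledGraph W
  open WheelerOrder O
  open Reversed W
  module V = Ranked _≺_ isStrictTotalOrder

  ≼⇒⊑ : ∀ {u v} → u ≼ v → u V.⊑ v
  ≼⇒⊑ (inj₁ p)    = V.⊏⇒⊑ p
  ≼⇒⊑ (inj₂ refl) = V.⊑-refl

  -- A vertex strictly between two targets of `c`-edges has an incoming edge; W1 squeezes its label
  -- to `c`, and W2 squeezes its source between the two sources, to which the induction hypothesis
  -- applies.
  convex : ∀ {ℓ} (ρ : Mer ℓ) {u x v} → RReach ρ u → RReach ρ v → u ≼ x → x ≼ v → RReach ρ x
  convex ρ r s (inj₂ refl) _ = r
  convex ρ r s (inj₁ _) (inj₂ refl) = s
  convex [] _ _ _ _ = tt
  convex (c ∷ ρ) {u} {x} {v} (p , e , r) (q , f , s) (inj₁ u≺x) (inj₁ x≺v)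
    with Fin.any? (λ y → Fin.any? λ a → edge? y x a)
  -- Without incoming edges `x` would precede `u`, which has one.
  ... | no none = contradiction (sources-first (λ (y , a , e) → none (y , a , e)) (p , c , e))
                    (V.⊏⇒⊑ u≺x)
  ... | yes (y , a , g) with Fin.<-cmp a c
  ... | tri< a<c _ _ = contradiction (W1 g e a<c) (V.⊏⇒⊑ u≺x)
  ... | tri> _ _ c<a = contradiction (W1 f g c<a) (V.⊏⇒⊑ x≺v)
  ... | tri≈ _ refl _ with V.⊏-cmp y p | V.⊏-cmp q y
  -- A source before `p` would by W2 have its target `x` at or before `u`.
  ... | tri< y≺p _ _ | _ = contradiction u≺x (≼⇒⊑ (W2 g e y≺p))
  ... | _ | tri< q≺y _ _ = contradiction x≺v (≼⇒⊑ (W2 f g q≺y))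
  ... | tri≈ _ refl _ | _ = y , g , r
  ... | tri> _ _ p≺y | tri≈ _ refl _ = y , g , s
  ... | tri> _ _ p≺y | tri> _ _ y≺q = y , g , convex ρ r s (inj₁ p≺y) (inj₁ y≺q)

  -- Different last letters are settled by W1. For equal ones the sources decide: in the right order
  -- by W2, and if equal, determinism makes the targets equal. Sources in the wrong order contradict
  -- the induction hypothesis.
  monotone : ∀ {ℓ} {ρ τ : Mer ℓ} {u v} → ρ <ₗ τ → RReach ρ u → RReach τ v → u V.⊑ v
  monotone (Lex.base ()) _ _ _
  monotone (Lex.this c<d _) (p , e , r) (q , f , s) v≺u = V.⊏⇒⊑ (W1 e f c<d) v≺u
  monotone (Lex.next refl ρ<τ) (p , e , r) (q , f , s) v≺u with V.⊏-cmp p q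
  ... | tri< p≺q _ _  = ≼⇒⊑ (W2 e f p≺q) v≺u
  ... | tri≈ _ refl _ = V.⊏-irrefl (det f e) v≺u
  ... | tri> _ _ q≺p  = monotone ρ<τ r s q≺p

  -- A vertex reached by `ρ` is also reached by `υ`, so by monotonicity a vertex of a string
  -- strictly between them is neither before nor after it. Hence both sets consist of one and the
  -- same vertex.
  class-convex : ∀ {ℓ} {ρ τ υ : Mer ℓ} → RContains ρ → RContains τ → ρ ⊑ τ → τ ⊑ υ →
                 Same ρ υ → Same ρ τ
  class-convex {ρ = ρ} {τ} (y , ρy) (z , τz) ρ⊑τ τ⊑υ same with ⊑-split ρ⊑τ | ⊑-split τ⊑υ
  ... | inj₂ refl | _ = same-refl {ρ = ρ}
  ... | _ | inj₂ refl = same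
  ... | inj₁ ρ<τ | inj₁ τ<υ = λ x →
    (λ ρx → subst (RReach τ) (sym (coincide ρx τz)) τz) ,
    (λ τx → subst (RReach ρ) (coincide ρy τx) ρy)
    where
    coincide : ∀ {x y} → RReach ρ x → RReach τ y → x ≡ y
    coincide ρx τy = V.⊑-antisym (monotone ρ<τ ρx τy) (monotone τ<υ τy (proj₁ (same _) ρx))

  -- If the representatives were in the wrong order, `ρ` would lie between `first τ` and `τ`, and so
  -- belong to the class of `τ`.
  first-monotone : ∀ {ℓ} {ρ τ : Mer ℓ} → RContains ρ → RContains τ → ρ ⊑ τ → first ρ ⊑ first τ
  first-monotone {ρ = ρ} {τ} r t ρ⊑τ φτ<φρ =
    ⊑-refl (subst (_<ₗ first ρ) first-eq φτ<φρ)
    where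
    τ~ρ : Same (first τ) ρ
    τ~ρ = class-convex (first-contained t) r
      (⊏⇒⊑ (⊏-⊑-trans φτ<φρ (first⊑ r))) ρ⊑τ (same-sym {ρ = τ} (first-same t))
    first-eq : first τ ≡ first ρ
    first-eq = trans (sym (first-first t)) (first-cong (first-contained t) r τ~ρ)

  classId-monotone : ∀ {ℓ} {ρ τ : Mer ℓ} → RContains ρ → RContains τ → ρ ⊑ τ →
                     classId ρ ≤ classId τ
  classId-monotone {ℓ} r t ρ⊑τ = rank-monotone (first-monotone r t ρ⊑τ) (firsts ℓ)

  -- The strings counted by an offset are members of the class, so every list of contained strings
  -- that includes the whole class gives the same count.
  between-class : ∀ {ℓ} {P : Mer ℓ → Set} (P? : ∀ τ → Dec (P τ)) {ρ} → RContains ρ →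
                  (∀ {τ} → P τ → RContains τ) → (∀ {τ} → Same (first ρ) τ → P τ) →
                  between (first ρ) ρ (filter P? (allMers σ ℓ)) ≡ offset ρ
  between-class {ℓ} {P} P? {ρ} r contained P-same = ≤-antisym
    (length-≤ id (filtered P?) (λ τ∈ → let (τ∈P , w) = ∈-filter⁻ within? τ∈ in
       ∈-filter⁺ within? (∈-merList (contained (proj₂ (∈-filter⁻ P? {xs = allMers σ ℓ} τ∈P)))) w)
      (λ _ _ → id))
    (length-≤ id (filtered rcontains?) (λ τ∈ → let (τ∈M , w) = ∈-filter⁻ within? τ∈ in
       ∈-filter⁺ within? (∈-filter⁺ P? (∈-allMers _) (P-same (in-class (∈-merList⁻ τ∈M) w))) w)
      (λ _ _ → id))
    where
    within? = within (first ρ) ρ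
    filtered : ∀ {Q : Mer ℓ → Set} (Q? : ∀ τ → Dec (Q τ)) →
             Unique (filter within? (filter Q? (allMers σ ℓ)))
    filtered Q? = AllPairs.filter⁺ within? (AllPairs.filter⁺ Q? (allMers-unique ℓ))
    in-class : ∀ {τ} → RContains τ → first ρ ⊑ τ × τ <ₗ ρ → Same (first ρ) τ
    in-class t (φ⊑τ , τ<ρ) = class-convex (first-contained r) t φ⊑τ (⊏⇒⊑ τ<ρ)
      (same-sym {ρ = ρ} (first-same r))

  -- This converts offsets into ranks and back: among the strings that reach a given vertex, and
  -- among the extensible strings, rank and offset differ by a constant of the class.
  rank-class : ∀ {ℓ} {P : Mer ℓ → Set} (P? : ∀ τ → Dec (P τ)) {ρ} → RContains ρ →
               (∀ {τ} → P τ → RContains τ) → (∀ {τ} → Same (first ρ) τ → P τ) →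
               rank ρ (filter P? (allMers σ ℓ)) ≡
               rank (first ρ) (filter P? (allMers σ ℓ)) + offset ρ
  rank-class {ℓ} P? {ρ} r contained P-same =
    trans (rank-split (first⊑ r) (filter P? (allMers σ ℓ)))
          (cong (rank (first ρ) (filter P? (allMers σ ℓ)) +_) (between-class P? r contained P-same))

  -- Appending `c` maps the strings from `first ρ` up to `ρ` in order to those from `c ∷ first ρ` up
  -- to `c ∷ ρ`. It is defined on all of them because a class extends by `c` as a whole, and onto
  -- because every string in the image range has head `c`. The remaining shift depends on the class
  -- and the letter only; it may be positive, as `c` can merge several classes.
  offset-∷ : ∀ {ℓ c} {ρ : Mer ℓ} → RContains (c ∷ ρ) →
             offset (c ∷ ρ) ≡ offset (c ∷ first ρ) + offset ρ
  offset-∷ {ℓ} {c} {ρ} cr = begin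
    between (first (c ∷ ρ)) (c ∷ ρ) M′
      ≡⟨ cong (λ f → between f (c ∷ ρ) M′) first-eq ⟩
    between (first (c ∷ φ)) (c ∷ ρ) M′
      ≡⟨ between-split (first⊑ cφ) cφ⊑cρ M′ ⟩
    offset (c ∷ φ) + between (c ∷ φ) (c ∷ ρ) M′
      ≡⟨ cong (offset (c ∷ φ) +_) (≤-antisym shrink grow) ⟩
    offset (c ∷ φ) + offset ρ ∎
    where
    open ≡-Reasoning
    r = tail-contained cr
    φ = first ρ
    M′ = merList (suc ℓ)
    same : Same (c ∷ ρ) (c ∷ φ)
    same = same-∷ c {ρ} (first-same r)
    cφ : RContains (c ∷ φ)
    cφ = same-contains {ρ = c ∷ ρ} same cr
    first-eq : first (c ∷ ρ) ≡ first (c ∷ φ)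
    first-eq = first-cong cr cφ same
    cφ⊑cρ : c ∷ φ ⊑ c ∷ ρ
    cφ⊑cρ p = first⊑ r (tail-< p)
    same-head : ∀ {d τ} → c ∷ φ ⊑ d ∷ τ → d ∷ τ <ₗ c ∷ ρ → d ≡ c
    same-head {d} lo hi with Fin.<-cmp d c
    ... | tri< d<c _ _ = contradiction (Lex.this d<c refl) lo
    ... | tri≈ _ d≡c _ = d≡c
    ... | tri> _ _ c<d = contradiction (head-≤ hi) (<⇒≱ c<d)
    shrink : between (c ∷ φ) (c ∷ ρ) M′ ≤ offset ρ
    shrink = length-≤-by (λ τ′ τ → τ′ ≡ c ∷ τ)
      (AllPairs.filter⁺ (within (c ∷ φ) (c ∷ ρ)) (sorted⇒unique (merList-sorted (suc ℓ))))
      (λ {τ′} → image τ′) (λ _ _ p q → trans p (sym q))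
      where
      image : ∀ τ′ → τ′ ∈ filter (within (c ∷ φ) (c ∷ ρ)) M′ →
              ∃[ τ ] τ ∈ filter (within φ ρ) (merList ℓ) × τ′ ≡ c ∷ τ
      image (d ∷ τ) τ′∈ with ∈-filter⁻ (within (c ∷ φ) (c ∷ ρ)) {xs = M′} τ′∈
      ... | τ′∈M , lo , hi with same-head lo hi
      ... | refl = τ , ∈-filter⁺ (within φ ρ) (∈-merList (tail-contained (∈-merList⁻ τ′∈M)))
                         ((λ p → lo (Lex.next refl p)) , tail-< hi) , refl
    grow : offset ρ ≤ between (c ∷ φ) (c ∷ ρ) M′
    grow = length-≤ (c ∷_)
      (AllPairs.filter⁺ (within φ ρ) (sorted⇒unique (merList-sorted ℓ)))
      (λ {τ} τ∈ → let (τ∈M , lo , hi) = ∈-filter⁻ (within φ ρ) {xs = merList ℓ} τ∈ in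
        ∈-filter⁺ (within (c ∷ φ) (c ∷ ρ))
          (∈-merList (same-contains {ρ = c ∷ φ} (same-∷ c {φ}
            (class-convex (first-contained r) (∈-merList⁻ τ∈M) lo (⊏⇒⊑ hi)
              (same-sym {ρ = ρ} (first-same r)))) cφ))
          ((λ p → lo (tail-< p)) , Lex.next refl hi))
      (λ _ _ → λ { refl → refl })

  -- Of two different strings, the larger one cannot reach a vertex before `x` when the smaller one
  -- reaches `x`. All counts of classes and arcs rest on this and its mirror image.
  determined-below : ∀ {ℓ} {ρ τ : Mer ℓ} {x y z} → RReach ρ x → RReach τ x →
                     RReach ρ y → y ≺ x → RReach τ z → z ≺ x → ρ ≡ τ
  determined-below {ρ = ρ} {τ} ρx τx ρy y≺x τz z≺x with ⊏-cmp ρ τ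
  ... | tri< ρ<τ _ _ = contradiction z≺x (monotone ρ<τ ρx τz)
  ... | tri≈ _ ρ≡τ _ = ρ≡τ
  ... | tri> _ _ τ<ρ = contradiction y≺x (monotone τ<ρ τx ρy)

  determined-above : ∀ {ℓ} {ρ τ : Mer ℓ} {x y z} → RReach ρ x → RReach τ x →
                     RReach ρ y → x ≺ y → RReach τ z → x ≺ z → ρ ≡ τ
  determined-above {ρ = ρ} {τ} ρx τx ρy x≺y τz x≺z with ⊏-cmp ρ τ
  ... | tri< ρ<τ _ _ = contradiction x≺y (monotone ρ<τ ρy τx)
  ... | tri≈ _ ρ≡τ _ = ρ≡τ
  ... | tri> _ _ τ<ρ = contradiction x≺z (monotone τ<ρ τz ρx)

  firsts-injective : ∀ {ℓ} {ρ τ : Mer ℓ} → ρ ∈ firsts ℓ → τ ∈ firsts ℓ → Same ρ τ → ρ ≡ τ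
  firsts-injective ρ∈ τ∈ s with ∈-firsts⁻ ρ∈ | ∈-firsts⁻ τ∈
  ... | r , ρ≡ | t , τ≡ = trans ρ≡ (trans (first-cong r t s) (sym τ≡))

-- Handles and the sizes of the tables

length-cartesianProduct : ∀ {A B : Set} (xs : List A) (ys : List B) →
                          length (cartesianProduct xs ys) ≡ length xs * length ys
length-cartesianProduct []       ys = refl
length-cartesianProduct (x ∷ xs) ys = trans (List.length-++ (map (x ,_) ys))
  (cong₂ _+_ (List.length-map (x ,_) ys) (length-cartesianProduct xs ys))

-- A set of vertices reached by some string is determined by its left endpoint p
-- and by whether its right endpoint q differs from p.
handleCode : ℕ → ℕ → ℕ
handleCode p q = p * 2 + (1 ∸ bit (does (p ≟ q)))

handleCode-bit : ∀ p q → 1 ∸ bit (does (p ≟ q)) < 2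
handleCode-bit p q = s≤s (m∸n≤m 1 (bit (does (p ≟ q))))

handleCode-injective : ∀ {p q p′ q′} → handleCode p q ≡ handleCode p′ q′ →
                       p ≡ p′ × (p ≡ q → p′ ≡ q′) × (p′ ≡ q′ → p ≡ q)
handleCode-injective {p} {q} {p′} {q′} eqn = quot , from p q p′ q′ rem , from p′ q′ p q (sym rem)
  where
  quot : p ≡ p′
  quot = trans (sym ([m*n+o]/n p (handleCode-bit p q)))
           (trans (cong (_/ 2) eqn) ([m*n+o]/n p′ (handleCode-bit p′ q′)))
  rem : 1 ∸ bit (does (p ≟ q)) ≡ 1 ∸ bit (does (p′ ≟ q′))
  rem = trans (sym ([m*n+o]%n p (handleCode-bit p q)))
          (trans (cong (_% 2) eqn) ([m*n+o]%n p′ (handleCode-bit p′ q′)))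
  from : ∀ p q p′ q′ → 1 ∸ bit (does (p ≟ q)) ≡ 1 ∸ bit (does (p′ ≟ q′)) → p ≡ q → p′ ≡ q′
  from p q p′ q′ e p≡q with p ≟ q | p′ ≟ q′
  ... | _       | yes e′ = e′
  ... | no p≢q | _      = contradiction p≡q p≢q
  from p q p′ q′ e p≡q | yes p≡q′ | no p′≢ = contradiction
    (trans (sym (cong (λ b → 1 ∸ bit b) (dec-true (p ≟ q) p≡q)))
      (trans e (cong (λ b → 1 ∸ bit b) (dec-false (p′ ≟ q′) p′≢)))) λ ()

module Handles {σ : ℕ} (W : LabeledGraph σ) (O : WheelerOrder W) (det : Deterministic W) where
  open LabeledGraph W
  open WheelerOrder O
  open Reversed W
  open Wheeler W O det
  -- In the reversed order, `minimum` yields right endpoints.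
  module V˘ = Ranked (λ u v → v ≺ u) (Flip.isStrictTotalOrder isStrictTotalOrder)

  vertices : List Vertex
  vertices = allFin order

  ⊑⇒≼ : ∀ {u v} → u V.⊑ v → u ≼ v
  ⊑⇒≼ = V.⊑-split

  position-mono : ∀ {u v} → u ≺ v → position u < position v
  position-mono {u} {v} u≺v = begin-strict
    position u                          <⟨ m<m+n (position u)
      (∈-length (∈-filter⁺ (V.within u v) (∈-allFin u) (V.⊑-refl , u≺v))) ⟩
    position u + V.between u v vertices ≡⟨ V.rank-split (V.⊏⇒⊑ u≺v) vertices ⟨
    position v                          ∎
    where open ≤-Reasoning

  position-injective : ∀ {u v} → position u ≡ position v → u ≡ v
  position-injective {u} {v} eqn with V.⊏-cmp u v
  ... | tri< u≺v _ _ = contradiction eqn (<⇒≢ (position-mono u≺v))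
  ... | tri≈ _ u≡v _ = u≡v
  ... | tri> _ _ v≺u = contradiction (sym eqn) (<⇒≢ (position-mono v≺u))

  position< : ∀ u → position u < order
  position< u = subst (position u <_) (List.length-tabulate id) (V.rank< (∈-allFin u))

  -- The endpoints are not mentioned: counting the vertices before all, or before some, of the
  -- reached ones gives functions that are defined on every string and depend only on the set
  -- reached.
  leftPos rightPos code : ∀ {ℓ} → Mer ℓ → ℕ
  leftPos ρ  = length (filter (λ x → Fin.all? λ y → rreach? ρ y →-dec (x ≺? y)) vertices)
  rightPos ρ = length (filter (λ x → Fin.any? λ y → rreach? ρ y ×-dec (x ≺? y)) vertices)
  code ρ     = handleCode (leftPos ρ) (rightPos ρ)

  Extent : ∀ {ℓ} → Mer ℓ → Vertex → Vertex → Set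
  Extent ρ u v = RReach ρ u × RReach ρ v × (∀ {x} → RReach ρ x → u V.⊑ x × x V.⊑ v)

  extent : ∀ {ℓ} {ρ : Mer ℓ} → RContains ρ → ∃[ u ] ∃[ v ] Extent ρ u v
  extent {ρ = ρ} (x , r)
    with V.minimum (rreach? ρ) vertices (Any.map (λ { refl → r }) (∈-allFin x))
       | V˘.minimum (rreach? ρ) vertices (Any.map (λ { refl → r }) (∈-allFin x))
  ... | u , _ , ru , least | v , _ , rv , greatest =
    u , v , ru , rv , λ {y} ry → least (∈-allFin y) ry , greatest (∈-allFin y) ry

  leftPos-extent : ∀ {ℓ} {ρ : Mer ℓ} {u v} → Extent ρ u v → leftPos ρ ≡ position u
  leftPos-extent (ru , _ , bounds) = cong length (List.filter-≐ _ (_≺? _)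
    ((λ below → below _ ru) , λ x≺u y ry → V.⊏-⊑-trans x≺u (proj₁ (bounds ry))) vertices)

  rightPos-extent : ∀ {ℓ} {ρ : Mer ℓ} {u v} → Extent ρ u v → rightPos ρ ≡ position v
  rightPos-extent (_ , rv , bounds) = cong length (List.filter-≐ _ (_≺? _)
    ((λ (y , ry , x≺y) → V.⊏-⊑-trans x≺y (proj₂ (bounds ry))) , λ x≺v → _ , rv , x≺v) vertices)

  leftPos< : ∀ {ℓ} {ρ : Mer ℓ} → RContains ρ → leftPos ρ < order
  leftPos< r with extent r
  ... | u , v , E = subst (_< order) (sym (leftPos-extent E)) (position< u)

  rightPos< : ∀ {ℓ} {ρ : Mer ℓ} → RContains ρ → rightPos ρ < order
  rightPos< r with extent r
  ... | u , v , E = subst (_< order) (sym (rightPos-extent E)) (position< v)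

  extent-same : ∀ {ℓ} {ρ τ : Mer ℓ} {u v} → Same ρ τ → Extent ρ u v → Extent τ u v
  extent-same s (ru , rv , bounds) = proj₁ (s _) ru , proj₁ (s _) rv , bounds ∘ proj₂ (s _)

  extent-unique : ∀ {ℓ} {ρ : Mer ℓ} {u v u′ v′} → Extent ρ u v → Extent ρ u′ v′ → u ≡ u′ × v ≡ v′
  extent-unique (ru , rv , bounds) (ru′ , rv′ , bounds′) =
    V.⊑-antisym (proj₁ (bounds ru′)) (proj₁ (bounds′ ru)) ,
    V.⊑-antisym (proj₂ (bounds′ rv)) (proj₂ (bounds rv′))

  code-first : ∀ {ℓ} {ρ : Mer ℓ} {u v} → RContains ρ → Extent ρ u v →
               code (first ρ) ≡ handleCode (position u) (position v)
  code-first r E = cong₂ handleCode (leftPos-extent E′) (rightPos-extent E′)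
    where E′ = extent-same (first-same r) E

  -- Equal codes give equal left ends, and either both sets are that single vertex, or both continue
  -- beyond it.
  code-injective : ∀ {ℓ} {ρ τ : Mer ℓ} → RContains ρ → RContains τ → code ρ ≡ code τ → Same ρ τ
  code-injective {ρ = ρ} {τ} r t eqn with extent r | extent t
  ... | u , v , E@(ru , rv , b) | u′ , v′ , E′@(ru′ , rv′ , b′)
    with handleCode-injective (subst₂ _≡_
           (cong₂ handleCode (leftPos-extent E) (rightPos-extent E))
           (cong₂ handleCode (leftPos-extent E′) (rightPos-extent E′)) eqn)
  ... | pu , to , from with position-injective pu
  ... | refl with V.⊏-cmp u v
  ... | tri> _ _ v≺u = contradiction v≺u (proj₁ (b rv))
  ... | tri< u≺v _ _ with ⊑⇒≼ (proj₁ (b′ rv′))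
  -- Both sets continue beyond `u`, and then even the strings are equal.
  ... | inj₁ u≺v′ = same-reflexive {ρ = ρ} {τ} (determined-above ru ru′ rv u≺v rv′ u≺v′)
  ... | inj₂ refl = contradiction (from refl) (<⇒≢ (position-mono u≺v))
  code-injective {ρ = ρ} {τ} r t eqn | u , v , E@(ru , rv , b) | u′ , v′ , E′@(ru′ , rv′ , b′)
    | pu , to , from | refl | tri≈ _ refl _ with position-injective (to refl)
  ... | refl = λ x → (λ rx → subst (RReach τ) (V.⊑-antisym (proj₁ (b rx)) (proj₂ (b rx))) ru′) ,
                     (λ tx → subst (RReach ρ) (V.⊑-antisym (proj₁ (b′ tx)) (proj₂ (b′ tx))) ru)

  code< : ∀ {ℓ} {ρ : Mer ℓ} → RContains ρ → code ρ < order * 2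
  code< {ρ = ρ} r = begin-strict
    leftPos ρ * 2 + (1 ∸ bit (does (leftPos ρ ≟ rightPos ρ)))
      <⟨ +-monoʳ-< (leftPos ρ * 2) (handleCode-bit (leftPos ρ) (rightPos ρ)) ⟩
    leftPos ρ * 2 + 2   ≡⟨ +-comm (leftPos ρ * 2) 2 ⟩
    suc (leftPos ρ) * 2 ≤⟨ *-monoˡ-≤ 2 (leftPos< r) ⟩
    order * 2           ∎
    where open ≤-Reasoning

  firsts≤2n : ∀ ℓ → length (firsts ℓ) ≤ order * 2
  firsts≤2n ℓ = subst (length (firsts ℓ) ≤_) (List.length-upTo (order * 2))
    (length-≤ code (sorted⇒unique (firsts-sorted ℓ))
      (λ ρ∈ → ∈-upTo⁺ (code< (proj₁ (∈-firsts⁻ ρ∈))))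
      (λ ρ∈ τ∈ eqn → firsts-injective ρ∈ τ∈
        (code-injective (proj₁ (∈-firsts⁻ ρ∈)) (proj₁ (∈-firsts⁻ τ∈)) eqn)))

  reachList : ∀ {ℓ} → Vertex → List (Mer ℓ)
  reachList {ℓ} u = filter (λ τ → rreach? τ u) (allMers σ ℓ)

  colexRank-rank : ∀ {ℓ} (α : Mer ℓ) u → colexRank W α u ≡ suc (rank (reverse α) (reachList u))
  colexRank-rank {ℓ} α u = cong suc (≤-antisym
    (length-≤ reverse (AllPairs.filter⁺ smaller? (allMers-unique ℓ))
      (λ β∈ → let (r , β<α) = proj₂ (∈-filter⁻ smaller? {xs = allMers σ ℓ} β∈) in
        ∈-filter⁺ (_⊏? reverse α) (∈-filter⁺ (λ τ → rreach? τ u) (∈-allMers _) (reaches⇒ r)) β<α)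
      (λ _ _ → Vec.reverse-injective))
    (length-≤ reverse
      (AllPairs.filter⁺ (_⊏? reverse α) (AllPairs.filter⁺ (λ τ → rreach? τ u) (allMers-unique ℓ)))
      (λ {τ} τ∈ → let (τ∈J , τ<α) = ∈-filter⁻ (_⊏? reverse α) {xs = reachList u} τ∈
                      r = proj₂ (∈-filter⁻ (λ τ → rreach? τ u) {xs = allMers σ ℓ} τ∈J)
                      back = sym (Vec.reverse-involutive τ) in
        ∈-filter⁺ smaller? (∈-allMers (reverse τ))
          (reaches⇐ (subst (λ z → RReach z u) back r) , subst (_<ₗ reverse α) back τ<α))
      (λ _ _ → Vec.reverse-injective)))
    where
    smaller? : ∀ β → Dec (Reaches W β u × β <colex α)
    smaller? β = reaches? W β u ×-dec β <colex? α

  -- The index in the handle of `ρ`, hence counted from one; 0 is a default for strings that do not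
  -- occur.
  startRank : ∀ {ℓ} → Mer ℓ → ℕ
  startRank ρ with rcontains? ρ
  ... | yes r = suc (rank ρ (reachList (proj₁ (extent r))))
  ... | no  _ = 0

  startRank-extent : ∀ {ℓ} {ρ : Mer ℓ} {u v} → Extent ρ u v → startRank ρ ≡ suc (rank ρ (reachList u))
  startRank-extent {ρ = ρ} E with rcontains? ρ
  ... | no ¬r = contradiction (_ , proj₁ E) ¬r
  ... | yes r = cong (λ x → suc (rank ρ (reachList x)))
    (proj₁ (extent-unique {ρ = ρ} (proj₂ (proj₂ (extent r))) E))

  startRank≤ : ∀ {ℓ} {ρ : Mer ℓ} → RContains ρ → startRank ρ ≤ length (merList ℓ)
  startRank≤ {ℓ} {ρ} r with extent r
  ... | u , v , E = subst (_≤ length (merList ℓ)) (sym (startRank-extent E))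
    (≤-trans (rank< (∈-filter⁺ (λ τ → rreach? τ u) (∈-allMers ρ) (proj₁ E)))
      (length-≤ id (AllPairs.filter⁺ (λ τ → rreach? τ u) (allMers-unique ℓ))
        (λ {τ} τ∈ → ∈-merList (u , proj₂ (∈-filter⁻ (λ τ → rreach? τ u) {xs = allMers σ ℓ} τ∈)))
        (λ _ _ → id)))

  -- The other members of the class reach `u` as well, so they are also consecutive among the
  -- strings reaching `u`.
  index-rank : ∀ {ℓ} {ρ : Mer ℓ} {u v} → RContains ρ → Extent ρ u v →
               suc (rank ρ (reachList u)) ≡ startRank (first ρ) + offset ρ
  index-rank {ℓ} {ρ} {u} r E = trans
    (cong suc (rank-class (λ τ → rreach? τ u) r (λ τu → u , τu)
      (λ s → proj₁ (s u) (proj₁ E′))))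
    (cong (_+ offset ρ) (sym (startRank-extent E′)))
    where E′ = extent-same {ρ = ρ} (first-same r) E

  handle-extent : ∀ {ℓ} {α : Mer ℓ} {u v j} → IsHandle O α ⟨ u , v , j ⟩ →
                  RContains (reverse α) × Extent (reverse α) u v ×
                  j ≡ suc (rank (reverse α) (reachList u))
  handle-extent {α = α} {u} {v} H = (u , ru) , (ru , rv , bounds) , trans isRank (colexRank-rank α u)
    where
    open IsHandle H
    ru = reaches⇒ (proj₂ reached u (inj₂ refl) (proj₁ reached))
    rv = reaches⇒ (proj₂ reached v (proj₁ reached) (inj₂ refl))
    bounds : ∀ {x} → RReach (reverse α) x → u V.⊑ x × x V.⊑ v
    bounds {x} rx = ≼⇒⊑ (proj₁ m) , ≼⇒⊑ (proj₂ m)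
      where
      -- Maximality, applied to the interval consisting of `x` alone, places every reached vertex
      -- between the endpoints.
      m = maximal x x (inj₂ refl , λ y x≼y y≼x → reaches⇐ (subst (RReach (reverse α))
            (V.⊑-antisym (≼⇒⊑ x≼y) (≼⇒⊑ y≼x)) rx))

  extent-handle : ∀ {ℓ} {α : Mer ℓ} {u v j} → Extent (reverse α) u v →
                  j ≡ suc (rank (reverse α) (reachList u)) → IsHandle O α ⟨ u , v , j ⟩
  extent-handle {α = α} {u} {v} (ru , rv , bounds) j≡ = record
    { reached = ⊑⇒≼ (proj₁ (bounds rv)) , λ x u≼x x≼v → reaches⇐ (convex (reverse α) ru rv u≼x x≼v)
    ; maximal = λ u′ v′ (u′≼v′ , all) →
        ⊑⇒≼ (proj₁ (bounds (reaches⇒ (all u′ (inj₂ refl) u′≼v′)))) ,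
        ⊑⇒≼ (proj₂ (bounds (reaches⇒ (all v′ u′≼v′ (inj₂ refl)))))
    ; isRank = trans j≡ (sym (colexRank-rank α u))
    }

  labels : ∀ {ℓ} → Mer ℓ → List (Fin σ)
  labels ρ = filter (λ c → rcontains? (c ∷ ρ)) (allFin σ)

  row : ∀ {ℓ} → Mer ℓ → List (Mer ℓ × Fin σ)
  row φ = map (φ ,_) (labels φ)

  arcs : ∀ ℓ → List (Mer ℓ × Fin σ)
  arcs ℓ = concatMap row (firsts ℓ)

  ∈-arcs⁻ : ∀ {ℓ} {φ : Mer ℓ} {c} → (φ , c) ∈ arcs ℓ → φ ∈ firsts ℓ × RContains (c ∷ φ)
  ∈-arcs⁻ {ℓ} {φ} {c} x∈ = find (∈-concatMap⁻ row {xs = firsts ℓ} x∈)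
    where
    find : ∀ {φs} → Any (λ τ → (φ , c) ∈ row τ) φs → φ ∈ φs × RContains (c ∷ φ)
    find (there any) with find any
    ... | φ∈ , r = there φ∈ , r
    find (here {τ} in-row) with ∈-map⁻ (τ ,_) in-row
    ... | _ , c∈ , refl = here refl , proj₂ (∈-filter⁻ (λ c → rcontains? (c ∷ φ)) {xs = allFin σ} c∈)

  arcs-unique : ∀ ℓ → Unique (arcs ℓ)
  arcs-unique ℓ = Unique.concat⁺
    (All.map⁺ (All.tabulate λ {φ} _ → Unique.map⁺ (λ { refl → refl })
      (AllPairs.filter⁺ (λ c → rcontains? (c ∷ φ)) (Unique.allFin⁺ σ))))
    (AllPairs.map⁺ (AllPairs.map (λ φ≢τ {_} (p , q) → φ≢τ (fst-row p q)) (sorted⇒unique (firsts-sorted ℓ))))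
    where
    fst-row : ∀ {φ τ : Mer ℓ} {x} → x ∈ row φ → x ∈ row τ → φ ≡ τ
    fst-row {φ} {τ} p q with ∈-map⁻ (φ ,_) p | ∈-map⁻ (τ ,_) q
    ... | _ , _ , refl | _ , _ , refl = refl

  -- Besides the bound by edges, this one is needed for the width of entries: row starts of a level
  -- are numbers up to the number of its arcs.
  arcs≤merList : ∀ ℓ → length (arcs ℓ) ≤ length (merList (suc ℓ))
  arcs≤merList ℓ = length-≤ (λ (φ , c) → c ∷ φ) (arcs-unique ℓ)
    (λ x∈ → ∈-merList (proj₂ (∈-arcs⁻ x∈))) (λ { {_ , _} {_ , _} _ _ refl → refl })

  Low High : ∀ {ℓ} → Mer ℓ → Vertex → Set
  Low ρ x  = ∃[ y ] RReach ρ y × y ≺ x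
  High ρ x = ∃[ y ] RReach ρ y × x ≺ y

  low? : ∀ {ℓ} (ρ : Mer ℓ) x → Dec (Low ρ x)
  low? ρ x = Fin.any? λ y → rreach? ρ y ×-dec (y ≺? x)

  high? : ∀ {ℓ} (ρ : Mer ℓ) x → Dec (High ρ x)
  high? ρ x = Fin.any? λ y → rreach? ρ y ×-dec (x ≺? y)

  -- If both sets extend below `x`, or both above it, the strings are equal; if neither set extends
  -- in any direction, both are just `x`.
  same-flags : ∀ {ℓ} {ρ τ : Mer ℓ} {x} → RReach ρ x → RReach τ x → does (low? ρ x) ≡ does (low? τ x) →
               does (high? ρ x) ≡ does (high? τ x) → Same ρ τ
  same-flags {ρ = ρ} {τ} {x} ρx τx low high with low? ρ x | low? τ x | high? ρ x | high? τ x
  ... | yes (y , ρy , y≺x) | yes (z , τz , z≺x) | _ | _ =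
    same-reflexive {ρ = ρ} {τ} (determined-below ρx τx ρy y≺x τz z≺x)
  ... | _ | _ | yes (y , ρy , x≺y) | yes (z , τz , x≺z) =
    same-reflexive {ρ = ρ} {τ} (determined-above ρx τx ρy x≺y τz x≺z)
  ... | no ¬low | no ¬low′ | no ¬high | no ¬high′ = λ y →
    (λ ρy → subst (RReach τ) (V.⊑-antisym (λ p → ¬low (y , ρy , p)) (λ p → ¬high (y , ρy , p))) τx) ,
    (λ τy → subst (RReach ρ) (V.⊑-antisym (λ p → ¬low′ (y , τy , p)) (λ p → ¬high′ (y , τy , p))) ρx)

  -- An arc `(φ , c)` is charged to a `c`-edge leaving a vertex `x` reached by `φ`, together with
  -- the two flags of `φ` at `x`. The edge yields `c` and `x`, and then `same-flags` yields the
  -- class.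
  arcs≤4m : ∀ ℓ → length (arcs ℓ) ≤ edgeCount * 4
  arcs≤4m ℓ = subst (length (arcs ℓ) ≤_) (length-cartesianProduct edges flags)
    (length-≤-by Witness (arcs-unique ℓ) image (λ {_} {_} {q} → determined {q = q}))
    where
    flags = (true , true) ∷ (true , false) ∷ (false , true) ∷ (false , false) ∷ []
    flags-complete : ∀ a b → (a , b) ∈ flags
    flags-complete true  true  = here refl
    flags-complete true  false = there (here refl)
    flags-complete false true  = there (there (here refl))
    flags-complete false false = there (there (there (here refl)))
    Witness : Mer ℓ × Fin σ → (Vertex × Vertex × Fin σ) × (Bool × Bool) → Set
    Witness (φ , c) ((x , _ , d) , (a , b)) =
      c ≡ d × RReach φ x × does (low? φ x) ≡ a × does (high? φ x) ≡ b
    image : ∀ {p} → p ∈ arcs ℓ → ∃[ q ] q ∈ cartesianProduct edges flags × Witness p q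
    image {φ , c} p∈ with ∈-arcs⁻ p∈
    ... | _ , y , x , e , r = _ , ∈-cartesianProduct⁺ e (flags-complete _ _) , refl , r , refl , refl
    determined : ∀ {p p′ q} → p ∈ arcs ℓ → p′ ∈ arcs ℓ → Witness p q → Witness p′ q → p ≡ p′
    determined {φ , c} {φ′ , c′} p∈ p′∈ (refl , r , l , h) (refl , r′ , l′ , h′) =
      cong (_, c) (firsts-injective (proj₁ (∈-arcs⁻ p∈)) (proj₁ (∈-arcs⁻ p′∈))
        (same-flags {ρ = φ} {φ′} r r′ (trans l (sym l′)) (trans h (sym h′))))

-- The programs

tableCount : ℕ
tableCount = 23

opaque
  read : ∀ {n} → Fin tableCount → Expr n → Expr n
  read = readSegment

opaque
  unfolding read

  read-value : ∀ (w g′ : ℕ) (ss : Vec Segment tableCount) (mem : ℕ → ℕ) → Fits w g′ ss →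
               let open Semantics w (dataWord w (layout g′ ss)) mem in
               ∀ {n} {ρ : Vec ℕ n} (i : Fin tableCount) {e : Expr n} {j} → ⟦ e ⟧ ρ ≡ j →
               j < Segment.count (lookup ss i) → ⟦ read i e ⟧ ρ ≡ Segment.content (lookup ss i) j
  read-value w g′ ss mem fits {ρ = ρ} i {e} = Reading.readSegment-value w g′ ss mem fits {ρ = ρ} i {e}

pattern scalarTable     = zero
pattern labelTable      = suc zero
pattern startTable      = suc (suc zero)
pattern arcLabelTable   = suc (suc (suc zero))
pattern arcTargetTable  = suc (suc (suc (suc zero)))
pattern arcOffsetTable  = suc (suc (suc (suc (suc zero))))
pattern leftTable       = suc (suc (suc (suc (suc (suc zero)))))
pattern rightTable      = suc (suc (suc (suc (suc (suc (suc zero))))))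
pattern indexTable      = suc (suc (suc (suc (suc (suc (suc (suc zero)))))))
pattern rankTable       = suc (suc (suc (suc (suc (suc (suc (suc (suc zero))))))))
pattern classTable      = suc (suc (suc (suc (suc (suc (suc (suc (suc (suc zero)))))))))
pattern suffixBaseTable = suc (suc (suc (suc (suc (suc (suc (suc (suc (suc (suc zero))))))))))
pattern from12 i = suc (suc (suc (suc (suc (suc (suc (suc (suc (suc (suc (suc i)))))))))))
pattern from17 i = from12 (suc (suc (suc (suc (suc i)))))
pattern decodingTable   = from17 (suc (suc (suc (suc (suc zero)))))

-- The scalars 0 to 4 are `k`, the strides of the row and arc tables, and the block parameters
-- `half` and `full`.
scalar : ∀ {n} → ℕ → Expr n
scalar i = read scalarTable (lit i)

record BlockTables : Set where
  constructor blockTables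
  field
    ordinals codes firsts values groupCodes : Fin tableCount

classBlocks rankBlocks : BlockTables
classBlocks = blockTables (from12 zero) (from12 (suc zero)) (from12 (suc (suc zero)))
                (from12 (suc (suc (suc zero)))) (from12 (suc (suc (suc (suc zero)))))
rankBlocks  = blockTables (from17 zero) (from17 (suc zero)) (from17 (suc (suc zero)))
                (from17 (suc (suc (suc zero)))) (from17 (suc (suc (suc (suc zero)))))

decodeE : Expr 2
decodeE = read decodingTable (op add (op mul (var zero) (scalar 4)) (var (suc zero)))

ordinalE : BlockTables → Expr 2
ordinalE b = op add (read ordinals (var zero)) (call decodeE (read codes (var zero) ∷ var (suc zero) ∷ []))
  where open BlockTables b

groupE : BlockTables → Expr 2
groupE b = op add (read values (var zero))
  (call decodeE (read groupCodes (var zero) ∷ op sub (var (suc zero)) (read firsts (var zero)) ∷ []))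
  where open BlockTables b

accessE : BlockTables → Expr 1
accessE b = call (groupE b)
  (call (ordinalE b) (op div (var zero) (scalar 3) ∷ op mod (var zero) (scalar 3) ∷ []) ∷ var zero ∷ [])

-- The variables: a string of length level is held as its class and the offset in
-- it; lo and len delimit the range of arcs being searched for letter.
pattern class  = zero
pattern offs   = suc zero
pattern level  = suc (suc zero)
pattern lo     = suc (suc (suc zero))
pattern len    = suc (suc (suc (suc zero)))
pattern letter = suc (suc (suc (suc (suc zero))))
pattern left?  = suc (suc (suc (suc (suc (suc zero)))))

startE : Expr 3
startE = read startTable (op add (op mul (var zero) (scalar 1))
  (op add (var (suc zero)) (var (suc (suc zero)))))

arcE : Fin tableCount → Expr 2
arcE t = read t (op add (op mul (var zero) (scalar 2)) (var (suc zero)))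

-- Two reads: an arc holds the index of its letter among the labels that occur, and only the table
-- of these labels has entries of `lg σ` bits.
arcLetterE : Expr 2
arcLetterE = read labelTable (arcE arcLabelTable)

halfLen : Expr 7
halfLen = op div (var len) (lit 2)

searchCond : Expr 7
searchCond = op lt (lit 1) (var len)

-- There is no conditional statement: `left?` is 0 or 1 and selects the half arithmetically. `len`
-- changes last because `halfLen` depends on it.
searchBody : Stmt 7
searchBody =
    left? ≔ op lt (var letter) (call arcLetterE (var level ∷ op add (var lo) halfLen ∷ []))
  ⨾ lo    ≔ op add (var lo) (op mul (op sub (lit 1) (var left?)) halfLen)
  ⨾ len   ≔ op add (op mul (var left?) halfLen)
                   (op mul (op sub (lit 1) (var left?)) (op sub (var len) halfLen))

rowBounds : Stmt 7
rowBounds =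
    lo  ≔ call startE (var level ∷ var class ∷ lit 0 ∷ [])
  ⨾ len ≔ call startE (var level ∷ var class ∷ lit 1 ∷ [])

followArc : Stmt 7
followArc =
    rowBounds
  ⨾ len   ≔ op sub (var len) (var lo)
  ⨾ while searchCond searchBody
  ⨾ offs  ≔ op add (var offs) (call (arcE arcOffsetTable) (var level ∷ var lo ∷ []))
  ⨾ class ≔ call (arcE arcTargetTable) (var level ∷ var lo ∷ [])

outputHandle : Stmt 7
outputHandle =
    output (read leftTable (var class))
  ⨾ output (read rightTable (var class))
  ⨾ output (op add (read indexTable (var class)) (var offs))

readCond : Expr 7
readCond = op lt (var level) (scalar 0)

readBody : Stmt 7
readBody = letter ≔ loadE (var level) ⨾ followArc ⨾ level ≔ op add (var level) (lit 1)

retrieveStmt : Stmt 7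
retrieveStmt = while readCond readBody ⨾ outputHandle

codeE : Expr 2
codeE = op add (op mul (var zero) (lit 2)) (op sub (lit 1) (op eq (var zero) (var (suc zero))))

-- `class` is at first the class of the `k`-mer; once `lo` holds the rank of the `k`-mer, it becomes
-- the class of the suffix. `offs` still refers to the `k`-mer afterwards: listing ignores it, and a
-- traversal replaces it.
resolve : Stmt 7
resolve =
    class ≔ read classTable (call codeE (loadE (lit 0) ∷ loadE (lit 1) ∷ []))
  ⨾ offs  ≔ op sub (loadE (lit 2)) (read indexTable (var class))
  ⨾ lo    ≔ op add (read rankTable (var class)) (var offs)
  ⨾ class ≔ call (accessE classBlocks) (var lo ∷ [])
  ⨾ level ≔ op sub (scalar 0) (lit 1)

listCond : Expr 7
listCond = op lt (var lo) (var len)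

listBody : Stmt 7
listBody = output (call arcLetterE (var level ∷ var lo ∷ [])) ⨾ lo ≔ op add (var lo) (lit 1)

listStmt : Stmt 7
listStmt = resolve ⨾ rowBounds ⨾ while listCond listBody

-- The offset of the suffix is its rank among the extensible strings minus that of the
-- representative of its class.
forwardStmt : Stmt 7
forwardStmt =
    resolve
  ⨾ offs   ≔ op sub (call (accessE rankBlocks) (var lo ∷ [])) (read suffixBaseTable (var class))
  ⨾ letter ≔ loadE (lit 3)
  ⨾ followArc
  ⨾ outputHandle

module Timed (w : ℕ) (datum mem : ℕ → ℕ) where
  open Semantics w datum mem

  infix 4 _⊢_⇓_/_within_
  record _⊢_⇓_/_within_ {v} (s : Vec ℕ v) (st : Stmt v) (s′ : Vec ℕ v) (o : List ℕ) (b : ℕ) : Set where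
    constructor timed
    field
      {time} : ℕ
      time≤  : time ≤ b
      run    : s ⊢ st ⇓ s′ / o in-time time

  assigns : ∀ {v} {s : Vec ℕ v} {i e x} → ⟦ e ⟧ s ≡ x → x < 2 ^ w →
            s ⊢ i ≔ e ⇓ s [ i ]≔ x / [] within (cost e + 2)
  assigns e≡ x< = timed ≤-refl (assign e≡ x<)

  outputs : ∀ {v} {s : Vec ℕ v} {e x} → ⟦ e ⟧ s ≡ x → s ⊢ output e ⇓ s / x ∷ [] within (cost e + 1)
  outputs e≡ = timed ≤-refl (emits e≡)

  infixr 5 _►_
  _►_ : ∀ {v} {s s₁ s₂ : Vec ℕ v} {a b o₁ o₂ b₁ b₂} → s ⊢ a ⇓ s₁ / o₁ within b₁ →
        s₁ ⊢ b ⇓ s₂ / o₂ within b₂ → s ⊢ a ⨾ b ⇓ s₂ / (o₁ ++ o₂) within (b₁ + b₂)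
  timed p x ► timed q y = timed (+-mono-≤ p q) (seq x y)

  stops : ∀ {v} {s : Vec ℕ v} {e b} → ⟦ e ⟧ s ≡ 0 → s ⊢ while e b ⇓ s / [] within (cost e + 1)
  stops e≡0 = timed ≤-refl (stop e≡0)

  loops : ∀ {v} {s s₁ s₂ : Vec ℕ v} {e b o₁ o₂ b₁ b₂} → ⟦ e ⟧ s ≡ 1 →
          s ⊢ b ⇓ s₁ / o₁ within b₁ → s₁ ⊢ while e b ⇓ s₂ / o₂ within b₂ →
          s ⊢ while e b ⇓ s₂ / (o₁ ++ o₂) within (cost e + 1 + (b₁ + 1) + b₂)
  loops {e = e} {b₁ = b₁} {b₂} e≡1 (timed p x) (timed q y) = timed
    (≤-trans (+-monoʳ-≤ (cost e + 1) (+-mono-≤ p (s≤s q)))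
      (≤-reflexive (solve 3 (λ c b d → c :+ (b :+ (con 1 :+ d)) := c :+ (b :+ con 1) :+ d)
        refl (cost e + 1) b₁ b₂)))
    (loop (λ e≡0 → contradiction (trans (sym e≡1) e≡0) λ ()) x y)

  weaken : ∀ {v} {s s′ : Vec ℕ v} {st o b b′} → b ≤ b′ → s ⊢ st ⇓ s′ / o within b →
           s ⊢ st ⇓ s′ / o within b′
  weaken b≤ (timed p x) = timed (≤-trans p b≤) x

at-map : ∀ {A B : Set} {d : A} {e : B} (f : A → B) xs {i} → i < length xs →
         at e (map f xs) i ≡ f (at d xs i)
at-map f (x ∷ xs) {zero}  _         = refl
at-map f (x ∷ xs) {suc i} (s≤s i<) = at-map f xs i<

at-map-< : ∀ {A : Set} {b} (f : A → ℕ) xs i → 0 < b → (∀ {x} → x ∈ xs → f x < b) → at 0 (map f xs) i < b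
at-map-< f []       i       0<b f< = 0<b
at-map-< f (x ∷ xs) zero    0<b f< = f< (here refl)
at-map-< f (x ∷ xs) (suc i) 0<b f< = at-map-< f xs i 0<b (f< ∘ there)

at-constant : ∀ {A : Set} {y} (f : A → ℕ) xs → 0 < length xs → (∀ {x} → x ∈ xs → f x ≡ y) →
              at 0 (map f xs) 0 ≡ y
at-constant f (x ∷ xs) _ f≡ = f≡ (here refl)

-- Extends the list by its last entry, which keeps it monotone.
clamped : List ℕ → ℕ → ℕ
clamped xs r = at 0 xs (r ⊓ (length xs ∸ 1))

clamped-< : ∀ xs {r} → r < length xs → clamped xs r ≡ at 0 xs r
clamped-< (x ∷ xs) {r} (s≤s r≤) = cong (at 0 (x ∷ xs)) (m≤n⇒m⊓n≡m r≤)

clamped-monotone : ∀ xs → (∀ {i j} → i ≤ j → j < length xs → at 0 xs i ≤ at 0 xs j) →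
                   Monotone (clamped xs)
clamped-monotone []          sorted r = ≤-refl
clamped-monotone xs@(_ ∷ ys) sorted r =
  sorted (⊓-monoˡ-≤ (length ys) (n≤1+n r)) (s≤s (m⊓n≤n (suc r) (length ys)))

levelled : ∀ s .{{_ : NonZero s}} → (ℕ → ℕ → ℕ) → ℕ → ℕ
levelled s f t = f (t / s) (t % s)

levelled-value : ∀ s .{{_ : NonZero s}} (f : ℕ → ℕ → ℕ) ℓ {i} → i < s → levelled s f (ℓ * s + i) ≡ f ℓ i
levelled-value s f ℓ i< = cong₂ f ([m*n+o]/n ℓ i<) ([m*n+o]%n ℓ i<)

level-index : ∀ {s k ℓ i} → ℓ < k → i < s → ℓ * s + i < k * s
level-index {s} {k} {ℓ} {i} ℓ<k i<s = begin-strict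
  ℓ * s + i   <⟨ +-monoʳ-< (ℓ * s) i<s ⟩
  ℓ * s + s   ≡⟨ +-comm (ℓ * s) s ⟩
  suc ℓ * s   ≤⟨ *-monoˡ-≤ s ℓ<k ⟩
  k * s       ∎
  where open ≤-Reasoning

record Widths : Set where
  field
    scalarW countW positionW letterW blockW : ℕ
    half full : ℕ
    {{half≢0}} : NonZero half
    {{full≢0}} : NonZero full
    halves : half + half ≤ full

-- The contents of the tables

module Tables {σ : ℕ} (W : LabeledGraph σ) (O : WheelerOrder W) (det : Deterministic W)
              (k′ : ℕ) (widths : Widths) where
  open LabeledGraph W using (order; edgeCount)
  open Reversed W
  open Wheeler W O det
  open Handles W O det
  open Widths widths

  -- A level has at most `order * 2` classes, and one more row start closes the last row. `largest`
  -- bounds `point` on the arguments below `N` for both suffix sequences, whose values are at most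
  -- `order * 2 + N`; so `blockCount` bounds the blocks of arguments and the groups.
  k N rowStride arcStride largest blockCount : ℕ
  k = suc k′
  N = length (merList k)
  rowStride = suc (order * 2)
  arcStride = suc (edgeCount * 4)
  largest = order * 2 + N + N
  blockCount = suc (largest / half)

  module FinRank = Ranked (Fin._<_ {σ}) Fin.<-isStrictTotalOrder

  letters : List (Fin σ)
  letters = labels []

  letterId : Fin σ → ℕ
  letterId c = FinRank.rank c letters

  suffixClasses suffixRanks : List ℕ
  suffixClasses = map (λ ρ → classId (front ρ)) (merList k)
  suffixRanks   = map (λ ρ → rank (front ρ) (rightList k′)) (merList k)

  mer-at : ∀ {i j} (f : Mer k → ℕ) → (∀ {ρ τ} → RContains ρ → RContains τ → ρ ⊑ τ → f ρ ≤ f τ) →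
           i ≤ j → j < length (map f (merList k)) → at 0 (map f (merList k)) i ≤ at 0 (map f (merList k)) j
  mer-at {i} {j} f mono i≤j j< = subst₂ _≤_ (sym (at-map f M (≤-<-trans i≤j j<′))) (sym (at-map f M j<′))
    (mono (∈-merList⁻ (at-∈ {d = d} (≤-<-trans i≤j j<′))) (∈-merList⁻ (at-∈ {d = d} j<′))
      (at-sorted (merList-sorted k) i≤j j<′))
    where
    M = merList k
    j<′ : j < length M
    j<′ = subst (j <_) (List.length-map f M) j<
    d = at-default M j<′
      where
      at-default : ∀ {j} (xs : List (Mer k)) → j < length xs → Mer k
      at-default (x ∷ _) _ = x

  front-contained : ∀ {ρ : Mer k} → RContains ρ → RContains (front ρ)
  front-contained {ρ} (v , r) = v , rreach-front ρ r

  front-⊑′ : ∀ {ρ τ : Mer k} → ρ ⊑ τ → front ρ ⊑ front τ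
  front-⊑′ ρ⊑τ with ⊑-split ρ⊑τ
  ... | inj₁ ρ<τ  = front-⊑ ρ<τ
  ... | inj₂ refl = ⊑-refl

  suffixClasses-monotone : Monotone (clamped suffixClasses)
  suffixClasses-monotone = clamped-monotone suffixClasses (mer-at (λ ρ → classId (front ρ))
    (λ r t ρ⊑τ → classId-monotone (front-contained r) (front-contained t) (front-⊑′ ρ⊑τ)))

  suffixRanks-monotone : Monotone (clamped suffixRanks)
  suffixRanks-monotone = clamped-monotone suffixRanks (mer-at (λ ρ → rank (front ρ) (rightList k′))
    (λ r t ρ⊑τ → rank-monotone (front-⊑′ ρ⊑τ) (rightList k′)))

  suffixClasses≤ : ∀ r → clamped suffixClasses r ≤ order * 2 + N
  suffixClasses≤ r = ≤-trans (≤-pred (at-map-< (λ ρ → classId (front ρ)) (merList k) _ (s≤s z≤n)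
    (λ {ρ} ρ∈ → s≤s (≤-trans (<⇒≤ (classId< (front-contained (∈-merList⁻ ρ∈)))) (firsts≤2n k′)))))
    (m≤m+n (order * 2) N)

  suffixRanks≤ : ∀ r → clamped suffixRanks r ≤ order * 2 + N
  suffixRanks≤ r = ≤-trans (≤-pred (at-map-< (λ ρ → rank (front ρ) (rightList k′)) (merList k) _ (s≤s z≤n)
    (λ {ρ} _ → s≤s (≤-trans (rank≤ (rightList k′) (front ρ)) (rightList≤ k′)))))
    (m≤n+m N (order * 2))

  module ClassBlocks = Blocks (clamped suffixClasses) suffixClasses-monotone N half full halves
  module RankBlocks  = Blocks (clamped suffixRanks) suffixRanks-monotone N half full halves

  arcEntry : (∀ {ℓ} → Mer ℓ × Fin σ → ℕ) → ℕ → ℕ → ℕ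
  arcEntry f ℓ i = at 0 (map f (arcs ℓ)) i

  -- The inverse of `code` on representatives, tabulated over all possible codes; a code of no class
  -- gets 0.
  classOfCode : ℕ → ℕ
  classOfCode x = at 0 (map classId (filter (λ φ → code φ ≟ x) (firsts k))) 0

  segments : Vec Segment tableCount
  segments =
      segment scalarW 5 (nth (k ∷ rowStride ∷ arcStride ∷ half ∷ full ∷ []))
    ∷ segment letterW (length letters) (λ i → at 0 (map toℕ letters) i)
    ∷ segment countW (k * rowStride) (levelled rowStride λ ℓ i → rowStart row (firsts ℓ) i)
    ∷ segment countW (k * arcStride) (levelled arcStride (arcEntry λ (φ , c) → letterId c))
    ∷ segment countW (k * arcStride) (levelled arcStride (arcEntry λ (φ , c) → classId (c ∷ φ)))
    ∷ segment countW (k * arcStride) (levelled arcStride (arcEntry λ (φ , c) → offset (c ∷ φ)))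
    ∷ segment positionW (length (firsts k)) (λ i → at 0 (map leftPos (firsts k)) i)
    ∷ segment positionW (length (firsts k)) (λ i → at 0 (map rightPos (firsts k)) i)
    ∷ segment countW (length (firsts k)) (λ i → at 0 (map startRank (firsts k)) i)
    ∷ segment countW (length (firsts k)) (λ i → at 0 (map (λ φ → rank φ (merList k)) (firsts k)) i)
    ∷ segment countW (order * 2) classOfCode
    ∷ segment countW (length (firsts k′)) (λ i → at 0 (map (λ φ → rank φ (rightList k′)) (firsts k′)) i)
    ∷ segment blockW blockCount ClassBlocks.blockOrdinal
    ∷ segment full blockCount ClassBlocks.blockCode
    ∷ segment blockW blockCount ClassBlocks.groupFirst
    ∷ segment blockW blockCount ClassBlocks.groupValue
    ∷ segment full blockCount ClassBlocks.groupCode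
    ∷ segment blockW blockCount RankBlocks.blockOrdinal
    ∷ segment full blockCount RankBlocks.blockCode
    ∷ segment blockW blockCount RankBlocks.groupFirst
    ∷ segment blockW blockCount RankBlocks.groupValue
    ∷ segment full blockCount RankBlocks.groupCode
    ∷ segment full (2 ^ full * full) (decodeTable full)
    ∷ []

-- Correctness of the programs

straight : ∀ {v} → Stmt v → ℕ
straight (i ≔ e)     = cost e + 2
straight (output e)  = cost e + 1
straight (a ⨾ b)     = straight a + straight b
straight (while e b) = cost e + 1

loopCost : ∀ {v} → Expr v → ℕ → ℕ
loopCost e b = cost e + 1 + (b + 1)

searchCost : ℕ → ℕ
searchCost zero    = cost searchCond + 1
searchCost (suc e) = loopCost searchCond (straight searchBody) + searchCost e

searchCost≥ : ∀ e → cost searchCond + 1 ≤ searchCost e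
searchCost≥ zero    = ≤-refl
searchCost≥ (suc e) = ≤-trans (searchCost≥ e)
  (m≤n+m (searchCost e) (loopCost searchCond (straight searchBody)))

addOffset : Stmt 7
addOffset = offs ≔ op add (var offs) (call (arcE arcOffsetTable) (var level ∷ var lo ∷ []))

target : Stmt 7
target = class ≔ call (arcE arcTargetTable) (var level ∷ var lo ∷ [])

shrinkLen : Stmt 7
shrinkLen = len ≔ op sub (var len) (var lo)

readLetterAt : Stmt 7
readLetterAt = letter ≔ loadE (var level)

advance : Stmt 7
advance = level ≔ op add (var level) (lit 1)

followCost readBodyCost : ℕ → ℕ
followCost e   = straight rowBounds +
  (straight shrinkLen + (searchCost e + (straight addOffset + straight target)))
readBodyCost e = straight readLetterAt + (followCost e + straight advance)

forwardOffset readLetter : Stmt 7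
forwardOffset = offs ≔ op sub (call (accessE rankBlocks) (var lo ∷ [])) (read suffixBaseTable (var class))
readLetter    = letter ≔ loadE (lit 3)

readCost : ℕ → ℕ → ℕ
readCost e zero    = cost readCond + 1
readCost e (suc n) = loopCost readCond (readBodyCost e) + readCost e n

listCost : ℕ → ℕ
listCost zero    = cost listCond + 1
listCost (suc n) = loopCost listCond (straight listBody) + listCost n

nth-∷ʳ : ∀ {σ ℓ} (α : Vec (Fin σ) ℓ) c → nth (encodeMer (α ∷ʳ c)) ℓ ≡ toℕ c
nth-∷ʳ []      c = refl
nth-∷ʳ (_ ∷ α) c = nth-∷ʳ α c

nth-∷ʳ-< : ∀ {σ ℓ} (α : Vec (Fin σ) ℓ) c {i} → i < ℓ → nth (encodeMer (α ∷ʳ c)) i ≡ nth (encodeMer α) i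
nth-∷ʳ-< (_ ∷ α) c {zero}  _         = refl
nth-∷ʳ-< (_ ∷ α) c {suc i} (s≤s i<) = nth-∷ʳ-< α c i<

-- In the reversed order of reading, the prefixes of a query are the tails of its string. `drop1`
-- goes back by one letter that has been read.
data Tail {σ : ℕ} {n : ℕ} (τ : Vec (Fin σ) n) : ∀ {ℓ} → Vec (Fin σ) ℓ → Set where
  whole : Tail τ τ
  drop1 : ∀ {ℓ c} {ρ : Vec (Fin σ) ℓ} → Tail τ (c ∷ ρ) → Tail τ ρ

tail-≤ : ∀ {σ n ℓ} {τ : Vec (Fin σ) n} {ρ : Vec (Fin σ) ℓ} → Tail τ ρ → ℓ ≤ n
tail-≤ whole     = ≤-refl
tail-≤ (drop1 t) = <⇒≤ (tail-≤ t)

tail-nil : ∀ {σ n} (τ : Vec (Fin σ) n) → Tail τ []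
tail-nil τ = extend τ whole
  where
  extend : ∀ {σ n ℓ} {τ : Vec (Fin σ) n} (ρ : Vec (Fin σ) ℓ) → Tail τ ρ → Tail τ []
  extend []      t = t
  extend (_ ∷ ρ) t = extend ρ (drop1 t)

tail-nth : ∀ {σ n ℓ} {τ : Vec (Fin σ) n} {ρ : Vec (Fin σ) ℓ} → Tail τ ρ → ∀ {i} → i < ℓ →
           nth (encodeMer (reverse τ)) i ≡ nth (encodeMer (reverse ρ)) i
tail-nth whole i< = refl
tail-nth {ρ = ρ} (drop1 {c = c} t) {i} i< = trans (tail-nth t (m≤n⇒m≤1+n i<))
  (trans (cong (λ α → nth (encodeMer α) i) (Vec.reverse-∷ c ρ)) (nth-∷ʳ-< (reverse ρ) c i<))

tail-letter : ∀ {σ n ℓ c} {τ : Vec (Fin σ) n} {ρ : Vec (Fin σ) ℓ} → Tail τ (c ∷ ρ) →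
              nth (encodeMer (reverse τ)) ℓ ≡ toℕ c
tail-letter {ℓ = ℓ} {c} {ρ = ρ} t = trans (tail-nth t ≤-refl)
  (trans (cong (λ α → nth (encodeMer α) ℓ) (Vec.reverse-∷ c ρ)) (nth-∷ʳ (reverse ρ) c))

reverse-∷ʳ : ∀ {σ ℓ} (α : Vec (Fin σ) ℓ) c → reverse (α ∷ʳ c) ≡ c ∷ reverse α
reverse-∷ʳ α c = Vec.reverse-reverse {xs = c ∷ reverse α}
  (trans (Vec.reverse-∷ c (reverse α)) (cong (_∷ʳ c) (Vec.reverse-involutive α)))

m<n⇒bit : ∀ {m n} → m < n → bit (does (m <? n)) ≡ 1
m<n⇒bit {m} {n} p rewrite dec-true (m <? n) p = refl

m≮n⇒bit : ∀ {m n} → ¬ m < n → bit (does (m <? n)) ≡ 0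
m≮n⇒bit {m} {n} p rewrite dec-false (m <? n) p = refl

module Correct {σ : ℕ} (W : LabeledGraph σ) (O : WheelerOrder W) (det : Deterministic W)
               (k′ : ℕ) (widths : Widths) (w : ℕ) (datum mem : ℕ → ℕ) where
  open LabeledGraph W using (Vertex; order; edgeCount)
  open WheelerOrder O using (position)
  open Reversed W
  open Wheeler W O det
  open Handles W O det
  open Widths widths
  open Tables W O det k′ widths
  open Semantics w datum mem
  open Arithmetic w datum mem
  open Timed w datum mem

  -- The programs are verified for any data segment on which reads return the prescribed entries;
  -- how the tables are laid out enters only through `reads`.
  module Run
    (reads    : ∀ {n} {ρ : Vec ℕ n} (s : Fin tableCount) {e : Expr n} {j : ℕ} → ⟦ e ⟧ ρ ≡ j →
                j < Segment.count (lookup segments s) →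
                ⟦ read s e ⟧ ρ ≡ Segment.content (lookup segments s) j)
    (entries< : ∀ (s : Fin tableCount) (j : ℕ) → j < Segment.count (lookup segments s) →
                Segment.content (lookup segments s) j < 2 ^ w)
    (counts<  : ∀ (s : Fin tableCount) → Segment.count (lookup segments s) < 2 ^ w)
    (0<w      : 0 < w)
    (8<2^w    : 8 < 2 ^ w)
    (largest< : largest < 2 ^ w)
    (mers<    : ∀ {ℓ : ℕ} → ℓ ≤ k → length (merList ℓ) < 2 ^ w)
    where

    lit< : ∀ {x} → x ≤ 8 → x < 2 ^ w
    lit< x≤ = ≤-<-trans x≤ 8<2^w

    literal : ∀ {n} {ρ : Vec ℕ n} {x} → x ≤ 8 → ⟦ lit x ⟧ ρ ≡ x
    literal {ρ = ρ} x≤ = lit-value {ρ = ρ} (lit< x≤)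

    module _ (s : Fin tableCount) {b c f} (s≡ : lookup segments s ≡ segment b c f) where

      read-at : ∀ {n} {ρ : Vec ℕ n} {e j} → ⟦ e ⟧ ρ ≡ j → j < c → ⟦ read s e ⟧ ρ ≡ f j
      read-at {ρ = ρ} {e} {j} e≡ j< =
        trans (reads {ρ = ρ} s {e} e≡ (subst (λ t → j < Segment.count t) (sym s≡) j<))
              (cong (λ t → Segment.content t j) s≡)

      value< : ∀ {j} → j < c → f j < 2 ^ w
      value< {j} j< = subst (λ t → Segment.content t j < 2 ^ w) s≡
        (entries< s j (subst (λ t → j < Segment.count t) (sym s≡) j<))

      index< : ∀ {j} → j < c → j < 2 ^ w
      index< j< = <-trans j< (subst (λ t → Segment.count t < 2 ^ w) s≡ (counts< s))

    scalar-value : ∀ {n} {ρ : Vec ℕ n} {x} → x < 5 →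
      ⟦ scalar x ⟧ ρ ≡ nth (k ∷ rowStride ∷ arcStride ∷ half ∷ full ∷ []) x
    scalar-value {ρ = ρ} x< = read-at scalarTable refl {ρ = ρ}
      (lit-value {ρ = ρ} (index< scalarTable refl x<)) x<

    scalar< : ∀ {x} → x < 5 → nth (k ∷ rowStride ∷ arcStride ∷ half ∷ full ∷ []) x < 2 ^ w
    scalar< = value< scalarTable refl

    k< : k < 2 ^ w
    k< = scalar< {0} (s≤s z≤n)

    decodeE-value : ∀ {c i} → c < 2 ^ full → i < full →
                    ⟦ decodeE ⟧ (c ∷ i ∷ []) ≡ decodeTable full (c * full + i)
    decodeE-value {c} {i} c< i< = read-at decodingTable refl {ρ = ρ}
      (add-value {ρ = ρ} {a = op mul (var zero) (scalar 4)} {b = var (suc zero)}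
        (mul-value {ρ = ρ} {a = var zero} {b = scalar 4} refl (scalar-value {ρ = ρ} {4} (m≤m+n 5 0))
          (≤-<-trans (m≤m+n (c * full) i) sum<))
        refl sum<) sum<c
      where
      ρ : Vec ℕ 2
      ρ = c ∷ i ∷ []
      sum<c : c * full + i < 2 ^ full * full
      sum<c = level-index c< i<
      sum< : c * full + i < 2 ^ w
      sum< = index< decodingTable refl sum<c

    module Access (b : BlockTables) (v : ℕ → ℕ) (mono : Monotone v)
                  (v≤ : ∀ r → v r ≤ order * 2 + N) where
      open BlockTables b renaming (firsts to heads)
      open Blocks v mono N half full halves

      access-value : lookup segments ordinals ≡ segment blockW blockCount blockOrdinal →
                     lookup segments codes ≡ segment full blockCount blockCode →
                     lookup segments heads ≡ segment blockW blockCount groupFirst →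
                     lookup segments values ≡ segment blockW blockCount groupValue →
                     lookup segments groupCodes ≡ segment full blockCount groupCode →
                     ∀ {r} → r < N → ⟦ accessE b ⟧ (r ∷ []) ≡ v r
      access-value o≡ c≡ h≡ v≡ g≡ {r} r<N = begin
        ⟦ accessE b ⟧ (r ∷ [])
          ≡⟨ cong₂ (λ x y → ⟦ groupE b ⟧ (⟦ ordinalE b ⟧ (x ∷ y ∷ []) ∷ r ∷ [])) div≡ mod≡ ⟩
        ⟦ groupE b ⟧ (⟦ ordinalE b ⟧ (r / half ∷ r % half ∷ []) ∷ r ∷ [])
          ≡⟨ cong (λ x → ⟦ groupE b ⟧ (x ∷ r ∷ [])) ordinal≡ ⟩
        ⟦ groupE b ⟧ (o ∷ r ∷ [])
          ≡⟨ add-value {ρ = o ∷ r ∷ []} {a = read values (var zero)}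
               {b = call decodeE (read groupCodes (var zero) ∷ op sub (var (suc zero))
                 (read heads (var zero)) ∷ [])}
               (read-at values v≡ {ρ = o ∷ r ∷ []} refl o<)
               (trans (cong₂ (λ x y → ⟦ decodeE ⟧ (x ∷ y ∷ []))
                         (read-at groupCodes g≡ {ρ = o ∷ r ∷ []} refl o<) diff≡)
                      (decodeE-value (code-bound v (firstOf o)) (group-offset r<N)))
               (subst (_< 2 ^ w) (value-access r<N) (≤-<-trans (≤-trans (v≤ r) (m≤m+n _ N)) largest<)) ⟩
        groupValue o + decodeTable full (groupCode o * full + (r ∸ groupFirst o))
          ≡⟨ value-access r<N ⟨
        v r ∎
        where
        open ≡-Reasoning
        o = ordinal r
        r< : r < 2 ^ w
        r< = <-trans (<-≤-trans r<N (m≤n+m N (order * 2 + N))) largest<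
        half≡ : ⟦ scalar 3 ⟧ (r ∷ []) ≡ half
        half≡ = scalar-value {ρ = r ∷ []} {3} (m≤m+n 4 1)
        div≡ : ⟦ op div (var zero) (scalar 3) ⟧ (r ∷ []) ≡ r / half
        div≡ = div-value {ρ = r ∷ []} {a = var zero} {b = scalar 3} refl half≡ r<
        mod≡ : ⟦ op mod (var zero) (scalar 3) ⟧ (r ∷ []) ≡ r % half
        mod≡ = mod-value {ρ = r ∷ []} {a = var zero} {b = scalar 3} refl half≡ r<
        point≤ : point r ≤ largest
        point≤ = +-mono-≤ (v≤ r) (<⇒≤ r<N)
        o< : o < blockCount
        o< = s≤s (≤-trans (ordinal≤ r) (/-monoˡ-≤ half point≤))
        q< : r / half < blockCount
        q< = s≤s (/-monoˡ-≤ half (≤-trans (<⇒≤ r<N) (m≤n+m N (order * 2 + N))))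
        ordinal≡ : ⟦ ordinalE b ⟧ (r / half ∷ r % half ∷ []) ≡ o
        ordinal≡ = trans (add-value {ρ = r / half ∷ r % half ∷ []} {a = read ordinals (var zero)}
            {b = call decodeE (read codes (var zero) ∷ var (suc zero) ∷ [])}
            (read-at ordinals o≡ {ρ = r / half ∷ r % half ∷ []} refl q<)
            (trans (cong (λ x → ⟦ decodeE ⟧ (x ∷ r % half ∷ []))
                     (read-at codes c≡ {ρ = r / half ∷ r % half ∷ []} refl q<))
                   (decodeE-value (code-bound ordinal (r / half * half))
                     (<-≤-trans (m%n<n r half) half≤full)))
            (subst (_< 2 ^ w) (ordinal-access r) (index< values v≡ o<)))
          (sym (ordinal-access r))
        diff≡ : ⟦ op sub (var (suc zero)) (read heads (var zero)) ⟧ (o ∷ r ∷ []) ≡ r ∸ groupFirst o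
        diff≡ = sub-value {ρ = o ∷ r ∷ []} {a = var (suc zero)} {b = read heads (var zero)} refl
          (read-at heads h≡ {ρ = o ∷ r ∷ []} refl o<) (proj₂ (group-first r<N)) r<

    classAccess : ∀ {r} → r < N → ⟦ accessE classBlocks ⟧ (r ∷ []) ≡ clamped suffixClasses r
    classAccess = Access.access-value classBlocks (clamped suffixClasses) suffixClasses-monotone
                    suffixClasses≤ refl refl refl refl refl

    rankAccess : ∀ {r} → r < N → ⟦ accessE rankBlocks ⟧ (r ∷ []) ≡ clamped suffixRanks r
    rankAccess = Access.access-value rankBlocks (clamped suffixRanks) suffixRanks-monotone
                   suffixRanks≤ refl refl refl refl refl

    startE-value : ∀ {ℓ i b} → ℓ < k → i + b < rowStride →
                   ⟦ startE ⟧ (ℓ ∷ i ∷ b ∷ []) ≡ rowStart row (firsts ℓ) (i + b)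
    startE-value {ℓ} {i} {b} ℓ<k i+b< = trans (read-at startTable refl {ρ = ρ}
        (add-value {ρ = ρ} {a = op mul (var zero) (scalar 1)}
          {b = op add (var (suc zero)) (var (suc (suc zero)))}
          (mul-value {ρ = ρ} {a = var zero} {b = scalar 1} refl (scalar-value {ρ = ρ} {1} (m≤m+n 2 3))
            (≤-<-trans (m≤m+n (ℓ * rowStride) (i + b)) sum<))
          (add-value {ρ = ρ} {a = var (suc zero)} {b = var (suc (suc zero))} refl refl
            (≤-<-trans (m≤n+m (i + b) (ℓ * rowStride)) sum<))
          sum<)
        (level-index ℓ<k i+b<))
      (levelled-value rowStride (λ ℓ i → rowStart row (firsts ℓ) i) ℓ i+b<)
      where
      ρ : Vec ℕ 3
      ρ = ℓ ∷ i ∷ b ∷ []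
      sum< : ℓ * rowStride + (i + b) < 2 ^ w
      sum< = index< startTable refl (level-index ℓ<k i+b<)

    arcE-value : ∀ t {b f} → lookup segments t ≡ segment b (k * arcStride) (levelled arcStride f) →
                 ∀ {ℓ i} → ℓ < k → i < arcStride → ⟦ arcE t ⟧ (ℓ ∷ i ∷ []) ≡ f ℓ i
    arcE-value t {f = f} t≡ {ℓ} {i} ℓ<k i< = trans (read-at t t≡ {ρ = ρ}
        (add-value {ρ = ρ} {a = op mul (var zero) (scalar 2)} {b = var (suc zero)}
          (mul-value {ρ = ρ} {a = var zero} {b = scalar 2} refl (scalar-value {ρ = ρ} {2} (m≤m+n 3 2))
            (≤-<-trans (m≤m+n (ℓ * arcStride) i) sum<))
          refl sum<)
        (level-index ℓ<k i<))
      (levelled-value arcStride f ℓ i<)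
      where
      ρ : Vec ℕ 2
      ρ = ℓ ∷ i ∷ []
      sum< : ℓ * arcStride + i < 2 ^ w
      sum< = index< t t≡ (level-index ℓ<k i<)

    letters-sorted : ∀ {ℓ} (φ : Mer ℓ) → FinRank.Sorted (labels φ)
    letters-sorted φ = AllPairs.filter⁺ (λ c → rcontains? (c ∷ φ)) (AllPairs.tabulate⁺-< id)

    ∈-labels : ∀ {ℓ c} {φ : Mer ℓ} → RContains (c ∷ φ) → c ∈ labels φ
    ∈-labels {c = c} {φ} r = ∈-filter⁺ (λ c → rcontains? (c ∷ φ)) (∈-allFin c) r

    ∈-letters : ∀ {ℓ c} {φ : Mer ℓ} → RContains (c ∷ φ) → c ∈ letters
    ∈-letters (v , p , e , _) = ∈-labels (v , p , e , tt)

    module Row {ℓ : ℕ} (ℓ<k : ℓ < k) {ρ : Mer ℓ} (r : RContains ρ) where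

      φ : Mer ℓ
      φ = first ρ

      begins deg : ℕ
      begins = rowStart row (firsts ℓ) (classId ρ)
      deg    = length (labels φ)

      row-end : rowStart row (firsts ℓ) (suc (classId ρ)) ≡ begins + deg
      row-end = trans (rowStart-suc row {d = ρ} (firsts ℓ) (classId< r))
        (cong (begins +_) (trans (cong (length ∘ row) (at-classId {d = ρ} r))
          (List.length-map (φ ,_) (labels φ))))

      row-bound : begins + deg ≤ length (arcs ℓ)
      row-bound = subst (_≤ length (arcs ℓ)) row-end (rowStart≤ row (firsts ℓ) (suc (classId ρ)))

      arc-bound : begins + deg < arcStride
      arc-bound = s≤s (≤-trans row-bound (arcs≤4m ℓ))

      class-bound : suc (classId ρ) < rowStride
      class-bound = s≤s (≤-trans (classId< r) (firsts≤2n ℓ))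

      at-arcs : ∀ c {j} → j < deg → at (ρ , c) (arcs ℓ) (begins + j) ≡ (φ , at c (labels φ) j)
      at-arcs c {j} j< = trans
        (at-row row {d = ρ} (firsts ℓ) (classId< r)
          (subst (λ z → j < length (row z)) (sym at≡)
            (subst (j <_) (sym (List.length-map (φ ,_) (labels φ))) j<)))
        (trans (cong (λ z → at (ρ , c) (row z) j) at≡) (at-map (φ ,_) (labels φ) j<))
        where at≡ = at-classId {d = ρ} r

      arc-entry : ∀ c (f : ∀ {ℓ} → Mer ℓ × Fin σ → ℕ) {j} → j < deg →
                  arcEntry f ℓ (begins + j) ≡ f (φ , at c (labels φ) j)
      arc-entry c f {j} j< = trans (at-map f (arcs ℓ) (<-≤-trans (+-monoʳ-< begins j<) row-bound))
                               (cong f (at-arcs c j<))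

      letter-value : ∀ c {j} → j < deg → ⟦ arcLetterE ⟧ (ℓ ∷ begins + j ∷ []) ≡ toℕ (at c (labels φ) j)
      letter-value c {j} j< = trans
        (read-at labelTable refl {ρ = ρ′}
          (trans (arcE-value arcLabelTable {f = arcEntry λ (φ , c) → letterId c} refl ℓ<k
                   (<-trans (+-monoʳ-< begins j<) arc-bound))
                 (arc-entry c (λ (φ , c) → letterId c) j<))
          id<)
        (trans (at-map {d = d} toℕ letters id<) (cong toℕ (FinRank.at-rank (letters-sorted []) d∈)))
        where
        ρ′ : Vec ℕ 2
        ρ′ = ℓ ∷ begins + j ∷ []
        d = at c (labels φ) j
        d∈ : d ∈ letters
        d∈ = ∈-letters (proj₂ (∈-filter⁻ (λ c → rcontains? (c ∷ φ)) {xs = allFin σ} (at-∈ {d = c} j<)))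
        id< : letterId d < length letters
        id< = FinRank.rank< d∈

      letter< : ∀ c {j} → j < deg → toℕ (at c (labels φ) j) < 2 ^ w
      letter< c {j} j< = subst (_< 2 ^ w)
        (trans (at-map {d = d} toℕ letters (FinRank.rank< d∈))
          (cong toℕ (FinRank.at-rank (letters-sorted []) d∈)))
        (value< labelTable refl (FinRank.rank< d∈))
        where
        d = at c (labels φ) j
        d∈ : d ∈ letters
        d∈ = ∈-letters (proj₂ (∈-filter⁻ (λ c → rcontains? (c ∷ φ)) {xs = allFin σ} (at-∈ {d = c} j<)))

      arcs< : ∀ {x} → x ≤ begins + deg → x < 2 ^ w
      arcs< x≤ = ≤-<-trans x≤ (<-trans arc-bound (scalar< {2} (m≤m+n 3 2)))

      class< : classId ρ < 2 ^ w
      class< = <-trans (<-trans (n<1+n _) class-bound) (scalar< {1} (m≤m+n 2 3))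

      rowBounds-run : ∀ {d x y c t} →
        (classId ρ ∷ d ∷ ℓ ∷ x ∷ y ∷ c ∷ t ∷ []) ⊢ rowBounds ⇓
        (classId ρ ∷ d ∷ ℓ ∷ begins ∷ begins + deg ∷ c ∷ t ∷ []) / [] within straight rowBounds
      rowBounds-run {d} {x} {y} {c} {t} =
          assigns (trans (cong (λ z → ⟦ startE ⟧ (ℓ ∷ classId ρ ∷ z ∷ []))
            (literal {ρ = classId ρ ∷ d ∷ ℓ ∷ x ∷ y ∷ c ∷ t ∷ []} {x = 0} z≤n))
                    (trans (startE-value ℓ<k (subst (_< rowStride) (sym (+-identityʳ (classId ρ)))
                      (<-trans (n<1+n _) class-bound)))
                      (cong (rowStart row (firsts ℓ)) (+-identityʳ (classId ρ)))))
                  (arcs< (m≤m+n begins deg))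
        ► assigns (trans (cong (λ z → ⟦ startE ⟧ (ℓ ∷ classId ρ ∷ z ∷ []))
          (literal {ρ = classId ρ ∷ d ∷ ℓ ∷ begins ∷ y ∷ c ∷ t ∷ []} {x = 1} (s≤s z≤n)))
                    (trans (startE-value ℓ<k (subst (_< rowStride) (+-comm 1 (classId ρ)) class-bound))
                      (trans (cong (rowStart row (firsts ℓ)) (+-comm (classId ρ) 1)) row-end)))
                  (arcs< ≤-refl)

      module Search {c : Fin σ} (c∈ : c ∈ labels φ) where

        p : ℕ
        p = FinRank.rank c (labels φ)

        p< : p < deg
        p< = FinRank.rank< c∈

        at-p : at c (labels φ) p ≡ c
        at-p = FinRank.at-rank (letters-sorted φ) c∈

        after : ∀ {j} → j < deg → toℕ c < toℕ (at c (labels φ) j) → p < j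
        after {j} j< c< = ≰⇒> λ j≤p → FinRank.at-sorted (letters-sorted φ) {i = j} {p} j≤p p<
          (subst (Fin._< at c (labels φ) j) (sym at-p) c<)

        before : ∀ {j} → j < deg → ¬ toℕ c < toℕ (at c (labels φ) j) → j ≤ p
        before {j} j< c≮ = ≮⇒≥ λ p<j → c≮ (subst (Fin._< at c (labels φ) j) at-p
          (FinRank.at-strict (letters-sorted φ) {i = p} {j} p<j j<))

        module Halving {d x n t : ℕ} (1<n : 1 < n) (begins≤ : begins ≤ x) (x+n≤ : x + n ≤ begins + deg) where

          s : Vec ℕ 7
          s = classId ρ ∷ d ∷ ℓ ∷ x ∷ n ∷ toℕ c ∷ t ∷ []
          h mid j : ℕ
          h   = n / 2
          mid = x + h
          j   = mid ∸ begins
          1≤h : 1 ≤ h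
          1≤h = m≥n⇒m/n>0 1<n
          h<n : h < n
          h<n = m/n<m n 2 {{>-nonZero (<⇒≤ 1<n)}} (s≤s (s≤s z≤n))
          begins+j : begins + j ≡ mid
          begins+j = m+[n∸m]≡n (≤-trans begins≤ (m≤m+n x h))
          mid< : mid < begins + deg
          mid< = <-≤-trans (+-monoʳ-< x h<n) x+n≤
          j< : j < deg
          j< = +-cancelˡ-< begins j deg (subst (_< begins + deg) (sym begins+j) mid<)
          n< : n < 2 ^ w
          n< = arcs< (≤-trans (m≤n+m n x) x+n≤)
          1≡ : ∀ {n} {ρ : Vec ℕ n} → ⟦ lit 1 ⟧ ρ ≡ 1
          1≡ {ρ = ρ} = literal {ρ = ρ} (s≤s z≤n)
          half≡ : ∀ (s : Vec ℕ 7) → lookup s len ≡ n → ⟦ halfLen ⟧ s ≡ h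
          half≡ s refl = div-value {ρ = s} {a = var len} {b = lit 2} refl (literal {ρ = s} (s≤s (s≤s z≤n)))
            n<
          cond≡ : ⟦ searchCond ⟧ s ≡ 1
          cond≡ = trans (lt-value {ρ = s} {a = lit 1} {b = var len} 0<w (1≡ {ρ = s}) refl) (m<n⇒bit 1<n)
          test≡ : ⟦ op lt (var letter) (call arcLetterE (var level ∷ op add (var lo) halfLen ∷ [])) ⟧ s ≡
                  bit (does (toℕ c <? toℕ (at c (labels φ) j)))
          test≡ = lt-value {ρ = s} {a = var letter}
            {b = call arcLetterE (var level ∷ op add (var lo) halfLen ∷ [])} 0<w refl
            (trans (cong (λ x → ⟦ arcLetterE ⟧ (ℓ ∷ x ∷ []))
                     (trans (add-value {ρ = s} {a = var lo} {b = halfLen} refl (half≡ s refl)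
                       (arcs< (<⇒≤ mid<)))
                            (sym begins+j)))
                   (letter-value c j<))
          -- Both outcomes of the comparison at once: `b` is the value of `left?`, and the equations
          -- for `x′` and `n′` reduce to either half of the range.
          body : ∀ b x′ n′ → bit (does (toℕ c <? toℕ (at c (labels φ) j))) ≡ b → b ≤ 1 →
                 x + (1 ∸ b) * h ≡ x′ → b * h + (1 ∸ b) * (n ∸ h) ≡ n′ → x′ ≤ mid → n′ ≤ n →
                 s ⊢ searchBody ⇓ (classId ρ ∷ d ∷ ℓ ∷ x′ ∷ n′ ∷ toℕ c ∷ b ∷ []) / [] within straight
                   searchBody
          body b x′ n′ b≡ b≤1 x≡ n≡ x′≤ n′≤ =
              assigns (trans test≡ b≡) (≤-<-trans b≤1 (lit< (s≤s z≤n)))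
            ► assigns (trans (add-value {ρ = s₁} {a = var lo}
              {b = op mul (op sub (lit 1) (var left?)) halfLen} refl
                         (mul-value {ρ = s₁} {a = op sub (lit 1) (var left?)} {b = halfLen} (flip≡ s₁ refl)
                           (half≡ s₁ refl)
                           (≤-<-trans (m≤n+m ((1 ∸ b) * h) x) x<))
                         x<) x≡) (arcs< (≤-trans x′≤ (<⇒≤ mid<)))
            ► assigns (trans (add-value {ρ = s₂} {a = op mul (var left?) halfLen}
                         {b = op mul (op sub (lit 1) (var left?)) (op sub (var len) halfLen)}
                         (mul-value {ρ = s₂} {a = var left?} {b = halfLen} refl (half≡ s₂ refl)
                           (≤-<-trans (m≤m+n (b * h) ((1 ∸ b) * (n ∸ h))) n′<))
                         (mul-value {ρ = s₂} {a = op sub (lit 1) (var left?)}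
                           {b = op sub (var len) halfLen} (flip≡ s₂ refl)
                           (sub-value {ρ = s₂} {a = var len} {b = halfLen} refl (half≡ s₂ refl) (<⇒≤ h<n)
                             n<)
                           (≤-<-trans (m≤n+m ((1 ∸ b) * (n ∸ h)) (b * h)) n′<))
                         n′<) n≡) (≤-<-trans n′≤ n<)
            where
            s₁ s₂ : Vec ℕ 7
            s₁ = classId ρ ∷ d ∷ ℓ ∷ x ∷ n ∷ toℕ c ∷ b ∷ []
            s₂ = classId ρ ∷ d ∷ ℓ ∷ x′ ∷ n ∷ toℕ c ∷ b ∷ []
            flip≡ : ∀ (s : Vec ℕ 7) → lookup s left? ≡ b → ⟦ op sub (lit 1) (var left?) ⟧ s ≡ 1 ∸ b
            flip≡ s refl = sub-value {ρ = s} {a = lit 1} {b = var left?} (1≡ {ρ = s}) refl b≤1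
              (lit< (s≤s z≤n))
            x< : x + (1 ∸ b) * h < 2 ^ w
            x< = subst (_< 2 ^ w) (sym x≡) (arcs< (≤-trans x′≤ (<⇒≤ mid<)))
            n′< : b * h + (1 ∸ b) * (n ∸ h) < 2 ^ w
            n′< = subst (_< 2 ^ w) (sym n≡) (≤-<-trans n′≤ n<)

          n≡ : n ≡ n % 2 + h * 2
          n≡ = m≡m%n+[m/n]*n n 2
          mid+ : mid + (n ∸ h) ≡ x + n
          mid+ = trans (+-assoc x h (n ∸ h)) (cong (x +_) (m+[n∸m]≡n (<⇒≤ h<n)))
          h≤ : ∀ {e} → n ≤ 2 ^ suc e → h ≤ 2 ^ e
          h≤ {e} n≤ = *-cancelʳ-≤ h (2 ^ e) 2
            (≤-trans (m/n*n≤m n 2) (≤-trans n≤ (≤-reflexive (*-comm 2 (2 ^ e)))))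
          -- The upper part is the longer one when `n` is odd; twice its length is then `n + 1`,
          -- still below twice `2 ^ e + 1`.
          n∸h≤ : ∀ {e} → n ≤ 2 ^ suc e → n ∸ h ≤ 2 ^ e
          n∸h≤ {e} n≤ = ≤-pred (*-cancelʳ-< 2 (n ∸ h) (suc (2 ^ e)) (begin-strict
            (n ∸ h) * 2               ≡⟨ cong (_* 2)
              (trans (cong (_∸ h) (trans n≡ (trans
                (cong (n % 2 +_) (trans (*-comm h 2) (cong (h +_) (+-identityʳ h))))
                  (sym (+-assoc (n % 2) h h))))) (m+n∸n≡m (n % 2 + h) h)) ⟩
            (n % 2 + h) * 2           ≡⟨ solve 2 (λ x h → (x :+ h) :* con 2 := x :+ (x :+ h :* con 2)) refl
              (n % 2) h ⟩
            n % 2 + (n % 2 + h * 2)   ≡⟨ cong (n % 2 +_) n≡ ⟨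
            n % 2 + n                 <⟨ +-mono-<-≤ (m%n<n n 2) n≤ ⟩
            2 + 2 * 2 ^ e             ≡⟨ trans (sym (*-suc 2 (2 ^ e))) (*-comm 2 (suc (2 ^ e))) ⟩
            suc (2 ^ e) * 2           ∎))
            where open ≤-Reasoning

        Finds : ℕ → ℕ → ℕ → ℕ → ℕ → Set
        Finds e d x n t = ∃[ t′ ]
          ((classId ρ ∷ d ∷ ℓ ∷ x ∷ n ∷ toℕ c ∷ t ∷ []) ⊢ while searchCond searchBody ⇓
           (classId ρ ∷ d ∷ ℓ ∷ begins + p ∷ 1 ∷ toℕ c ∷ t′ ∷ []) / [] within searchCost e)

        -- The invariant is that the position `begins + p` of the letter stays within the `n` arcs
        -- from `x` on, so the range never becomes empty. Its length is at most `2 ^ e`, and `e`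
        -- halvings reduce it to one.
        search : ∀ e {d x n t} → 1 ≤ n → n ≤ 2 ^ e → begins ≤ x → x + n ≤ begins + deg →
                 x ≤ begins + p → begins + p < x + n →
                 Finds e d x n t
        search-dec : ∀ e {d x n t} → Dec (1 < n) → 1 ≤ n → n ≤ 2 ^ e → begins ≤ x → x + n ≤ begins + deg →
                 x ≤ begins + p → begins + p < x + n → Finds e d x n t
        search-step : ∀ e {d x n t} → 1 < n → n ≤ 2 ^ e → begins ≤ x → x + n ≤ begins + deg →
                 x ≤ begins + p → begins + p < x + n →
                 Finds e d x n t
        search-stop : ∀ e {d x n t} → n ≡ 1 → x ≡ begins + p → Finds e d x n t
        search-stop e {d} {_} {_} {t} refl refl = t , weaken (searchCost≥ e) (stops
          (lt-value {ρ = s} {a = lit 1} {b = var len} 0<w (literal {ρ = s} (s≤s z≤n)) refl))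
          where
          s : Vec ℕ 7
          s = classId ρ ∷ d ∷ ℓ ∷ begins + p ∷ 1 ∷ toℕ c ∷ t ∷ []
        search e {n = n} = search-dec e (1 <? n)
        search-dec e (yes 1<n) 1≤n n≤ begins≤ x+n≤ x≤ <x+n = search-step e 1<n n≤ begins≤ x+n≤ x≤ <x+n
        search-dec e {x = x} (no 1≮n) 1≤n n≤ begins≤ x+n≤ x≤ <x+n =
          search-stop e n≡1 (≤-antisym x≤ (≤-pred (subst (begins + p <_)
            (trans (cong (x +_) n≡1) (+-comm x 1)) <x+n)))
          where n≡1 = ≤-antisym (≮⇒≥ 1≮n) 1≤n
        search-step zero 1<n n≤1 _ _ _ _ = contradiction n≤1 (<⇒≱ 1<n)
        search-step (suc e) {d} {x} {n} {t} 1<n n≤ begins≤ x+n≤ x≤ <x+n =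
          halve (toℕ c <? toℕ (at c (labels φ) j))
          where
          open Halving {d} {x} {n} {t} 1<n begins≤ x+n≤
          halve : Dec (toℕ c < toℕ (at c (labels φ) j)) →
                  Finds (suc e) d x n t
          halve (yes c<) = proj₁ found , loops cond≡
            (body 1 x h (m<n⇒bit c<) ≤-refl (+-identityʳ x)
              (trans (+-identityʳ (h + 0)) (+-identityʳ h)) (m≤m+n x h) (<⇒≤ h<n)) (proj₂ found)
            where
            found : Finds e d x h 1
            found = search e 1≤h (h≤ {e} n≤) begins≤ (<⇒≤ mid<) x≤
                      (subst (begins + p <_) begins+j (+-monoʳ-< begins (after j< c<)))
          halve (no c≮) = proj₁ found , loops cond≡
            (body 0 mid (n ∸ h) (m≮n⇒bit c≮) z≤n (cong (x +_) (+-identityʳ h)) (+-identityʳ (n ∸ h))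
              ≤-refl (m∸n≤m n h)) (proj₂ found)
            where
            found : Finds e d mid (n ∸ h) 0
            found = search e (m<n⇒0<n∸m h<n) (n∸h≤ {e} n≤) (≤-trans begins≤ (m≤m+n x h))
                      (≤-trans (≤-reflexive mid+) x+n≤)
                      (subst (_≤ begins + p) begins+j (+-monoʳ-≤ begins (before j< c≮)))
                      (subst (begins + p <_) (sym mid+) <x+n)

        -- The arc is stored for the representative `φ`. Its target serves `ρ` because `c ∷ φ` and
        -- `c ∷ ρ` reach the same vertices, and its shift does so by `offset-∷`.
        follow : ∀ e {x y t} → deg ≤ 2 ^ e → RContains (c ∷ ρ) → ∃[ t′ ]
          ((classId ρ ∷ offset ρ ∷ ℓ ∷ x ∷ y ∷ toℕ c ∷ t ∷ []) ⊢ followArc ⇓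
           (classId (c ∷ ρ) ∷ offset (c ∷ ρ) ∷ ℓ ∷ begins + p ∷ 1 ∷ toℕ c ∷ t′ ∷ []) / [] within followCost
             e)
        follow e {x} {y} {t} deg≤ cr = proj₁ found ,
            rowBounds-run
          ► assigns (trans (sub-value {ρ = s₁} {a = var len} {b = var lo} refl refl (m≤m+n begins deg)
            (arcs< ≤-refl))
                           (m+n∸m≡n begins deg))
                    (arcs< (m≤n+m deg begins))
          ► proj₂ found
          ► assigns (trans (add-value {ρ = s₂} {a = var offs}
            {b = call (arcE arcOffsetTable) (var level ∷ var lo ∷ [])} refl
                       (trans (arcE-value arcOffsetTable {f = arcEntry λ (φ , c) → offset (c ∷ φ)} refl ℓ<k
                         bound)
                         (trans (arc-entry c (λ (φ , c) → offset (c ∷ φ)) p<)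
                           (cong (λ c → offset (c ∷ φ)) at-p)))
                       (subst (_< 2 ^ w) (sym offset≡) offset<)) offset≡) offset<
          ► assigns (trans (arcE-value arcTargetTable {f = arcEntry λ (φ , c) → classId (c ∷ φ)} refl ℓ<k
            bound)
                      (trans (arc-entry c (λ (φ , c) → classId (c ∷ φ)) p<)
                        (trans (cong (λ c → classId (c ∷ φ)) at-p) class≡)))
                    (<-≤-trans (classId< cr) (≤-trans (firsts≤merList (suc ℓ)) (<⇒≤ (mers< ℓ<k))))
          where
          s₁ s₂ : Vec ℕ 7
          s₁ = classId ρ ∷ offset ρ ∷ ℓ ∷ begins ∷ begins + deg ∷ toℕ c ∷ t ∷ []
          found : Finds e (offset ρ) begins deg t
          found = search e (≤-<-trans z≤n p<) deg≤ ≤-refl ≤-refl (m≤m+n begins p) (+-monoʳ-< begins p<)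
          s₂ = classId ρ ∷ offset ρ ∷ ℓ ∷ begins + p ∷ 1 ∷ toℕ c ∷ proj₁ found ∷ []
          bound : begins + p < arcStride
          bound = <-trans (+-monoʳ-< begins p<) arc-bound
          offset≡ : offset ρ + offset (c ∷ φ) ≡ offset (c ∷ ρ)
          offset≡ = trans (+-comm (offset ρ) _) (sym (offset-∷ cr))
          offset< : offset (c ∷ ρ) < 2 ^ w
          offset< = <-trans (between< (∈-merList cr)) (mers< ℓ<k)
          same : Same (c ∷ φ) (c ∷ ρ)
          same = same-sym {ρ = c ∷ ρ} {c ∷ φ} (same-∷ c {ρ} {φ} (first-same r))
          class≡ : classId (c ∷ φ) ≡ classId (c ∷ ρ)
          class≡ = cong (λ f → rank f (firsts (suc ℓ)))
            (first-cong (same-contains {ρ = c ∷ ρ} {c ∷ φ} (same-sym {ρ = c ∷ φ} {c ∷ ρ} same) cr) cr same)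

    ∈-labels-first : ∀ {ℓ c} {ρ : Mer ℓ} → RContains (c ∷ ρ) → c ∈ labels (first ρ)
    ∈-labels-first {c = c} {ρ} cr = ∈-labels (same-contains {ρ = c ∷ ρ} {c ∷ first ρ}
      (same-∷ c {ρ} {first ρ} (first-same (tail-contained cr))) cr)

    labels≤σ : ∀ {ℓ} (φ : Mer ℓ) → length (labels φ) ≤ σ
    labels≤σ φ = ≤-trans (List.length-filter (λ c → rcontains? (c ∷ φ)) (allFin σ))
                   (≤-reflexive (List.length-tabulate id))

    follow-arc : ∀ {ℓ} (ρ : Mer ℓ) (c : Fin σ) → ℓ < k → RContains (c ∷ ρ) → ∀ e {x y t} → σ ≤ 2 ^ e →
      ∃[ x′ ] ∃[ y′ ] ∃[ t′ ]
      ((classId ρ ∷ offset ρ ∷ ℓ ∷ x ∷ y ∷ toℕ c ∷ t ∷ []) ⊢ followArc ⇓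
       (classId (c ∷ ρ) ∷ offset (c ∷ ρ) ∷ ℓ ∷ x′ ∷ y′ ∷ toℕ c ∷ t′ ∷ []) / [] within followCost e)
    follow-arc ρ c ℓ<k cr e σ≤ = _ , _ ,
      Row.Search.follow ℓ<k {ρ} (tail-contained cr) (∈-labels-first cr) e
        (≤-trans (labels≤σ (first ρ)) σ≤) cr

    class-table : ∀ {s b} (f : Mer k → ℕ) →
      lookup segments s ≡ segment b (length (firsts k)) (λ i → at 0 (map f (firsts k)) i) →
      ∀ {ρ : Mer k} → RContains ρ → ∀ {n} {env : Vec ℕ n} {e} → ⟦ e ⟧ env ≡ classId ρ →
      ⟦ read s e ⟧ env ≡ f (first ρ)
    class-table {s} f s≡ {ρ} r {env = env} e≡ = trans (read-at s s≡ {ρ = env} e≡ (classId< r))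
      (trans (at-map {d = ρ} f (firsts k) (classId< r)) (cong f (at-classId {d = ρ} r)))

    output-handle : ∀ {ρ : Mer k} {u v} → RContains ρ → Extent ρ u v → ∀ {i x y c t} →
      (classId ρ ∷ offset ρ ∷ i ∷ x ∷ y ∷ c ∷ t ∷ []) ⊢ outputHandle ⇓
      (classId ρ ∷ offset ρ ∷ i ∷ x ∷ y ∷ c ∷ t ∷ []) /
      (position u ∷ position v ∷ suc (rank ρ (reachList u)) ∷ []) within straight outputHandle
    output-handle {ρ} {u} {v} r E {i} {x} {y} {c} {t} =
        outputs (trans (class-table leftPos refl r {env = s} refl) (leftPos-extent E′))
      ► outputs (trans (class-table rightPos refl r {env = s} refl) (rightPos-extent E′))
      ► outputs (trans (add-value {ρ = s} {a = read indexTable (var class)} {b = var offs}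
          (class-table startRank refl r {env = s} refl) refl
          (subst (_< 2 ^ w) (trans (startRank-extent E) (index-rank r E))
            (≤-<-trans (startRank≤ r) (mers< ≤-refl))))
          (sym (index-rank r E)))
      where
      s : Vec ℕ 7
      s = classId ρ ∷ offset ρ ∷ i ∷ x ∷ y ∷ c ∷ t ∷ []
      E′ : Extent (first ρ) u v
      E′ = extent-same {ρ = ρ} (first-same r) E

    tail-contains : ∀ {n ℓ} {τ : Mer n} {ρ : Mer ℓ} → Tail τ ρ → RContains τ → RContains ρ
    tail-contains whole     r = r
    tail-contains (drop1 t) r = tail-contained (tail-contains t r)

    -- Induction on `Tail`, from the whole query back to the prefix already read; the recursive call
    -- is the rest of the loop. Every prefix of a contained query is contained, so the next arc
    -- always exists.
    reading : ∀ {τ : Mer k} {ℓ} {ρ : Mer ℓ} → Tail τ ρ → RContains τ →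
      (∀ {i} → i < k → mem i ≡ nth (encodeMer (reverse τ)) i) → ∀ e {x y c t} → σ ≤ 2 ^ e →
      ∃[ x′ ] ∃[ y′ ] ∃[ c′ ] ∃[ t′ ]
      ((classId ρ ∷ offset ρ ∷ ℓ ∷ x ∷ y ∷ c ∷ t ∷ []) ⊢ while readCond readBody ⇓
       (classId τ ∷ offset τ ∷ k ∷ x′ ∷ y′ ∷ c′ ∷ t′ ∷ []) / [] within readCost e (k ∸ ℓ))
    reading {τ} whole r mem≡ e {x} {y} {c} {t} σ≤ = x , y , c , t ,
      subst (λ n → s ⊢ while readCond readBody ⇓ s / [] within readCost e n) (sym (n∸n≡0 k))
        (stops (trans (lt-value {ρ = s} {a = var level} {b = scalar 0} 0<w refl
          (scalar-value {ρ = s} {0} (s≤s z≤n)))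
                 (m≮n⇒bit (<-irrefl {k} refl))))
      where
      s : Vec ℕ 7
      s = classId τ ∷ offset τ ∷ k ∷ x ∷ y ∷ c ∷ t ∷ []
    reading {τ} {ℓ} {ρ} (drop1 {c = d} tl) r mem≡ e {x} {y} {c} {t} σ≤ =
      _ , _ , _ , _ , subst (λ n → s ⊢ while readCond readBody ⇓ s₃ / [] within readCost e n)
        (sym (+-∸-assoc 1 (≤-pred ℓ<k)))
        (loops (trans (lt-value {ρ = s} {a = var level} {b = scalar 0} 0<w refl
          (scalar-value {ρ = s} {0} (s≤s z≤n)))
                 (m<n⇒bit ℓ<k))
          (assigns (trans (mem≡ ℓ<k) (tail-letter tl)) d<
            ► proj₂ (proj₂ (proj₂ arc))
            ► assigns (trans (add-value {ρ = s₂} {a = var level} {b = lit 1} refl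
              (literal {ρ = s₂} (s≤s z≤n)) next<)
                        (+-comm ℓ 1))
                      (≤-<-trans ℓ<k k<))
          (proj₂ (proj₂ (proj₂ (proj₂ rest)))))
      where
      ℓ<k : ℓ < k
      ℓ<k = tail-≤ tl
      s s₂ s₃ : Vec ℕ 7
      s = classId ρ ∷ offset ρ ∷ ℓ ∷ x ∷ y ∷ c ∷ t ∷ []
      cr : RContains (d ∷ ρ)
      cr = tail-contains tl r
      arc = follow-arc ρ d ℓ<k cr e {x} {y} {t} σ≤
      s₂ = classId (d ∷ ρ) ∷ offset (d ∷ ρ) ∷ ℓ ∷ proj₁ arc ∷ proj₁ (proj₂ arc) ∷ toℕ d ∷ proj₁
        (proj₂ (proj₂ arc)) ∷ []
      rest = reading {τ} {suc ℓ} {d ∷ ρ} tl r mem≡ e {proj₁ arc} {proj₁ (proj₂ arc)} {toℕ d}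
               {proj₁ (proj₂ (proj₂ arc))} σ≤
      s₃ = classId τ ∷ offset τ ∷ k ∷ proj₁ rest ∷ proj₁ (proj₂ rest) ∷ proj₁ (proj₂ (proj₂ rest)) ∷
           proj₁ (proj₂ (proj₂ (proj₂ rest))) ∷ []
      d< : toℕ d < 2 ^ w
      d< = subst (λ c → toℕ c < 2 ^ w) (Row.Search.at-p ℓ<k (tail-contained cr) (∈-labels-first cr))
        (Row.letter< ℓ<k (tail-contained cr) d (Row.Search.p< ℓ<k (tail-contained cr) (∈-labels-first cr)))
      next< : ℓ + 1 < 2 ^ w
      next< = subst (_< 2 ^ w) (+-comm 1 ℓ) (≤-<-trans ℓ<k k<)

    single : ∀ {P : Mer 0 → Set} (P? : ∀ ρ → Dec (P ρ)) {x} → x < length (filter P? (allMers σ 0)) → x ≡ 0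
    single P? x< = n<1⇒n≡0 (<-≤-trans x< (List.length-filter P? (allMers σ 0)))

    -- There is only one string of length 0, so the initial zeros of the variables already represent
    -- it.
    empty-state : RContains {0} [] → classId {0} [] ≡ 0 × offset {0} [] ≡ 0
    empty-state r = single isFirst? (classId< r) , single rcontains? (between< (∈-merList r))

    retrieves : ∀ {τ : Mer k} {u v} → RContains τ → Extent τ u v →
      (∀ {i} → i < k → mem i ≡ nth (encodeMer (reverse τ)) i) → ∀ e → σ ≤ 2 ^ e →
      ∃[ s ] (Vec.replicate 7 0 ⊢ retrieveStmt ⇓ s /
        (position u ∷ position v ∷ suc (rank τ (reachList u)) ∷ []) within
          (readCost e k + straight outputHandle))
    retrieves {τ} {u} {v} r E mem≡ e σ≤ = _ ,
      (subst₂ (λ a b → (a ∷ b ∷ 0 ∷ 0 ∷ 0 ∷ 0 ∷ 0 ∷ []) ⊢ while readCond readBody ⇓ s / [] within readCost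
        e k)
        (proj₁ start) (proj₂ start) (proj₂ (proj₂ (proj₂ (proj₂ done)))) ►
       output-handle r E)
      where
      start = empty-state (tail-contains (tail-nil τ) r)
      done = reading {τ} {0} {[]} (tail-nil τ) r mem≡ e {0} {0} {0} {0} σ≤
      s : Vec ℕ 7
      s = classId τ ∷ offset τ ∷ k ∷ proj₁ done ∷ proj₁ (proj₂ done) ∷ proj₁ (proj₂ (proj₂ done)) ∷
          proj₁ (proj₂ (proj₂ (proj₂ done))) ∷ []

    -- By `code-injective`, every representative with this code is the one sought, so the first hit
    -- is right.
    class-of-code : ∀ {ρ : Mer k} → RContains ρ → classOfCode (code (first ρ)) ≡ classId ρ
    class-of-code {ρ} r = at-constant classId coded (∈-length φ∈)
      (λ {ψ} ψ∈ → let (ψ∈F , eqn) = ∈-filter⁻ (λ ψ → code ψ ≟ code (first ρ)) {xs = firsts k} ψ∈ in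
        trans (cong classId (firsts-injective ψ∈F (∈-firsts r)
                (code-injective (proj₁ (∈-firsts⁻ ψ∈F)) (first-contained r) eqn)))
          (cong (λ f → rank f (firsts k)) (first-first r)))
      where
      coded = filter (λ ψ → code ψ ≟ code (first ρ)) (firsts k)
      φ∈ : first ρ ∈ coded
      φ∈ = ∈-filter⁺ (λ ψ → code ψ ≟ code (first ρ)) (∈-firsts r) refl

    clamped-rank : ∀ (f : Mer k → ℕ) {ρ : Mer k} → RContains ρ →
                   clamped (map f (merList k)) (rank ρ (merList k)) ≡ f ρ
    clamped-rank f {ρ} r = trans
      (clamped-< (map f (merList k))
        (subst (rank ρ (merList k) <_) (sym (List.length-map f (merList k))) (rank< (∈-merList r))))
      (trans (at-map {d = ρ} f (merList k) (rank< (∈-merList r)))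
        (cong f (at-rank (merList-sorted k) (∈-merList r))))

    -- The index in the handle and the rank among all `k`-mers both exceed the values of the
    -- representative by the offset; two tables over classes thus convert one into the other.
    resolves : ∀ {ρ : Mer k} {u v} → RContains ρ → Extent ρ u v → mem 0 ≡ position u → mem 1 ≡ position v →
      mem 2 ≡ suc (rank ρ (reachList u)) →
      Vec.replicate 7 0 ⊢ resolve ⇓
      (classId (front ρ) ∷ offset ρ ∷ k′ ∷ rank ρ (merList k) ∷ 0 ∷ 0 ∷ 0 ∷ []) / [] within straight resolve
    resolves {ρ} {u} {v} r E mem₀ mem₁ mem₂ =
        assigns (trans (read-at classTable refl {ρ = s₀} code≡ (code< (first-contained r)))
          (class-of-code r)) class<
      ► assigns (trans (sub-value {ρ = s₁} {a = loadE (lit 2)} {b = read indexTable (var class)}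
                  (trans (cong mem (literal {ρ = s₁} (s≤s (s≤s z≤n)))) (trans mem₂ (index-rank r E)))
                  (class-table startRank refl r {env = s₁} refl) (m≤m+n _ (offset ρ)) index<′)
                  (m+n∸m≡n (startRank (first ρ)) (offset ρ)))
                (≤-<-trans (m≤n+m (offset ρ) (startRank (first ρ))) index<′)
      ► assigns (trans (add-value {ρ = s₂} {a = read rankTable (var class)} {b = var offs}
                  (class-table (λ φ → rank φ (merList k)) refl r {env = s₂} refl) refl
                  (subst (_< 2 ^ w) rank≡ rank<′)) (sym rank≡)) rank<′
      ► assigns (trans (classAccess (rank< (∈-merList r))) (clamped-rank (λ ρ → classId (front ρ)) r))
                (<-≤-trans (classId< (front-contained r))
                  (≤-trans (firsts≤merList k′) (<⇒≤ (mers< (n≤1+n k′)))))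
      ► assigns (sub-value {ρ = s₄} {a = scalar 0} {b = lit 1} (scalar-value {ρ = s₄} {0} (s≤s z≤n))
                  (literal {ρ = s₄} (s≤s z≤n)) (s≤s z≤n) k<)
                (<-trans (n<1+n k′) k<)
      where
      s₀ s₁ s₂ s₄ : Vec ℕ 7
      s₀ = 0 ∷ 0 ∷ 0 ∷ 0 ∷ 0 ∷ 0 ∷ 0 ∷ []
      s₁ = classId ρ ∷ 0 ∷ 0 ∷ 0 ∷ 0 ∷ 0 ∷ 0 ∷ []
      s₂ = classId ρ ∷ offset ρ ∷ 0 ∷ 0 ∷ 0 ∷ 0 ∷ 0 ∷ []
      s₄ = classId (front ρ) ∷ offset ρ ∷ 0 ∷ rank ρ (merList k) ∷ 0 ∷ 0 ∷ 0 ∷ []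
      class< : classId ρ < 2 ^ w
      class< = <-≤-trans (classId< r) (≤-trans (firsts≤merList k) (<⇒≤ (mers< ≤-refl)))
      index<′ : startRank (first ρ) + offset ρ < 2 ^ w
      index<′ = subst (_< 2 ^ w) (trans (startRank-extent E) (index-rank r E))
        (≤-<-trans (startRank≤ r) (mers< ≤-refl))
      rank≡ : rank ρ (merList k) ≡ rank (first ρ) (merList k) + offset ρ
      rank≡ = rank-split (first⊑ r) (merList k)
      rank<′ : rank ρ (merList k) < 2 ^ w
      rank<′ = <-trans (rank< (∈-merList r)) (mers< ≤-refl)
      pq : Vec ℕ 2
      pq = position u ∷ position v ∷ []
      hc : handleCode (position u) (position v) ≡ code (first ρ)
      hc = sym (code-first r E)
      hc< : handleCode (position u) (position v) < 2 ^ w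
      hc< = subst (_< 2 ^ w) (sym hc) (index< classTable refl (code< (first-contained r)))
      code≡ : ⟦ call codeE (loadE (lit 0) ∷ loadE (lit 1) ∷ []) ⟧ s₀ ≡ code (first ρ)
      code≡ = trans (cong₂ (λ a b → ⟦ codeE ⟧ (a ∷ b ∷ []))
                (trans (cong mem (literal {ρ = s₀} {0} z≤n)) mem₀)
                (trans (cong mem (literal {ρ = s₀} {1} (s≤s z≤n))) mem₁))
        (trans (add-value {ρ = pq} {a = op mul (var zero) (lit 2)}
          {b = op sub (lit 1) (op eq (var zero) (var (suc zero)))}
          (mul-value {ρ = pq} {a = var zero} {b = lit 2} refl (literal {ρ = pq} (s≤s (s≤s z≤n)))
            (≤-<-trans (m≤m+n _ (1 ∸ bit (does (position u ≟ position v)))) hc<))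
          (sub-value {ρ = pq} {a = lit 1} {b = op eq (var zero) (var (suc zero))}
            (literal {ρ = pq} (s≤s z≤n))
            (eq-value {ρ = pq} {a = var zero} {b = var (suc zero)} 0<w refl refl)
            (≤-pred (bit<2 (does (position u ≟ position v)))) (lit< (s≤s z≤n)))
          hc<) hc)

    module _ {ρ : Mer k} (r : RContains ρ) where
      private
        η = front ρ
        ηr : RContains η
        ηr = front-contained r
        open module R = Row (n<1+n k′) {η} ηr

      emits-labels : ∀ pre suf {d y t} → labels (first η) ≡ pre ++ suf →
        ∃[ s ] ((classId η ∷ d ∷ k′ ∷ R.begins + length pre ∷ R.begins + R.deg ∷ y ∷ t ∷ []) ⊢
          while listCond listBody ⇓ s / encodeLabels suf within listCost (length suf))
      emits-labels pre [] {d} {y} {t} split = s , stops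
        (trans (lt-value {ρ = s} {a = var lo} {b = var len} 0<w refl refl)
          (m≮n⇒bit (<-irrefl (cong (R.begins +_)
            (sym (trans (cong length split) (cong length (List.++-identityʳ pre))))))))
        where
        s : Vec ℕ 7
        s = classId η ∷ d ∷ k′ ∷ R.begins + length pre ∷ R.begins + R.deg ∷ y ∷ t ∷ []
      emits-labels pre (c ∷ suf) {d} {y} {t} split = proj₁ rest , loops
        (trans (lt-value {ρ = s} {a = var lo} {b = var len} 0<w refl refl)
          (m<n⇒bit (+-monoʳ-< R.begins pre<)))
        (outputs (trans (R.letter-value c pre<) (cong toℕ at≡))
          ► assigns (trans (add-value {ρ = s} {a = var lo} {b = lit 1} refl (literal {ρ = s} (s≤s z≤n))
                      (subst (_< 2 ^ w) (sym next≡) next<)) next≡) next<)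
        (proj₂ rest)
        where
        s : Vec ℕ 7
        s = classId η ∷ d ∷ k′ ∷ R.begins + length pre ∷ R.begins + R.deg ∷ y ∷ t ∷ []
        rest = emits-labels (pre ++ c ∷ []) suf {d} {y} {t}
          (trans split (sym (List.++-assoc pre (c ∷ []) suf)))
        deg≡ : R.deg ≡ length pre + suc (length suf)
        deg≡ = trans (cong length split) (List.length-++ pre)
        pre< : length pre < R.deg
        pre< = subst (length pre <_) (sym deg≡) (m<m+n (length pre) (s≤s z≤n))
        at≡ : at c (labels (first η)) (length pre) ≡ c
        at≡ = trans (cong₂ (at c) split (sym (+-identityʳ (length pre)))) (at-++ʳ pre 0)
        next≡ : R.begins + length pre + 1 ≡ R.begins + length (pre ++ c ∷ [])
        next≡ = trans (+-assoc R.begins (length pre) 1) (cong (R.begins +_) (sym (List.length-++ pre)))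
        next< : R.begins + length (pre ++ c ∷ []) < 2 ^ w
        next< = R.arcs< (+-monoʳ-≤ R.begins (subst (_≤ R.deg)
          (trans (+-comm 1 (length pre)) (sym (List.length-++ pre))) pre<))

      lists : ∀ {u v} → Extent ρ u v → mem 0 ≡ position u → mem 1 ≡ position v →
        mem 2 ≡ suc (rank ρ (reachList u)) →
        ∃[ s ] (Vec.replicate 7 0 ⊢ listStmt ⇓ s / encodeLabels (labels (first η)) within
          (straight resolve + (straight rowBounds + listCost (length (labels (first η))))))
      lists E mem₀ mem₁ mem₂ = proj₁ rest ,
        (resolves r E mem₀ mem₁ mem₂ ► R.rowBounds-run ►
         subst (λ x → (classId η ∷ offset ρ ∷ k′ ∷ x ∷ R.begins + R.deg ∷ 0 ∷ 0 ∷ []) ⊢ while listCond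
           listBody ⇓
                 proj₁ rest / encodeLabels (labels (first η)) within listCost (length (labels (first η))))
           (+-identityʳ R.begins) (proj₂ rest))
        where rest = emits-labels [] (labels (first η)) {offset ρ} {0} {0} refl

      forwards : ∀ {u v u′ v′ c} → Extent ρ u v → RContains (c ∷ η) → Extent (c ∷ η) u′ v′ →
        mem 0 ≡ position u → mem 1 ≡ position v → mem 2 ≡ suc (rank ρ (reachList u)) → mem 3 ≡ toℕ c →
        ∀ e → σ ≤ 2 ^ e →
        ∃[ s ] (Vec.replicate 7 0 ⊢ forwardStmt ⇓ s /
          (position u′ ∷ position v′ ∷ suc (rank (c ∷ η) (reachList u′)) ∷ []) within
          (straight resolve + (straight forwardOffset +
            (straight readLetter + (followCost e + straight outputHandle)))))
      forwards {c = c} E cr E′ mem₀ mem₁ mem₂ mem₃ e σ≤ = _ ,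
        (resolves r E mem₀ mem₁ mem₂ ►
         assigns (trans (sub-value {ρ = s₀} {a = call (accessE rankBlocks) (var lo ∷ [])}
           {b = read suffixBaseTable (var class)}
             (trans (rankAccess (rank< (∈-merList r)))
               (trans (clamped-rank (λ ρ → rank (front ρ) (rightList k′)) r) rank≡))
             (trans (read-at suffixBaseTable refl {ρ = s₀} refl (classId< ηr))
               (trans (at-map {d = η} (λ φ → rank φ (rightList k′)) (firsts k′) (classId< ηr))
                 (cong (λ φ → rank φ (rightList k′)) (at-classId {d = η} ηr))))
             (m≤m+n _ (offset η)) sum<)
           (m+n∸m≡n (rank (first η) (rightList k′)) (offset η)))
           (≤-<-trans (m≤n+m (offset η) _) sum<) ►
         assigns (trans (cong mem (literal {ρ = s₁} (s≤s (s≤s (s≤s z≤n))))) mem₃) c< ►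
         proj₂ (proj₂ (proj₂ arc)) ►
         output-handle cr E′)
        where
        s₀ s₁ : Vec ℕ 7
        s₀ = classId η ∷ offset ρ ∷ k′ ∷ rank ρ (merList k) ∷ 0 ∷ 0 ∷ 0 ∷ []
        s₁ = classId η ∷ offset η ∷ k′ ∷ rank ρ (merList k) ∷ 0 ∷ 0 ∷ 0 ∷ []
        arc = follow-arc η c (n<1+n k′) cr e {rank ρ (merList k)} {0} {0} σ≤
        c< : toℕ c < 2 ^ w
        c< = subst (λ c → toℕ c < 2 ^ w) (R.Search.at-p (∈-labels-first cr))
          (R.letter< c (R.Search.p< (∈-labels-first cr)))
        rank≡ : rank η (rightList k′) ≡ rank (first η) (rightList k′) + offset η
        -- Extensibility passes to the whole class of the suffix, with the traversed letter as the
        -- witness.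
        rank≡ = rank-class rightExtensible? ηr (λ (c , r) → tail-contained r)
          (λ {τ} s → c , same-contains {ρ = c ∷ η} {c ∷ τ}
            (same-∷ c {η} {τ} (same-trans {ρ = η} {first η} {τ} (first-same ηr) s)) cr)
        sum< : rank (first η) (rightList k′) + offset η < 2 ^ w
        sum< = subst (_< 2 ^ w) rank≡
          (≤-<-trans (≤-trans (rank≤ (rightList k′) η) (rightList≤ k′)) (mers< ≤-refl))

-- Resource bounds

n≤2^⌈log₂n⌉ : ∀ n → n ≤ 2 ^ ⌈log₂ n ⌉
n≤2^⌈log₂n⌉ n = go n n ≤-refl
  where
  go : ∀ fuel n → n ≤ fuel → n ≤ 2 ^ ⌈log₂ n ⌉
  go _          zero          _         = z≤n
  go _          (suc zero)    _         = ≤-refl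
  go (suc fuel) (suc (suc m)) (s≤s le) = begin
    suc (suc m)                 ≡⟨ ⌊n/2⌋+⌈n/2⌉≡n (suc (suc m)) ⟨
    ⌊ n′ /2⌋ + ⌈ n′ /2⌉         ≤⟨ +-monoˡ-≤ ⌈ n′ /2⌉ (⌊n/2⌋≤⌈n/2⌉ n′) ⟩
    ⌈ n′ /2⌉ + ⌈ n′ /2⌉         ≤⟨ +-mono-≤ half≤ half≤ ⟩
    2 ^ l + 2 ^ l               ≡⟨ cong (2 ^ l +_) (+-identityʳ (2 ^ l)) ⟨
    2 ^ suc l                   ≡⟨ cong (2 ^_) l≡ ⟩
    2 ^ ⌈log₂ n′ ⌉              ∎
    where
    open ≤-Reasoning
    n′ = suc (suc m)
    l = ⌈log₂ n′ ⌉ ∸ 1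
    half≤ : ⌈ n′ /2⌉ ≤ 2 ^ l
    half≤ = subst (λ x → ⌈ n′ /2⌉ ≤ 2 ^ x) (⌈log₂⌈n/2⌉⌉≡⌈log₂n⌉∸1 n′)
              (go fuel ⌈ n′ /2⌉ (≤-trans (≤-pred (⌈n/2⌉<n m)) le))
    l≡ : suc l ≡ ⌈log₂ n′ ⌉
    l≡ = m+[n∸m]≡n (⌈log₂⌉-mono-≤ {2} {n′} (s≤s (s≤s z≤n)))

n≤2^lg : ∀ n → n ≤ 2 ^ lg n
n≤2^lg n = ≤-trans (n≤2^⌈log₂n⌉ n) (^-monoʳ-≤ 2 (m≤n⊔m 1 ⌈log₂ n ⌉))

1≤lg : ∀ n → 1 ≤ lg n
1≤lg n = m≤m⊔n 1 ⌈log₂ n ⌉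

lg≤ : ∀ {n j} → 1 ≤ j → n ≤ 2 ^ j → lg n ≤ j
lg≤ {n} {j} 1≤j n≤ = ⊔-lub 1≤j (subst (⌈log₂ n ⌉ ≤_) (⌈log₂2^n⌉≡n j) (⌈log₂⌉-mono-≤ n≤))

lg≤n : ∀ {n} → 1 ≤ n → lg n ≤ n
lg≤n {n} 1≤n = lg≤ 1≤n (<⇒≤ (n<2^n n))

-- Either lg x is at most 2 lg s, or x / r is so large that it absorbs lg x.
trade : ∀ {r x s} → r ≤ 2 * x → r ≤ s → r * lg x ≤ 4 * (x * lg s)
trade {r} {x} {s} r≤2x r≤s with x ≤? 2 ^ (2 * lg s)
... | yes x≤ = begin
  r * lg x             ≤⟨ *-mono-≤ r≤2x (lg≤ (≤-trans (1≤lg s) (m≤n*m (lg s) 2)) x≤) ⟩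
  2 * x * (2 * lg s)   ≡⟨ solve 2 (λ x l → con 2 :* x :* (con 2 :* l) := con 4 :* (x :* l)) refl x (lg s) ⟩
  4 * (x * lg s)       ∎
  where open ≤-Reasoning
... | no x≰ = begin
  r * lg x             ≤⟨ *-mono-≤ (≤-trans r≤s (n≤2^lg s)) lgx≤ ⟩
  2 ^ a * (2 * q)      ≡⟨ solve 2 (λ p q → p :* (con 2 :* q) := con 2 :* (q :* p)) refl (2 ^ a) q ⟩
  2 * (q * 2 ^ a)      ≤⟨ *-mono-≤ {2} {4} (s≤s (s≤s z≤n)) (m/n*n≤m x (2 ^ a)) ⟩
  4 * x                ≤⟨ *-monoʳ-≤ 4 (m≤m*n x a {{>-nonZero (1≤lg s)}}) ⟩
  4 * (x * lg s)       ∎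
  where
  open ≤-Reasoning
  a = lg s
  instance _ = m^n≢0 2 a
  q = x / 2 ^ a
  2^a≤q : 2 ^ a ≤ q
  2^a≤q = ≤-trans (≤-reflexive (sym (m*n/n≡m (2 ^ a) (2 ^ a))))
    (/-monoˡ-≤ (2 ^ a) (≤-trans (≤-reflexive
      (trans (sym (^-distribˡ-+-* 2 a a)) (cong (λ z → 2 ^ (a + z)) (sym (+-identityʳ a)))))
      (<⇒≤ (≰⇒> x≰))))
  a≤q : a ≤ q
  a≤q = ≤-trans (<⇒≤ (n<2^n a)) 2^a≤q
  -- `x` is at most `(q + 1) * 2 ^ a`, and `a ≤ q`. Since also `q * 2 ^ a ≤ x`, the product
  -- `2 ^ a * lg x` is linear in `x`.
  lgx≤ : lg x ≤ 2 * q
  lgx≤ = lg≤ (≤-trans (1≤lg s) (≤-trans a≤q (m≤n*m q 2))) (begin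
    x                            ≡⟨ m≡m%n+[m/n]*n x (2 ^ a) ⟩
    x % 2 ^ a + q * 2 ^ a        ≤⟨ +-monoˡ-≤ (q * 2 ^ a) (m%n≤n x (2 ^ a)) ⟩
    suc q * 2 ^ a                ≤⟨ *-mono-≤ (n<2^n q) (^-monoʳ-≤ 2 a≤q) ⟩
    2 ^ q * 2 ^ q                ≡⟨ ^-distribˡ-+-* 2 q q ⟨
    2 ^ (q + q)                  ≡⟨ cong (λ z → 2 ^ (q + z)) (+-identityʳ q) ⟨
    2 ^ (2 * q)                  ∎)

searchRate followRate readRate retrieveRate listRate forwardRate : ℕ
searchRate   = loopCost searchCond (straight searchBody) + (cost searchCond + 1)
followRate   = straight rowBounds +
  (straight shrinkLen + (searchRate + (straight addOffset + straight target)))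
readRate     = loopCost readCond (straight readLetterAt + (followRate + straight advance))
retrieveRate = readRate + (cost readCond + 1) + straight outputHandle
listRate     = straight resolve +
  (straight rowBounds + (loopCost listCond (straight listBody) + (cost listCond + 1)))
forwardRate  = straight resolve +
  (straight forwardOffset + (straight readLetter + (followRate + straight outputHandle)))

infix 4 _≤[_]_
-- Linear bounds with a rate that adds up along sums, so that the constants of the running times
-- need not be evaluated.
record _≤[_]_ (b u a : ℕ) : Set where
  constructor rate
  field
    rate≤ : b ≤ a * u
open _≤[_]_

const-rate : ∀ {u} a → 1 ≤ u → a ≤[ u ] a
const-rate {u} a 1≤u = rate (m≤m*n a u {{>-nonZero 1≤u}})

+-rate : ∀ {u a b x y} → x ≤[ u ] a → y ≤[ u ] b → x + y ≤[ u ] a + b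
+-rate {u} {a} {b} (rate p) (rate q) = rate
  (≤-trans (+-mono-≤ p q) (≤-reflexive (sym (*-distribʳ-+ u a b))))

rate-trans : ∀ {u a x y} → x ≤ y → y ≤[ u ] a → x ≤[ u ] a
rate-trans p (rate q) = rate (≤-trans p q)

search-rate : ∀ {e} → 1 ≤ e → searchCost e ≤[ e ] searchRate
search-rate {e} 1≤e = rate-trans (≤-reflexive (exact e)) (rate
  (≤-trans (+-monoʳ-≤ (e * d) (m≤m*n c e {{>-nonZero 1≤e}}))
    (≤-reflexive (solve 3 (λ e d c → e :* d :+ c :* e := (d :+ c) :* e) refl e d c))))
  where
  d = loopCost searchCond (straight searchBody)
  c = cost searchCond + 1
  exact : ∀ e → searchCost e ≡ e * d + c
  exact zero    = refl
  exact (suc e) = trans (cong (d +_) (exact e)) (sym (+-assoc d (e * d) c))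

follow-rate : ∀ {e} → 1 ≤ e → followCost e ≤[ e ] followRate
follow-rate 1≤e = +-rate (const-rate (straight rowBounds) 1≤e)
  (+-rate (const-rate (straight shrinkLen) 1≤e)
    (+-rate (search-rate 1≤e) (const-rate (straight addOffset + straight target) 1≤e)))

readBody-rate : ∀ {e} → 1 ≤ e → loopCost readCond (readBodyCost e) ≤[ e ] readRate
readBody-rate 1≤e = +-rate (const-rate (cost readCond + 1) 1≤e)
  (+-rate
    (+-rate (const-rate (straight readLetterAt) 1≤e)
      (+-rate (follow-rate 1≤e) (const-rate (straight advance) 1≤e)))
    (const-rate 1 1≤e))

retrieve-rate : ∀ {k e} → 1 ≤ k → 1 ≤ e → readCost e k + straight outputHandle ≤[ k * e ] retrieveRate
retrieve-rate {k} {e} 1≤k 1≤e = +-rate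
  (rate-trans (≤-reflexive (exact k)) (+-rate
    (rate {a = readRate} (≤-trans (*-monoʳ-≤ k (rate≤ (readBody-rate 1≤e)))
      (≤-reflexive (solve 3 (λ k r e → k :* (r :* e) := r :* (k :* e)) refl k readRate e))))
    (const-rate (cost readCond + 1) 1≤ke)))
  (const-rate (straight outputHandle) 1≤ke)
  where
  1≤ke : 1 ≤ k * e
  1≤ke = *-mono-≤ 1≤k 1≤e
  exact : ∀ k → readCost e k ≡ k * loopCost readCond (readBodyCost e) + (cost readCond + 1)
  exact zero    = refl
  exact (suc k) = trans (cong (loopCost readCond (readBodyCost e) +_) (exact k))
    (sym (+-assoc (loopCost readCond (readBodyCost e)) _ (cost readCond + 1)))

list-rate : ∀ {n e} → 1 ≤ e → straight resolve + (straight rowBounds + listCost n) ≤[ suc n * e ] listRate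
list-rate {n} {e} 1≤e = rate (≤-trans (rate≤ (+-rate (const-rate (straight resolve) (s≤s z≤n))
    (+-rate (const-rate (straight rowBounds) (s≤s z≤n))
      (rate-trans (≤-reflexive (exact n)) (+-rate
        (rate (≤-trans (*-monoˡ-≤ d (n≤1+n n)) (≤-reflexive (*-comm (suc n) d))))
        (const-rate (cost listCond + 1) (s≤s z≤n)))))))
  (*-monoʳ-≤ listRate (m≤m*n (suc n) e {{>-nonZero 1≤e}})))
  where
  d = loopCost listCond (straight listBody)
  exact : ∀ n → listCost n ≡ n * d + (cost listCond + 1)
  exact zero    = refl
  exact (suc n) = trans (cong (d +_) (exact n)) (sym (+-assoc d (n * d) (cost listCond + 1)))

forward-rate : ∀ {e} → 1 ≤ e → (straight resolve + (straight forwardOffset +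
  (straight readLetter + (followCost e + straight outputHandle)))) ≤[ e ] forwardRate
forward-rate 1≤e = +-rate (const-rate (straight resolve) 1≤e)
  (+-rate (const-rate (straight forwardOffset) 1≤e)
    (+-rate (const-rate (straight readLetter) 1≤e)
      (+-rate (follow-rate 1≤e) (const-rate (straight outputHandle) 1≤e))))

-- The tables take at most 2 ^ budgetBits times the space bound.
opaque
  budgetBits spareBits budgetFactor : ℕ
  budgetBits   = 12
  spareBits    = 8
  budgetFactor = 5000

  5≤spareBits : 5 ≤ spareBits
  5≤spareBits = m≤m+n 5 3

  -- 789 is the sum of the coefficients of `S` in the bounds on the single tables in `total≤`.
  789≤budget : 789 ≤ 2 ^ budgetBits
  789≤budget = m≤m+n 789 3307

  4+budgetBits≤16 : 4 + budgetBits ≤ 16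
  4+budgetBits≤16 = ≤-refl

  2≤2^budgetBits : 2 ≤ 2 ^ budgetBits
  2≤2^budgetBits = m≤m+n 2 4094

  -- Besides the tables there is a header of 47 = 1 + 2 * 23 fields, each of at most `17 * S` bits.
  layout≤budgetFactor : 17 * 47 + 2 ^ budgetBits ≤ budgetFactor
  layout≤budgetFactor = m≤m+n 4895 105

  budgetFactor< : budgetFactor + 1 ≤ 2 ^ budgetBits * 2 ^ spareBits
  budgetFactor< = m≤m+n 5001 1043575

wordFactor : ℕ
wordFactor = 2 ^ budgetBits * 2 ^ spareBits

record Admissible (w h : ℕ) (s : Segment) : Set where
  constructor admissible
  field
    positive : 0 < Segment.width s
    narrow   : Segment.width s < w
    modest   : Segment.width s < 2 ^ h
    fitting  : ∀ j → j < Segment.count s → Segment.content s j < 2 ^ Segment.width s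
open Admissible

-- Choice of the parameters, and size of the data structure

module Instance {σ : ℕ} (W : LabeledGraph σ) (O : WheelerOrder W) (det : Deterministic W) (k′ w : ℕ)
                (sufficient : WordSizeSuffices wordFactor W (suc k′) w)
                {τ₀ : Vec (Fin σ) (suc k′)} (contained : Reversed.RContains W τ₀) where
  open LabeledGraph W using (order; edges; edgeCount; unique) renaming (size to graphSize)
  open Reversed W
  open Wheeler W O det
  open Handles W O det
  open WheelerOrder O using (position)

  k Nₖ most L S unit : ℕ
  k    = suc k′
  Nₖ   = length (merList k)
  most = maxMerCount W k
  L    = lg most
  S    = spaceBound W k
  unit = graphSize * k * L

  -- A contained `k`-mer makes the number of vertices, the alphabet size and the maximal count
  -- positive, so that additive constants are absorbed by `S`. Graphs without `k`-mers are treated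
  -- separately at the end.
  vertex≥1 : 1 ≤ order
  vertex≥1 = ≤-<-trans z≤n (Fin.toℕ<n (proj₁ contained))

  edge≥1 : ∀ {ρ : Mer k} → RContains ρ → 1 ≤ edgeCount × 1 ≤ σ
  edge≥1 {c ∷ ρ} (v , p , e , _) = ∈-length e , ≤-<-trans z≤n (Fin.toℕ<n c)

  1≤σ : 1 ≤ σ
  1≤σ = proj₂ (edge≥1 contained)

  merCount≤most : ∀ {ℓ} → ℓ < k → merCount W (suc ℓ) ≤ most
  merCount≤most ℓ<k = All.lookup (xs≤max 0 (map (merCount W ∘ suc) (upTo k)))
    (∈-map⁺ (merCount W ∘ suc) (∈-upTo⁺ ℓ<k))

  Nₖ≤merCount : Nₖ ≤ merCount W k
  Nₖ≤merCount = merList≤merCount k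

  1≤most : 1 ≤ most
  1≤most = ≤-trans (∈-length (∈-merList contained)) (≤-trans Nₖ≤merCount (merCount≤most ≤-refl))

  mers≤most : ∀ {ℓ} → ℓ ≤ k → length (merList ℓ) ≤ most
  mers≤most {zero}  _   = ≤-trans (List.length-filter rcontains? (allMers σ 0)) 1≤most
  mers≤most {suc ℓ} ℓ<k = ≤-trans (merList≤merCount (suc ℓ)) (merCount≤most ℓ<k)

  1≤L : 1 ≤ L
  1≤L = 1≤lg most

  order≤size : order ≤ graphSize
  order≤size = m≤m+n order edgeCount

  1≤size : 1 ≤ graphSize
  1≤size = ≤-trans vertex≥1 order≤size

  unit≤S : unit ≤ S
  unit≤S = ≤-trans (m≤n+m unit (merCount W k)) (m≤m+n _ (σ * lg edgeCount))

  *-unit : ∀ {a b} → a ≤ graphSize → b ≤ L → a * b ≤ unit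
  *-unit {a} {b} p q = *-mono-≤ (≤-trans p (m≤m*n graphSize k)) q

  order≤unit : order ≤ unit
  order≤unit = ≤-trans (≤-reflexive (sym (*-identityʳ order))) (*-unit order≤size 1≤L)

  order≤S : order ≤ S
  order≤S = ≤-trans order≤unit unit≤S

  k≤S : k ≤ S
  k≤S = ≤-trans (≤-trans (m≤n*m k graphSize {{>-nonZero 1≤size}})
    (m≤m*n (graphSize * k) L {{>-nonZero 1≤L}})) unit≤S

  edges≤S : edgeCount ≤ S
  edges≤S = ≤-trans (≤-trans (≤-trans (m≤n+m edgeCount order) (≤-reflexive (sym (*-identityʳ graphSize))))
    (*-unit ≤-refl 1≤L)) unit≤S

  L≤S : L ≤ S
  L≤S = ≤-trans (≤-trans (≤-reflexive (sym (*-identityˡ L))) (*-unit 1≤size ≤-refl)) unit≤S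

  σ≤S : σ ≤ S
  σ≤S = ≤-trans (m≤m*n σ (lg edgeCount) {{>-nonZero (1≤lg edgeCount)}})
    (m≤n+m (σ * lg edgeCount) (merCount W k + unit))

  order+N≤S : order + Nₖ ≤ S
  order+N≤S = ≤-trans (+-mono-≤ order≤unit Nₖ≤merCount)
    (≤-trans (≤-reflexive (+-comm unit (merCount W k))) (m≤m+n _ (σ * lg edgeCount)))

  1≤S : 1 ≤ S
  1≤S = ≤-trans vertex≥1 order≤S

  budget g′ field′ : ℕ
  budget = 2 ^ budgetBits * S
  -- The least `g′` for which a field is wider than `lg budget`; a field holds all numbers up to
  -- `budget` and has at most 4 more bits than `lg budget`.
  g′     = lg budget / 4
  field′ = fieldWidth g′

  spare<w : spareBits < w
  spare<w = ≰⇒> λ w≤ → <⇒≱ (≤-<-trans (^-monoʳ-≤ 2 w≤) (begin-strict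
      2 ^ spareBits                  <⟨ m<m*n (2 ^ spareBits) (2 ^ budgetBits) {{m^n≢0 2 spareBits}}
        2≤2^budgetBits ⟩
      2 ^ spareBits * 2 ^ budgetBits ≡⟨ *-comm (2 ^ spareBits) (2 ^ budgetBits) ⟩
      wordFactor                     ≤⟨ m≤m*n wordFactor (most + S)
        {{>-nonZero (≤-trans 1≤S (m≤n+m S most))}} ⟩
      wordFactor * (most + S)        ∎)) sufficient
    where open ≤-Reasoning

  -- Widths are compared with `w`, but the hypothesis is about `2 ^ w`: the factor `2 ^ spareBits`
  -- of `wordFactor` becomes an additive reserve of bits.
  log-room : ∀ {x} → x ≤ 2 ^ budgetBits * (most + S) → lg x + spareBits ≤ w
  log-room {x} x≤ = subst (lg x + spareBits ≤_) (m∸n+n≡m (<⇒≤ spare<w))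
    (+-monoˡ-≤ spareBits (lg≤ (m<n⇒0<n∸m spare<w)
    (*-cancelʳ-≤ x (2 ^ (w ∸ spareBits)) (2 ^ spareBits) {{m^n≢0 2 spareBits}} (begin
      x * 2 ^ spareBits                               ≤⟨ *-monoˡ-≤ (2 ^ spareBits) x≤ ⟩
      2 ^ budgetBits * (most + S) * 2 ^ spareBits
        ≡⟨ solve 3 (λ a b t → a :* t :* b := a :* b :* t) refl (2 ^ budgetBits) (2 ^ spareBits) (most + S) ⟩
      wordFactor * (most + S)                         ≤⟨ sufficient ⟩
      2 ^ w                                           ≡⟨ cong (2 ^_) (m∸n+n≡m (<⇒≤ spare<w)) ⟨
      2 ^ (w ∸ spareBits + spareBits)                 ≡⟨ ^-distribˡ-+-* 2 (w ∸ spareBits) spareBits ⟩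
      2 ^ (w ∸ spareBits) * 2 ^ spareBits             ∎))))
    where open ≤-Reasoning

  log-room-5 : ∀ {x} → x ≤ 2 ^ budgetBits * (most + S) → 5 + lg x ≤ w
  log-room-5 {x} x≤ = ≤-trans (≤-trans (≤-reflexive (+-comm 5 (lg x))) (+-monoʳ-≤ (lg x) 5≤spareBits))
    (log-room x≤)

  budget-room : 5 + lg budget ≤ w
  budget-room = log-room-5 (*-monoʳ-≤ (2 ^ budgetBits) (m≤n+m S most))

  within-budget : ∀ {x} a → x ≤ a * S → a ≤ 2 ^ budgetBits → x ≤ budget
  within-budget a x≤ a≤ = ≤-trans x≤ (*-monoˡ-≤ S a≤)

  field≤ : field′ ≤ 4 + lg budget
  field≤ = +-monoʳ-≤ 4 (m/n*n≤m (lg budget) 4)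

  field<w : field′ < w
  field<w = ≤-trans (s≤s field≤) budget-room

  <2^field : ∀ {x} → x ≤ budget → x < 2 ^ field′
  <2^field x≤ = ≤-<-trans (≤-trans x≤ (n≤2^lg budget)) (^-monoʳ-< 2 (s≤s (s≤s z≤n)) (begin-strict
    lg budget                              ≡⟨ m≡m%n+[m/n]*n (lg budget) 4 ⟩
    lg budget % 4 + g′ * 4                 <⟨ +-monoˡ-< (g′ * 4) (m%n<n (lg budget) 4) ⟩
    field′                                 ∎))
    where open ≤-Reasoning

  field≤17S : field′ ≤ 17 * S
  field≤17S = begin
    field′             ≤⟨ field≤ ⟩
    4 + lg budget      ≤⟨ +-monoʳ-≤ 4
      (lg≤ (≤-trans 1≤S (m≤n+m S budgetBits))
        (≤-trans (*-monoʳ-≤ (2 ^ budgetBits) (<⇒≤ (n<2^n S)))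
          (≤-reflexive (sym (^-distribˡ-+-* 2 budgetBits S))))) ⟩
    4 + (budgetBits + S) ≡⟨ +-assoc 4 budgetBits S ⟨
    4 + budgetBits + S ≤⟨ +-monoˡ-≤ S (≤-trans 4+budgetBits≤16 (m≤m*n 16 S {{>-nonZero 1≤S}})) ⟩
    16 * S + S         ≡⟨ +-comm (16 * S) S ⟩
    17 * S             ∎
    where open ≤-Reasoning

  biggest Z e : ℕ
  biggest = order * 2 + Nₖ + Nₖ
  -- Block starts run up to `biggest`, possibly beyond `N`, so `point` at a block start is only
  -- bounded by twice `biggest`.
  Z       = suc (biggest + biggest)
  -- With blocks of this length, `suc (lg Z)` bits per block are linear in total, while the decoding
  -- table, of order `2 ^ (4 * e)`, does not exceed the order of `Z`.
  e       = lg Z / 8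

  widths : Widths
  widths = record
    { scalarW = field′ ; countW = suc L ; positionW = lg order ; letterW = lg σ ; blockW = suc (lg Z)
    ; half = suc e ; full = suc e + suc e ; halves = ≤-refl }

  open Widths widths using (half; full)
  open Tables W O det k′ widths hiding (k)

  Z≤5S : Z ≤ 5 * S
  Z≤5S = begin
    suc (biggest + biggest)
      ≡⟨ cong suc (solve 2 (λ n m → n :* con 2 :+ m :+ m :+ (n :* con 2 :+ m :+ m) := con 4 :* (n :+ m))
        refl order Nₖ) ⟩
    1 + 4 * (order + Nₖ)   ≤⟨ +-mono-≤ 1≤S (*-monoʳ-≤ 4 order+N≤S) ⟩
    5 * S                  ∎
    where open ≤-Reasoning

  -- `lg` rounds up, so `2 ^ lg Z` may exceed `Z`; the factor two between `e * 4` and `e * 8`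
  -- absorbs the rounding.
  2^4e≤Z : 2 ^ (e * 4) ≤ Z
  2^4e≤Z = small e (m/n*n≤m (lg Z) 8)
    where
    small : ∀ e → e * 8 ≤ lg Z → 2 ^ (e * 4) ≤ Z
    small zero    _  = s≤s z≤n
    small (suc e) le = ≮⇒≥ λ Z< → <⇒≱
      (*-monoʳ-< (suc e) {4} {8} (s≤s (s≤s (s≤s (s≤s (s≤s z≤n))))))
      (≤-trans le (lg≤ (s≤s z≤n) (<⇒≤ Z<)))

  2^e≤ : 2 ^ e ≤ 2 ^ (e * 4)
  2^e≤ = ^-monoʳ-≤ 2 (m≤m*n e 4)

  half≤Z : half ≤ Z
  half≤Z = ≤-trans (n<2^n e) (≤-trans 2^e≤ 2^4e≤Z)

  biggest≤Z : biggest ≤ Z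
  biggest≤Z = ≤-trans (m≤m+n biggest biggest) (n≤1+n _)

  blockW≤ : suc (lg Z) ≤ 8 * half
  blockW≤ = begin-strict
    lg Z                 ≡⟨ m≡m%n+[m/n]*n (lg Z) 8 ⟩
    lg Z % 8 + e * 8     <⟨ +-monoˡ-< (e * 8) (m%n<n (lg Z) 8) ⟩
    suc e * 8            ≡⟨ *-comm (suc e) 8 ⟩
    8 * half             ∎
    where open ≤-Reasoning

  -- The cost of a block is proportional to its length, so the sum is linear in `biggest`; one extra
  -- block accounts for rounding. The factor 10 comes from two quantities of at most `Z`, which is
  -- at most `5 * S`.
  blocks≤ : ∀ a {b} → b ≤ a * half → blockCount * b ≤ a * 10 * S
  blocks≤ a {b} b≤ = begin
    suc (biggest / half) * b             ≤⟨ *-monoʳ-≤ (suc (biggest / half)) b≤ ⟩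
    suc (biggest / half) * (a * half)    ≡⟨ solve 3
      (λ q a h → (con 1 :+ q) :* (a :* h) := a :* (h :+ q :* h)) refl (biggest / half) a half ⟩
    a * (half + biggest / half * half)   ≤⟨ *-monoʳ-≤ a
      (+-mono-≤ half≤Z (≤-trans (m/n*n≤m biggest half) biggest≤Z)) ⟩
    a * (Z + Z)                          ≤⟨ *-monoʳ-≤ a (+-mono-≤ Z≤5S Z≤5S) ⟩
    a * (5 * S + 5 * S)                  ≡⟨ solve 2
      (λ a s → a :* (con 5 :* s :+ con 5 :* s) := a :* con 10 :* s) refl a S ⟩
    a * 10 * S                           ∎
    where open ≤-Reasoning

  full≡ : full ≤ 2 * half
  full≡ = ≤-reflexive (cong (half +_) (sym (+-identityʳ half)))

  -- Each factor `full` is estimated by `2 * 2 ^ e`, and `2 ^ full` is the square of that, so the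
  -- product is a fourth power.
  decoding≤ : 2 ^ full * full * full ≤ 80 * S
  decoding≤ = begin
    2 ^ full * full * full                              ≤⟨ *-mono-≤ (*-monoʳ-≤ (2 ^ full) full≤) full≤ ⟩
    2 ^ full * (2 * P) * (2 * P)                        ≡⟨ cong (λ z → z * (2 * P) * (2 * P))
      (^-distribˡ-+-* 2 half half) ⟩
    2 * P * (2 * P) * (2 * P) * (2 * P)                 ≡⟨ solve 1
      (λ p → con 2 :* p :* (con 2 :* p) :* (con 2 :* p) :* (con 2 :* p) := con 16 :* (p :* p :* (p :* p)))
        refl P ⟩
    16 * (P * P * (P * P))                              ≡⟨ cong (16 *_) P⁴ ⟩
    16 * 2 ^ (e * 4)                                    ≤⟨ *-monoʳ-≤ 16 (≤-trans 2^4e≤Z Z≤5S) ⟩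
    16 * (5 * S)                                        ≡⟨ *-assoc 16 5 S ⟨
    80 * S                                              ∎
    where
    open ≤-Reasoning
    P = 2 ^ e
    full≤ : full ≤ 2 * P
    full≤ = ≤-trans full≡ (*-monoʳ-≤ 2 (n<2^n e))
    P⁴ : P * P * (P * P) ≡ 2 ^ (e * 4)
    P⁴ = trans (cong₂ _*_ (sym (^-distribˡ-+-* 2 e e)) (sym (^-distribˡ-+-* 2 e e)))
      (trans (sym (^-distribˡ-+-* 2 (e + e) (e + e)))
        (cong (2 ^_) (solve 1 (λ e → e :+ e :+ (e :+ e) := e :* con 4) refl e)))

  classes≤ : ∀ {ℓ} → ℓ ≤ k → length (firsts ℓ) ≤ most
  classes≤ {ℓ} ℓ≤k = ≤-trans (firsts≤merList ℓ) (mers≤most ℓ≤k)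

  countW≤ : suc L ≤ 2 * L
  countW≤ = ≤-trans (+-monoˡ-≤ L 1≤L) (≤-reflexive (cong (L +_) (sym (+-identityʳ L))))

  rows≤ : k * rowStride * suc L ≤ 6 * S
  rows≤ = begin
    k * suc (order * 2) * suc L   ≤⟨ *-mono-≤ (*-monoʳ-≤ k stride≤) countW≤ ⟩
    k * (3 * graphSize) * (2 * L) ≡⟨ solve 3
      (λ k s l → k :* (con 3 :* s) :* (con 2 :* l) := con 6 :* (s :* k :* l)) refl k graphSize L ⟩
    6 * unit                      ≤⟨ *-monoʳ-≤ 6 unit≤S ⟩
    6 * S                         ∎
    where
    open ≤-Reasoning
    stride≤ : suc (order * 2) ≤ 3 * graphSize
    stride≤ = ≤-trans (+-monoˡ-≤ (order * 2) vertex≥1)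
      (≤-trans (≤-reflexive (solve 1 (λ n → n :+ n :* con 2 := con 3 :* n) refl order))
        (*-monoʳ-≤ 3 order≤size))

  arcs≤ : k * arcStride * suc L ≤ 10 * S
  arcs≤ = begin
    k * suc (edgeCount * 4) * suc L ≤⟨ *-mono-≤ (*-monoʳ-≤ k stride≤) countW≤ ⟩
    k * (5 * graphSize) * (2 * L)   ≡⟨ solve 3
      (λ k s l → k :* (con 5 :* s) :* (con 2 :* l) := con 10 :* (s :* k :* l)) refl k graphSize L ⟩
    10 * unit                       ≤⟨ *-monoʳ-≤ 10 unit≤S ⟩
    10 * S                          ∎
    where
    open ≤-Reasoning
    stride≤ : suc (edgeCount * 4) ≤ 5 * graphSize
    stride≤ = +-mono-≤ 1≤size (≤-trans (≤-reflexive (*-comm edgeCount 4))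
      (*-monoʳ-≤ 4 (m≤n+m edgeCount order)))

  perClass≤ : ∀ {c} → c ≤ order * 2 → c * suc L ≤ 4 * S
  perClass≤ {c} c≤ = begin
    c * suc L             ≤⟨ *-mono-≤ c≤ countW≤ ⟩
    order * 2 * (2 * L)   ≡⟨ solve 2 (λ n l → n :* con 2 :* (con 2 :* l) := con 4 :* (n :* l)) refl order
      L ⟩
    4 * (order * L)       ≤⟨ *-monoʳ-≤ 4 (≤-trans (*-unit order≤size ≤-refl) unit≤S) ⟩
    4 * S                 ∎
    where open ≤-Reasoning

  -- A position takes `lg order` bits, and `order` may be much larger than `most`. The number of
  -- classes is bounded in terms of both, which is what `trade` exploits.
  positions≤ : length (firsts k) * lg order ≤ 4 * S
  positions≤ = ≤-trans (trade {x = order} {s = most} (≤-trans (firsts≤2n k) (≤-reflexive (*-comm order 2)))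
    (classes≤ ≤-refl))
    (*-monoʳ-≤ 4 (≤-trans (*-unit order≤size ≤-refl) unit≤S))

  letters≤edges : length letters ≤ edgeCount
  letters≤edges = length-≤-by (λ c (_ , _ , d) → c ≡ d)
    (AllPairs.filter⁺ (λ c → rcontains? (c ∷ [])) (Unique.allFin⁺ σ))
    (λ c∈ → let (v , p , e , _) = proj₂ (∈-filter⁻ (λ c → rcontains? (c ∷ [])) {xs = allFin σ} c∈)
             in (p , v , _) , e , refl)
    (λ _ _ p q → trans p (sym q))

  letters≤σ : length letters ≤ σ
  letters≤σ = ≤-trans (List.length-filter (λ c → rcontains? (c ∷ [])) (allFin σ))
    (≤-reflexive (List.length-tabulate id))

  letters≤most : length letters ≤ most
  letters≤most = ≤-trans (length-≤ (_∷ []) (AllPairs.filter⁺ (λ c → rcontains? (c ∷ [])) (Unique.allFin⁺ σ))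
    (λ c∈ → ∈-merList (proj₂ (∈-filter⁻ (λ c → rcontains? (c ∷ [])) {xs = allFin σ} c∈)))
    (λ _ _ → λ { refl → refl })) (mers≤most {1} (s≤s z≤n))

  -- Only letters that label edges are stored, so their number is bounded by the alphabet and by the
  -- edges, and `lg σ` can be traded for `lg edgeCount`.
  alphabet≤ : length letters * lg σ ≤ 4 * S
  alphabet≤ = ≤-trans (trade {x = σ} {s = edgeCount} (≤-trans letters≤σ (m≤n*m σ 2)) letters≤edges)
    (*-monoʳ-≤ 4 (m≤n+m (σ * lg edgeCount) (merCount W k + unit)))

  total≤ : totalSize segments ≤ budget
  total≤ = ≤-trans
    (+-mono-≤ (≤-trans (*-monoʳ-≤ 5 field≤17S) (≤-reflexive (sym (*-assoc 5 17 S))))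
      (+-mono-≤ alphabet≤ (+-mono-≤ rows≤
      (+-mono-≤ arcs≤ (+-mono-≤ arcs≤ (+-mono-≤ arcs≤ (+-mono-≤ positions≤ (+-mono-≤ positions≤
      (+-mono-≤ (perClass≤ (firsts≤2n k)) (+-mono-≤ (perClass≤ (firsts≤2n k)) (+-mono-≤ (perClass≤ ≤-refl)
      (+-mono-≤ (perClass≤ (firsts≤2n k′))
      (+-mono-≤ b₈ (+-mono-≤ b₂ (+-mono-≤ b₈ (+-mono-≤ b₈ (+-mono-≤ b₂
      (+-mono-≤ b₈ (+-mono-≤ b₂ (+-mono-≤ b₈ (+-mono-≤ b₈ (+-mono-≤ b₂
      (+-mono-≤ decoding≤ z≤n)))))))))))))))))))))))
    (within-budget 789 (≤-reflexive (solve 1 (λ s →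
       con 85 :* s :+ (con 4 :* s :+ (con 6 :* s :+ (con 10 :* s :+ (con 10 :* s :+ (con 10 :* s :+
       (con 4 :* s :+ (con 4 :* s :+ (con 4 :* s :+ (con 4 :* s :+ (con 4 :* s :+ (con 4 :* s :+
       (con 80 :* s :+ (con 20 :* s :+ (con 80 :* s :+ (con 80 :* s :+ (con 20 :* s :+
       (con 80 :* s :+ (con 20 :* s :+ (con 80 :* s :+ (con 80 :* s :+ (con 20 :* s :+
       (con 80 :* s :+ con 0))))))))))))))))))))))
       := con 789 :* s) refl S)) 789≤budget)
    where
    b₈ : blockCount * suc (lg Z) ≤ 80 * S
    b₈ = blocks≤ 8 blockW≤
    b₂ : blockCount * full ≤ 20 * S
    b₂ = blocks≤ 2 full≡

  field<2^w : ∀ {x} → x < 2 ^ field′ → x < 2 ^ w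
  field<2^w x< = <-trans x< (^-monoʳ-< 2 (s≤s (s≤s z≤n)) field<w)

  Z-room : 5 + lg Z ≤ w
  Z-room = log-room-5 (≤-trans (within-budget 5 Z≤5S (≤-trans (m≤m+n 5 784) 789≤budget))
    (*-monoʳ-≤ (2 ^ budgetBits) (m≤n+m S most)))

  module _ {c : ℕ} {f : ℕ → ℕ} where

    counting : (∀ j → j < c → f j ≤ most) → Admissible w field′ (segment (suc L) c f)
    counting f≤ = admissible (s≤s z≤n)
      (≤-trans (m≤n+m (2 + L) 3) (log-room-5 (≤-trans (m≤n*m most (2 ^ budgetBits) {{m^n≢0 2 budgetBits}})
        (*-monoʳ-≤ (2 ^ budgetBits) (m≤m+n most S)))))
      (<2^field (within-budget 2 (+-mono-≤ 1≤S (≤-trans L≤S (≤-reflexive (sym (+-identityʳ S)))))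
        2≤2^budgetBits))
      (λ j j< → ≤-<-trans (≤-trans (f≤ j j<) (n≤2^lg most)) (^-monoʳ-< 2 (s≤s (s≤s z≤n)) (n<1+n L)))

    logarithmic : ∀ x → 1 ≤ x → x ≤ S → (∀ j → j < c → f j < x) → Admissible w field′ (segment (lg x) c f)
    logarithmic x 1≤x x≤S f< = admissible (1≤lg x)
      (≤-trans (m≤n+m (1 + lg x) 4) (log-room-5 (≤-trans x≤S (≤-trans (m≤n+m S most)
        (m≤n*m (most + S) (2 ^ budgetBits) {{m^n≢0 2 budgetBits}})))))
      (<2^field (within-budget 1 (≤-trans (lg≤n 1≤x) (≤-trans x≤S (≤-reflexive (sym (+-identityʳ S)))))
        (<⇒≤ 2≤2^budgetBits)))
      (λ j j< → <-≤-trans (f< j j<) (n≤2^lg x))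

    blocky : (∀ j → j < c → f j ≤ Z) → Admissible w field′ (segment (suc (lg Z)) c f)
    blocky f≤ = admissible (s≤s z≤n)
      (≤-trans (m≤n+m (2 + lg Z) 3) Z-room)
      (<2^field (within-budget 6 (+-mono-≤ 1≤S (≤-trans (lg≤n (s≤s z≤n)) Z≤5S))
        (≤-trans (m≤m+n 6 783) 789≤budget)))
      (λ j j< → ≤-<-trans (≤-trans (f≤ j j<) (n≤2^lg Z)) (^-monoʳ-< 2 (s≤s (s≤s z≤n)) (n<1+n (lg Z))))

    coded : (∀ j → j < c → f j < 2 ^ full) → Admissible w field′ (segment full c f)
    coded f< = admissible (s≤s z≤n)
      (≤-trans (s≤s full≤) (≤-trans (m≤n+m (3 + lg Z) 2) Z-room))
      (<2^field (within-budget 10 (≤-trans full≡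
        (≤-trans (*-monoʳ-≤ 2 (≤-trans half≤Z Z≤5S)) (≤-reflexive (sym (*-assoc 2 5 S)))))
        (≤-trans (m≤m+n 10 779) 789≤budget)))
      f<
      where
      full≤ : full ≤ 2 + lg Z
      full≤ = begin
        suc e + suc e     ≡⟨ solve 1 (λ e → con 1 :+ e :+ (con 1 :+ e) := con 2 :+ (e :+ e)) refl e ⟩
        2 + (e + e)       ≤⟨ +-monoʳ-≤ 2
          (≤-trans (≤-trans (m≤m+n (e + e) (6 * e))
            (≤-reflexive (solve 1 (λ e → e :+ e :+ con 6 :* e := e :* con 8) refl e))) (m/n*n≤m (lg Z) 8)) ⟩
        2 + lg Z          ∎
        where open ≤-Reasoning

  scalars-admissible : Admissible w field′
    (segment field′ 5 (nth (k ∷ rowStride ∷ arcStride ∷ half ∷ full ∷ [])))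
  scalars-admissible = admissible (s≤s z≤n) field<w (n<2^n field′) λ j j< → <2^field
    (within-budget 10 (values j j<) (≤-trans (m≤m+n 10 779) 789≤budget))
    where
    values : ∀ j → j < 5 → nth (k ∷ rowStride ∷ arcStride ∷ half ∷ full ∷ []) j ≤ 10 * S
    values 0 _ = ≤-trans k≤S (m≤n*m S 10)
    values 1 _ = ≤-trans (+-mono-≤ 1≤S (*-monoˡ-≤ 2 order≤S))
      (≤-trans (≤-reflexive (solve 1 (λ s → s :+ s :* con 2 := con 3 :* s) refl S))
        (*-monoˡ-≤ S (m≤m+n 3 7)))
    values 2 _ = ≤-trans (+-mono-≤ 1≤S (*-monoˡ-≤ 4 edges≤S))
      (≤-trans (≤-reflexive (solve 1 (λ s → s :+ s :* con 4 := con 5 :* s) refl S))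
        (*-monoˡ-≤ S (m≤m+n 5 5)))
    values 3 _ = ≤-trans (≤-trans half≤Z Z≤5S) (*-monoˡ-≤ S (m≤m+n 5 5))
    values 4 _ = ≤-trans full≡ (≤-trans (*-monoʳ-≤ 2 (≤-trans half≤Z Z≤5S))
      (≤-reflexive (sym (*-assoc 2 5 S))))
    values (suc (suc (suc (suc (suc _))))) (s≤s (s≤s (s≤s (s≤s (s≤s ())))))

  level< : ∀ {s t} .{{_ : NonZero s}} → t < k * s → t / s < k
  level< t< = m<n*o⇒m/o<n t<

  at-map-≤ : ∀ {A : Set} {b} (f : A → ℕ) xs i → (∀ {x} → x ∈ xs → f x ≤ b) → at 0 (map f xs) i ≤ b
  at-map-≤ f xs i f≤ = ≤-pred (at-map-< f xs i (s≤s z≤n) (s≤s ∘ f≤))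

  block-values : ∀ v (mono : Monotone v) → (∀ r → v r ≤ order * 2 + N) →
    let open Blocks v mono N half full ≤-refl in
    (∀ j → j < blockCount → blockOrdinal j ≤ Z) × (∀ j → j < blockCount → groupFirst j ≤ Z) ×
    (∀ j → j < blockCount → groupValue j ≤ Z)
  block-values v mono v≤ =
    (λ j j< → ≤-trans (ordinal≤ (j * half)) (≤-trans (m/n≤m (point (j * half)) half)
      (≤-trans (+-mono-≤ (≤-trans (v≤ (j * half)) (m≤m+n (order * 2 + N) N))
                         (≤-trans (*-monoˡ-≤ half (≤-pred j<)) (m/n*n≤m biggest half))) (n≤1+n _)))) ,
    (λ j _ → ≤-trans (least≤ ordinal j N) (≤-trans (m≤n+m N (order * 2 + N)) biggest≤Z)) ,
    (λ j _ → ≤-trans (v≤ (firstOf j)) (≤-trans (m≤m+n (order * 2 + N) N) biggest≤Z))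
    where open Blocks v mono N half full ≤-refl

  suffixClassValues = block-values (clamped suffixClasses) suffixClasses-monotone suffixClasses≤
  suffixRankValues  = block-values (clamped suffixRanks) suffixRanks-monotone suffixRanks≤

  all-admissible : VecAll.All (Admissible w field′) segments
  all-admissible =
      scalars-admissible
    VecAll.∷ logarithmic σ 1≤σ σ≤S (λ j _ → at-map-< toℕ letters j 1≤σ (λ {c} _ → Fin.toℕ<n c))
    VecAll.∷ counting (λ t t< → ≤-trans (rowStart≤ row (firsts (t / rowStride)) (t % rowStride))
      (arcs≤most (level< t<)))
    VecAll.∷ counting (λ t t< → at-map-≤ (λ (φ , c) → letterId c) (arcs (t / arcStride)) (t % arcStride)
                (λ {(φ , c)} _ → ≤-trans (FinRank.rank≤ letters c) letters≤most))
    VecAll.∷ counting (λ t t< → at-map-≤ (λ (φ , c) → classId (c ∷ φ)) (arcs (t / arcStride))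
      (t % arcStride)
                (λ {(φ , c)} x∈ → ≤-trans (<⇒≤ (classId< (proj₂ (∈-arcs⁻ x∈)))) (classes≤ (level< t<))))
    VecAll.∷ counting (λ t t< → at-map-≤ (λ (φ , c) → offset (c ∷ φ)) (arcs (t / arcStride)) (t % arcStride)
                (λ {(φ , c)} _ → ≤-trans (between≤ (first (c ∷ φ)) (c ∷ φ) (merList (suc (t / arcStride))))
                  (mers≤most (level< t<))))
    VecAll.∷ logarithmic order vertex≥1 order≤S (λ j _ → at-map-< leftPos (firsts k) j vertex≥1
                (λ ρ∈ → leftPos< (proj₁ (∈-firsts⁻ ρ∈))))
    VecAll.∷ logarithmic order vertex≥1 order≤S (λ j _ → at-map-< rightPos (firsts k) j vertex≥1
                (λ ρ∈ → rightPos< (proj₁ (∈-firsts⁻ ρ∈))))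
    VecAll.∷ counting (λ j _ → at-map-≤ startRank (firsts k) j
                (λ ρ∈ → ≤-trans (startRank≤ (proj₁ (∈-firsts⁻ ρ∈))) (mers≤most ≤-refl)))
    VecAll.∷ counting (λ j _ → at-map-≤ (λ φ → rank φ (merList k)) (firsts k) j
                (λ {φ} _ → ≤-trans (rank≤ (merList k) φ) (mers≤most ≤-refl)))
    VecAll.∷ counting (λ x _ → at-map-≤ classId (filter (λ φ → code φ ≟ x) (firsts k)) 0
                (λ {φ} φ∈ → ≤-trans (rank≤ (firsts k) (first φ)) (classes≤ ≤-refl)))
    VecAll.∷ counting (λ j _ → at-map-≤ (λ φ → rank φ (rightList k′)) (firsts k′) j
                (λ {φ} _ → ≤-trans (rank≤ (rightList k′) φ) (≤-trans (rightList≤ k′) (mers≤most ≤-refl))))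
    VecAll.∷ blocky (proj₁ suffixClassValues)
    VecAll.∷ coded (λ j _ → ClassBlocks.code-bound ClassBlocks.ordinal (j * half))
    VecAll.∷ blocky (proj₁ (proj₂ suffixClassValues))
    VecAll.∷ blocky (proj₂ (proj₂ suffixClassValues))
    VecAll.∷ coded (λ j _ → ClassBlocks.code-bound (clamped suffixClasses) (ClassBlocks.firstOf j))
    VecAll.∷ blocky (proj₁ suffixRankValues)
    VecAll.∷ coded (λ j _ → RankBlocks.code-bound RankBlocks.ordinal (j * half))
    VecAll.∷ blocky (proj₁ (proj₂ suffixRankValues))
    VecAll.∷ blocky (proj₂ (proj₂ suffixRankValues))
    VecAll.∷ coded (λ j _ → RankBlocks.code-bound (clamped suffixRanks) (RankBlocks.firstOf j))
    VecAll.∷ coded (λ j _ → ≤-<-trans (decodeTable≤ full j) (n<2^n full))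
    VecAll.∷ VecAll.[]
    where
    arcs≤most : ∀ {ℓ} → ℓ < k → length (arcs ℓ) ≤ most
    arcs≤most {ℓ} ℓ<k = ≤-trans (arcs≤merList ℓ) (mers≤most ℓ<k)

  opaque
    bits : List Bool
    bits = layout g′ segments

  layout-size : fieldWidth g′ * (1 + 2 * tableCount) + totalSize segments ≤ budgetFactor * S
  layout-size = begin
    field′ * 47 + totalSize segments       ≤⟨ +-mono-≤ (*-monoˡ-≤ 47 field≤17S) total≤ ⟩
    17 * S * 47 + 2 ^ budgetBits * S       ≡⟨ solve 3
      (λ a s b → con 17 :* s :* a :+ b :* s := (con 17 :* a :+ b) :* s) refl 47 S (2 ^ budgetBits) ⟩
    (17 * 47 + 2 ^ budgetBits) * S         ≤⟨ *-monoˡ-≤ S layout≤budgetFactor ⟩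
    budgetFactor * S                       ∎
    where open ≤-Reasoning

  room : fieldWidth g′ * (1 + 2 * tableCount) + totalSize segments + 1 < 2 ^ w
  room = begin-strict
    fieldWidth g′ * (1 + 2 * tableCount) + totalSize segments + 1 ≤⟨ +-mono-≤ layout-size 1≤S ⟩
    budgetFactor * S + S               ≡⟨ trans (cong (budgetFactor * S +_) (sym (*-identityˡ S)))
      (sym (*-distribʳ-+ S budgetFactor 1)) ⟩
    (budgetFactor + 1) * S             ≤⟨ *-monoˡ-≤ S budgetFactor< ⟩
    wordFactor * S                     <⟨ *-monoʳ-< wordFactor {{wordFactor≢0}} (+-monoˡ-≤ S 1≤most) ⟩
    wordFactor * (most + S)            ≤⟨ sufficient ⟩
    2 ^ w                              ∎
    where
    open ≤-Reasoning
    wordFactor≢0 : NonZero wordFactor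
    wordFactor≢0 = m*n≢0 (2 ^ budgetBits) (2 ^ spareBits) {{m^n≢0 2 budgetBits}} {{m^n≢0 2 spareBits}}

  admitted : ∀ i → Admissible w field′ (lookup segments i)
  admitted = VecAll.lookup⁺ all-admissible

  fits : Fits w g′ segments
  fits = record
    { header-fits = field<w
    ; header-room = room
    ; sizes-fit   = <2^field total≤
    ; widths-fit  = λ i → modest (admitted i)
    ; width<w     = λ i → narrow (admitted i)
    ; content-fit = λ i → fitting (admitted i)
    }

  most<2^w : most < 2 ^ w
  most<2^w = begin-strict
    most                         <⟨ m<m+n most 1≤S ⟩
    most + S                     ≤⟨ m≤n*m (most + S) wordFactor
      {{m*n≢0 (2 ^ budgetBits) (2 ^ spareBits) {{m^n≢0 2 budgetBits}} {{m^n≢0 2 spareBits}}}} ⟩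
    wordFactor * (most + S)      ≤⟨ sufficient ⟩
    2 ^ w                        ∎
    where open ≤-Reasoning

  counts< : ∀ i → Segment.count (lookup segments i) < 2 ^ w
  counts< i = ≤-<-trans (≤-trans
    (≤-trans (m≤m*n _ (Segment.width (lookup segments i)) {{>-nonZero (positive (admitted i))}})
      (≤-trans (m≤n+m (footprint (lookup segments i)) (lookup (offsets segments) i))
        (offset-bound segments i)))
      (≤-trans (m≤n+m (totalSize segments) (fieldWidth g′ * (1 + 2 * tableCount))) (m≤m+n _ 1))) room

  8<2^w : 8 < 2 ^ w
  8<2^w = ≤-<-trans (≤-trans (≤-trans (m≤m+n 8 39) (m≤n*m 47 (fieldWidth g′)))
    (≤-trans (m≤m+n (fieldWidth g′ * 47) (totalSize segments)) (m≤m+n _ 1))) room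

  entries< : ∀ i j → j < Segment.count (lookup segments i) → Segment.content (lookup segments i) j < 2 ^ w
  entries< i j j< = <-trans (fitting (admitted i) j j<) (^-monoʳ-< 2 (s≤s (s≤s z≤n)) (narrow (admitted i)))

  0<w : 0 < w
  0<w = ≤-<-trans z≤n field<w

  biggest< : biggest < 2 ^ w
  biggest< = field<2^w (<2^field
    (within-budget 5 (≤-trans biggest≤Z Z≤5S) (≤-trans (m≤m+n 5 784) 789≤budget)))

  mers< : ∀ {ℓ} → ℓ ≤ k → length (merList ℓ) < 2 ^ w
  mers< ℓ≤k = ≤-<-trans (mers≤most ℓ≤k) most<2^w

  opaque
    unfolding bits

    bits-size : length bits ≤ budgetFactor * S
    bits-size = ≤-trans (≤-reflexive (length-layout g′ segments)) layout-size

    reads : ∀ (mem : ℕ → ℕ) → let open Semantics w (dataWord w bits) mem in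
            ∀ {n} {ρ : Vec ℕ n} (s : Fin tableCount) {e : Expr n} {j} → ⟦ e ⟧ ρ ≡ j →
            j < Segment.count (lookup segments s) → ⟦ read s e ⟧ ρ ≡ Segment.content (lookup segments s) j
    reads mem {ρ = ρ} s {e} = read-value w g′ segments mem fits {ρ = ρ} s {e}

  Executes : (ℕ → ℕ) → Stmt 7 → List ℕ → ℕ → Set
  Executes mem st o b = ∃[ s ] Timed._⊢_⇓_/_within_ w (dataWord w bits) mem (Vec.replicate 7 0) st s o b

  module _ (mem : ℕ → ℕ) where

    retrieves : ∀ {τ : Mer k} {u v} → RContains τ → Extent τ u v →
      (∀ {i} → i < k → mem i ≡ nth (encodeMer (reverse τ)) i) → ∀ e → σ ≤ 2 ^ e →
      Executes mem retrieveStmt (position u ∷ position v ∷ suc (rank τ (reachList u)) ∷ [])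
        (readCost e k + straight outputHandle)
    retrieves = Correct.Run.retrieves W O det k′ widths w (dataWord w bits) mem
      (reads mem) entries< counts< 0<w 8<2^w biggest< mers<

    lists : ∀ {ρ : Mer k} (r : RContains ρ) {u v} → Extent ρ u v → mem 0 ≡ position u → mem 1 ≡ position v →
      mem 2 ≡ suc (rank ρ (reachList u)) →
      Executes mem listStmt (encodeLabels (labels (first (front ρ))))
        (straight resolve + (straight rowBounds + listCost (length (labels (first (front ρ))))))
    lists = Correct.Run.lists W O det k′ widths w (dataWord w bits) mem
      (reads mem) entries< counts< 0<w 8<2^w biggest< mers<

    forwards : ∀ {ρ : Mer k} (r : RContains ρ) {u v u′ v′ c} → Extent ρ u v → RContains (c ∷ front ρ) →
      Extent (c ∷ front ρ) u′ v′ →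
      mem 0 ≡ position u → mem 1 ≡ position v → mem 2 ≡ suc (rank ρ (reachList u)) → mem 3 ≡ toℕ c →
      ∀ e → σ ≤ 2 ^ e →
      Executes mem forwardStmt (position u′ ∷ position v′ ∷ suc (rank (c ∷ front ρ) (reachList u′)) ∷ [])
        (straight resolve + (straight forwardOffset +
          (straight readLetter + (followCost e + straight outputHandle))))
    forwards = Correct.Run.forwards W O det k′ widths w (dataWord w bits) mem
      (reads mem) entries< counts< 0<w 8<2^w biggest< mers<

opaque
  timeFactor : ℕ
  timeFactor = retrieveRate + listRate + forwardRate + budgetFactor

  retrieveRate≤ : retrieveRate ≤ timeFactor
  retrieveRate≤ = ≤-trans (≤-trans (m≤m+n retrieveRate listRate)
    (m≤m+n (retrieveRate + listRate) forwardRate)) (m≤m+n _ budgetFactor)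

  listRate≤ : listRate ≤ timeFactor
  listRate≤ = ≤-trans (≤-trans (m≤n+m listRate retrieveRate) (m≤m+n (retrieveRate + listRate) forwardRate))
    (m≤m+n _ budgetFactor)

  forwardRate≤ : forwardRate ≤ timeFactor
  forwardRate≤ = ≤-trans (m≤n+m forwardRate (retrieveRate + listRate)) (m≤m+n _ budgetFactor)

  budgetFactor≤ : budgetFactor ≤ timeFactor
  budgetFactor≤ = m≤n+m budgetFactor (retrieveRate + listRate + forwardRate)

rate-within : ∀ {b u a} → b ≤[ u ] a → a ≤ timeFactor → b ≤ timeFactor * u
rate-within {u = u} (rate p) a≤ = ≤-trans p (*-monoˡ-≤ u a≤)

-- From executions to queries on the de Bruijn graph

module Queries {σ : ℕ} (W : LabeledGraph σ) (O : WheelerOrder W) (det : Deterministic W) (k′ w : ℕ)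
               (sufficient : WordSizeSuffices wordFactor W (suc k′) w)
               {τ₀ : Vec (Fin σ) (suc k′)} (contained : Reversed.RContains W τ₀) where
  open Reversed W
  open Handles W O det
  open WheelerOrder O using (position)

  private
    k = suc k′

  bits : List Bool
  bits = Instance.bits W O det k′ w sufficient contained

  bits-small : length bits ≤ timeFactor * spaceBound W k
  bits-small = ≤-trans (Instance.bits-size W O det k′ w sufficient contained)
    (*-monoˡ-≤ (spaceBound W k) budgetFactor≤)

  answers : ∀ {query s out b} {st : Stmt 7} {t} →
    Timed._⊢_⇓_/_within_ w (dataWord w bits) (nth query) (Vec.replicate 7 0) st s out b →
    b ≤ t → Answers w bits (compile st) query out t
  answers {query} (Timed.timed time≤ run) b≤ = compile-answers w bits query run (≤-trans time≤ b≤)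

  retrieves-handles : RetrievesHandles O k w bits (compile retrieveStmt) timeFactor
  retrieves-handles α cα =
    ⟨ u , v , suc (rank (reverse α) (reachList u)) ⟩ , extent-handle E refl ,
    answers {encodeMer α} (proj₂ (Instance.retrieves W O det k′ w sufficient contained (nth (encodeMer α))
      r E
        (λ {i} _ → cong (λ β → nth (encodeMer β) i) (sym (Vec.reverse-involutive α))) (lg σ) (n≤2^lg σ)))
      (rate-within (retrieve-rate {k} {lg σ} (s≤s z≤n) (1≤lg σ)) retrieveRate≤)
    where
    r : RContains (reverse α)
    r = contains⇒ cα
    u = proj₁ (extent r)
    v = proj₁ (proj₂ (extent r))
    E : Extent (reverse α) u v
    E = proj₂ (proj₂ (extent r))

  -- Dropping the first letter and appending `c` becomes, in reversed reading, `front` followed by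
  -- `c ∷_`.
  outgoing⇒ : ∀ {α : Mer k} {c β} → DBEdge W α c β → reverse β ≡ c ∷ front (reverse α)
  outgoing⇒ (edge {b = b} {c} {α} _ _) = trans (reverse-∷ʳ α c)
    (cong (c ∷_) (sym (trans (cong front (Vec.reverse-∷ b α)) (front-∷ʳ (reverse α) b))))

  outgoing-contains : ∀ {α : Mer k} {c β} → DBEdge W α c β → RContains (c ∷ front (reverse α))
  outgoing-contains d@(edge _ cβ) = subst RContains (outgoing⇒ d) (contains⇒ cβ)

  outgoing⇐ : ∀ {α : Mer k} {c} → Contains W α → RContains (c ∷ front (reverse α)) → OutgoingLabel W α c
  outgoing⇐ {b ∷ α} {c} cα r = α ∷ʳ c , edge cα (contains⇐ (subst RContains
    (sym (trans (reverse-∷ʳ α c)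
      (cong (c ∷_) (sym (trans (cong front (Vec.reverse-∷ b α)) (front-∷ʳ (reverse α) b)))))) r))

  lists-labels : ListsOutgoingLabels O k w bits (compile listStmt) timeFactor
  lists-labels α ⟨ u , v , j ⟩ H =
    -- The labels emitted are those of the representative; by `same-∷` they are also the labels that
    -- extend the suffix itself.
    labels φ , AllPairs.filter⁺ (λ c → rcontains? (c ∷ φ)) (Unique.allFin⁺ σ) ,
    (λ c → (λ c∈ → outgoing⇐ (contains⇐ r) (same-contains {ρ = c ∷ φ}
                (same-∷ c {φ} {η} (same-sym {ρ = η} (first-same ηr)))
                (proj₂ (∈-filter⁻ (λ c → rcontains? (c ∷ φ)) {xs = allFin σ} c∈)))) ,
           (λ (β , d) → ∈-filter⁺ (λ c → rcontains? (c ∷ φ)) (∈-allFin c)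
                (same-contains {ρ = c ∷ η} (same-∷ c {η} {φ} (first-same ηr)) (outgoing-contains d)))) ,
    answers {encodeHandle O ⟨ u , v , j ⟩}
      (proj₂ (Instance.lists W O det k′ w sufficient contained (nth (encodeHandle O ⟨ u , v , j ⟩)) r E
        refl refl j≡))
      (rate-within (list-rate {length (labels φ)} {lg σ} (1≤lg σ)) listRate≤)
    where
    r : RContains (reverse α)
    r = proj₁ (handle-extent H)
    E : Extent (reverse α) u v
    E = proj₁ (proj₂ (handle-extent H))
    j≡ = proj₂ (proj₂ (handle-extent H))
    η φ : Mer k′
    η = front (reverse α)
    φ = first η
    ηr : RContains η
    ηr = proj₁ r , rreach-front (reverse α) (proj₂ r)

  traverses-forward : TraversesForward O k w bits (compile forwardStmt) timeFactor
  traverses-forward α ⟨ u , v , j ⟩ c β H d =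
    ⟨ u′ , v′ , suc (rank (c ∷ η) (reachList u′)) ⟩ ,
    extent-handle (subst (λ ρ → Extent ρ u′ v′) (sym β≡) E′)
      (cong (λ ρ → suc (rank ρ (reachList u′))) (sym β≡)) ,
    answers {encodeHandle O ⟨ u , v , j ⟩ ++ toℕ c ∷ []}
      (proj₂ (Instance.forwards W O det k′ w sufficient contained
        (nth (encodeHandle O ⟨ u , v , j ⟩ ++ toℕ c ∷ [])) r E cr E′
        refl refl j≡ refl (lg σ) (n≤2^lg σ)))
      (rate-within (forward-rate {lg σ} (1≤lg σ)) forwardRate≤)
    where
    r : RContains (reverse α)
    r = proj₁ (handle-extent H)
    E : Extent (reverse α) u v
    E = proj₁ (proj₂ (handle-extent H))
    j≡ = proj₂ (proj₂ (handle-extent H))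
    η : Mer k′
    η = front (reverse α)
    β≡ : reverse β ≡ c ∷ η
    β≡ = outgoing⇒ d
    cr : RContains (c ∷ η)
    cr = outgoing-contains d
    u′ = proj₁ (extent cr)
    v′ = proj₁ (proj₂ (extent cr))
    E′ : Extent (c ∷ η) u′ v′
    E′ = proj₂ (proj₂ (extent cr))

theorem12 : ∃[ retrieve ] ∃[ list ] ∃[ forward ] ∃[ C ] ∃[ c ]
    (∀ (σ : ℕ) (W : LabeledGraph σ) (O : WheelerOrder W) → Deterministic W →
    ∀ (k : ℕ) {{_ : NonZero k}} (w : ℕ) → WordSizeSuffices c W k w →
    ∃[ bits ] length {A = Bool} bits ≤ C * spaceBound W k ×
    RetrievesHandles O k w bits retrieve C ×
    ListsOutgoingLabels O k w bits list C ×
    TraversesForward O k w bits forward C)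
theorem12 = compile retrieveStmt , compile listStmt , compile forwardStmt , timeFactor , wordFactor , build
  where
  build : ∀ (σ : ℕ) (W : LabeledGraph σ) (O : WheelerOrder W) → Deterministic W →
    ∀ (k : ℕ) {{_ : NonZero k}} (w : ℕ) → WordSizeSuffices wordFactor W k w →
    ∃[ bits ] length {A = Bool} bits ≤ timeFactor * spaceBound W k ×
    RetrievesHandles O k w bits (compile retrieveStmt) timeFactor ×
    ListsOutgoingLabels O k w bits (compile listStmt) timeFactor ×
    TraversesForward O k w bits (compile forwardStmt) timeFactor
  build σ W O det (suc k′) w sufficient = choose (merList (suc k′)) refl
    where
    open Reversed W
    open Handles W O det
    choose : ∀ ρs → ρs ≡ merList (suc k′) →
      ∃[ bits ] length {A = Bool} bits ≤ timeFactor * spaceBound W (suc k′) ×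
      RetrievesHandles O (suc k′) w bits (compile retrieveStmt) timeFactor ×
      ListsOutgoingLabels O (suc k′) w bits (compile listStmt) timeFactor ×
      TraversesForward O (suc k′) w bits (compile forwardStmt) timeFactor
    -- Without contained `k`-mers no query meets its premises, so the empty data structure suffices.
    choose [] none = [] , z≤n , (λ α cα → ⊥-elim (absent (contains⇒ cα))) ,
      (λ α h H → ⊥-elim (absent (proj₁ (handle-extent H)))) ,
      (λ α h c β H _ → ⊥-elim (absent (proj₁ (handle-extent H))))
      where
      absent : ∀ {ρ : Mer (suc k′)} → ¬ RContains ρ
      absent {ρ} r with subst (ρ ∈_) (sym none) (∈-merList r)
      ... | ()
    choose (τ₀ ∷ _) some =
      Queries.bits W O det k′ w sufficient τ₀∈ , Queries.bits-small W O det k′ w sufficient τ₀∈ ,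
      Queries.retrieves-handles W O det k′ w sufficient τ₀∈ ,
      Queries.lists-labels W O det k′ w sufficient τ₀∈ ,
      Queries.traverses-forward W O det k′ w sufficient τ₀∈
      where
      τ₀∈ : RContains τ₀
      τ₀∈ = ∈-merList⁻ (subst (τ₀ ∈_) some (here refl))
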